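{- Let $(\mathbf a,\mathbf b)$ be a Legendre pair of length $\ell=5m$, with $\ell$ odd and $\sum_i a_i=\sum_i b_i=1$, and let $\mathcal A_m=[A_0,\ldots,A_4]$, $\mathcal B_m=[B_0,\ldots,B_4]$ be the $m$-compressions of $\mathbf a,\mathbf b$. Then the following two conditions are equivalent: (i) for some nonnegative integer $x\equiv-(\ell+1)\equiv \ell+1\pmod 4$, $$\mathrm{PSD}_{\mathbf a}(rm)=\ell+1+(-1)^{\lfloor r/2\rfloor}\sqrt5\,x,\qquad \mathrm{PSD}_{\mathbf b}(rm)=\ell+1-(-1)^{\lfloor r/2\rfloor}\sqrt5\,x\qquad\text{for } r=1,\ldots,4;$$ (ii) $p_2(\mathcal A_m)=\mathrm{PAF}_{\mathcal A_m}(0)=p_2(\mathcal B_m)=\mathrm{PAF}_{\mathcal B_m}(0)=4m+1$.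
   Context: For $\mathbf a\in\mathbb{R}^N$ indexed by $\mathbb{Z}_N$: $\mathrm{PAF}_{\mathbf a}(j)=\sum_{i=0}^{N-1}a_i a_{i-j}$ (indices mod $N$), $\mathrm{DFT}_{\mathbf a}(j)=\sum_{r=0}^{N-1}e^{2\pi i jr/N}a_r$, $\mathrm{PSD}_{\mathbf a}(j)=|\mathrm{DFT}_{\mathbf a}(j)|^2$, and $p_2(\mathbf a)=\sum_i a_i^2$. A pair $(\mathbf a,\mathbf b)$ of vectors in $\{ -1,1\}^\ell$ is a Legendre pair of length $\ell$ if $\mathrm{PAF}_{\mathbf a}(j)+\mathrm{PAF}_{\mathbf b}(j)=-2$ for all $j\in\mathbb{Z}_\ell\setminus\{0\}$ and $\sum_i a_i=\sum_i b_i$. For $\ell=nm$, the $m$-compression of $\mathbf a\in\mathbb{R}^\ell$ is $\mathcal A_m=[A_0,\ldots,A_{n-1}]$ with $A_j=\sum_{i=0}^{m-1}a_{ni+j}$ (here $n=5$).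
   Formalization: Condition (i) is taken up to interchanging a and b, because with x nonnegative and the order fixed, (ii) implies (i) fails, e.g. for ℓ=5, a=(-1,1,-1,1,1), b=(-1,-1,1,1,1), where x would have to be -2. -}

module Defs where

open import Algebra.Bundles.Raw using (RawMonoid)
import Algebra.Definitions.RawMonoid as RawMonoidOps
open import Data.Fin.Base using (Fin; zero; toℕ; combine)
open import Data.Integer.Base as ℤ using (ℤ; +_; -[1+_]; 0ℤ; 1ℤ; -1ℤ)
import Data.Integer.Divisibility as ℤ
import Data.Integer.Properties as ℤₚ
open import Data.Nat.Base as ℕ using (ℕ; zero; suc; z≤n; s≤s; ⌊_/2⌋)
import Data.Nat.Properties as ℕₚ
open import Data.Nat.DivMod using (_mod_)
import Data.Nat.Solver as ℕ-Solver
open import Data.Product.Base using (∃; ∃-syntax; _×_; _,_; proj₁; proj₂)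
open import Data.Rational.Base
open import Data.Rational.Literals using (fromℤ)
open import Data.Rational.Properties
open import Data.Rational.Solver using (module +-*-Solver)
import Data.Rational.Unnormalised.Base as ℚᵘ
import Data.Rational.Unnormalised.Properties as ℚᵘₚ
open import Data.Sum.Base using (_⊎_; inj₁; inj₂)
open import Function.Base using (_∘_)
open import Level using (0ℓ)
open import Relation.Binary.PropositionalEquality
  using (_≡_; _≢_; refl; sym; trans; cong; cong₂; subst; subst₂)
open import Relation.Nullary.Decidable.Core using (yes; no)

open +-*-Solver using (solve; _:=_; _:+_; _:*_; :-_; con)

0≤1ℚ : 0ℚ ≤ 1ℚ
0≤1ℚ = *≤* (ℤ.+≤+ z≤n)

0<1ℚ : 0ℚ < 1ℚ
0<1ℚ = *<* (ℤ.+<+ (s≤s z≤n))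

0≤-* : ∀ {p q} → 0ℚ ≤ p → 0ℚ ≤ q → 0ℚ ≤ p * q
0≤-* {p} {q} hp hq =
  nonNegative⁻¹ (p * q)
    {{nonNeg*nonNeg⇒nonNeg p {{nonNegative hp}} q {{nonNegative hq}}}}

0<-* : ∀ {p q} → 0ℚ < p → 0ℚ < q → 0ℚ < p * q
0<-* {p} {q} hp hq =
  positive⁻¹ (p * q) {{pos*pos⇒pos p {{positive hp}} q {{positive hq}}}}

0≤-+ : ∀ {p q} → 0ℚ ≤ p → 0ℚ ≤ q → 0ℚ ≤ p + q
0≤-+ {p} {q} hp hq = subst (_≤ p + q) (+-identityˡ 0ℚ) (+-mono-≤ hp hq)

*-monoˡ-0≤ : ∀ {r p q} → 0ℚ ≤ r → p ≤ q → r * p ≤ r * q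
*-monoˡ-0≤ {r} hr = *-monoˡ-≤-nonNeg r {{nonNegative hr}}

*-monoʳ-0≤ : ∀ {r p q} → 0ℚ ≤ r → p ≤ q → p * r ≤ q * r
*-monoʳ-0≤ {r} hr = *-monoʳ-≤-nonNeg r {{nonNegative hr}}

*-mono-0≤ : ∀ {p q r s} → 0ℚ ≤ q → 0ℚ ≤ r → p ≤ q → r ≤ s → p * r ≤ q * s
*-mono-0≤ hq hr p≤q r≤s = ≤-trans (*-monoʳ-0≤ hr p≤q) (*-monoˡ-0≤ hq r≤s)

p≤p+q : ∀ p {q} → 0ℚ ≤ q → p ≤ p + q
p≤p+q p {q} hq = subst (_≤ p + q) (+-identityʳ p) (+-monoʳ-≤ p hq)

p≤q+p : ∀ p {q} → 0ℚ ≤ q → p ≤ q + p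
p≤q+p p {q} hq = subst (_≤ q + p) (+-identityˡ p) (+-monoˡ-≤ p hq)

∣p-q∣≡∣q-p∣ : ∀ p q → ∣ p - q ∣ ≡ ∣ q - p ∣
∣p-q∣≡∣q-p∣ p q =
  trans (cong ∣_∣ (solve 2 (λ p q → p :+ :- q := :- (q :+ :- p)) refl p q))
        (∣-p∣≡∣p∣ (q - p))

p≤∣p∣ : ∀ p → p ≤ ∣ p ∣
p≤∣p∣ p with ≤-total 0ℚ p
... | inj₁ 0≤p = ≤-reflexive (sym (0≤p⇒∣p∣≡p 0≤p))
... | inj₂ p≤0 = ≤-trans p≤0 (0≤∣p∣ p)

p<q+r⇒p-q<r : ∀ {p q r} → p < q + r → p - q < r
p<q+r⇒p-q<r {p} {q} {r} h =
  subst (p - q <_) (solve 2 (λ q r → q :+ r :+ :- q := r) refl q r)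
        (+-monoˡ-< (- q) h)

p≤q+r⇒p-q≤r : ∀ {p q r} → p ≤ q + r → p - q ≤ r
p≤q+r⇒p-q≤r {p} {q} {r} h =
  subst (p - q ≤_) (solve 2 (λ q r → q :+ r :+ :- q := r) refl q r)
        (+-monoˡ-≤ (- q) h)

∣∣-≤ : ∀ {p q} → p ≤ q → - p ≤ q → ∣ p ∣ ≤ q
∣∣-≤ {p} {q} h₁ h₂ with ∣p∣≡p∨∣p∣≡-p p
... | inj₁ e = subst (_≤ q) (sym e) h₁
... | inj₂ e = subst (_≤ q) (sym e) h₂

∣∣-< : ∀ {p q} → p < q → - p < q → ∣ p ∣ < q
∣∣-< {p} {q} h₁ h₂ with ∣p∣≡p∨∣p∣≡-p p
... | inj₁ e = subst (_< q) (sym e) h₁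
... | inj₂ e = subst (_< q) (sym e) h₂

fromℤ-+ : ∀ i j → fromℤ (i ℤ.+ j) ≡ fromℤ i + fromℤ j
fromℤ-+ i j = toℚᵘ-injective
  (ℚᵘₚ.≃-trans (ℚᵘₚ.≃-reflexive (cong (λ k → ℚᵘ.mkℚᵘ k 0)
      (sym (cong₂ ℤ._+_ (ℤₚ.*-identityʳ i) (ℤₚ.*-identityʳ j)))))
    (ℚᵘₚ.≃-sym (toℚᵘ-homo-+ (fromℤ i) (fromℤ j))))

fromℕ : ℕ → ℚ
fromℕ n = fromℤ (+ n)

fromℕ-suc : ∀ n → fromℕ (suc n) ≡ 1ℚ + fromℕ n
fromℕ-suc n = fromℤ-+ 1ℤ (+ n)

fromℕ-mono : ∀ {m n} → m ℕ.≤ n → fromℕ m ≤ fromℕ n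
fromℕ-mono {m} {n} h =
  *≤* (subst₂ ℤ._≤_ (sym (ℤₚ.*-identityʳ (+ m))) (sym (ℤₚ.*-identityʳ (+ n)))
        (ℤ.+≤+ h))

0≤fromℕ : ∀ n → 0ℚ ≤ fromℕ n
0≤fromℕ n = fromℕ-mono {0} {n} z≤n

1/suc : ℕ → ℚ
1/suc k = 1/ fromℕ (suc k)

0<1/suc : ∀ k → 0ℚ < 1/suc k
0<1/suc k = positive⁻¹ (1/suc k)

0≤1/suc : ∀ k → 0ℚ ≤ 1/suc k
0≤1/suc k = <⇒≤ (0<1/suc k)

suc*1/suc : ∀ k → fromℕ (suc k) * 1/suc k ≡ 1ℚ
suc*1/suc k = *-inverseʳ (fromℕ (suc k))

archimedean : ∀ p → ∃[ n ] p ≤ fromℕ n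
archimedean (mkℚ (+ n) d _) = n ,
  *≤* (ℤₚ.≤-trans (ℤₚ.≤-reflexive (ℤₚ.*-identityʳ (+ n)))
        (subst (+ n ℤ.≤_) (ℤₚ.pos-* n (suc d)) (ℤ.+≤+ (ℕₚ.m≤m*n n (suc d)))))
archimedean p@(mkℚ -[1+ n ] d _) = 0 , <⇒≤ (negative⁻¹ p)

shrink : ∀ K ε → 0ℚ < K → 0ℚ < ε → ∃[ δ ] 0ℚ < δ × K * δ ≡ ε
shrink K ε 0<K 0<ε = δ , 0<-* 0<ε 0<K⁻¹ , eq
  where
  instance
    K-pos : Positive K
    K-pos = positive 0<K
    K≢0 : NonZero K
    K≢0 = pos⇒nonZero K
  δ = ε * 1/ K
  0<K⁻¹ : 0ℚ < 1/ K
  0<K⁻¹ = positive⁻¹ (1/ K) {{1/pos⇒pos K}}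
  eq : K * δ ≡ ε
  eq = trans (solve 3 (λ k e i → k :* (e :* i) := e :* (k :* i)) refl K ε (1/ K))
         (trans (cong (ε *_) (*-inverseʳ K)) (*-identityʳ ε))

small : ∀ ε → 0ℚ < ε → ∃[ N ] 1/suc N < ε
small ε 0<ε = go (shrink ε 1ℚ 0<ε 0<1ℚ)
  where
  step : ∀ δ n → ε * δ ≡ 1ℚ → δ ≤ fromℕ n → 1/suc n < ε
  step δ n εδ≡1 δ≤n = subst₂ _<_ (*-identityˡ r) εsr≡ε
      (*-monoˡ-<-pos r {{positive (0<1/suc n)}} 1<ε*suc)
    where
    r = 1/suc n
    δ<suc : δ < fromℕ (suc n)
    δ<suc = ≤-<-trans δ≤n
      (subst₂ _<_ (+-identityˡ (fromℕ n)) (sym (fromℕ-suc n))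
        (+-monoˡ-< (fromℕ n) 0<1ℚ))
    1<ε*suc : 1ℚ < ε * fromℕ (suc n)
    1<ε*suc = subst (_< ε * fromℕ (suc n)) εδ≡1
      (*-monoʳ-<-pos ε {{positive 0<ε}} δ<suc)
    εsr≡ε : ε * fromℕ (suc n) * r ≡ ε
    εsr≡ε = trans (*-assoc ε (fromℕ (suc n)) r)
      (trans (cong (ε *_) (suc*1/suc n)) (*-identityʳ ε))
  go : (∃[ δ ] 0ℚ < δ × ε * δ ≡ 1ℚ) → ∃[ N ] 1/suc N < ε
  go (δ , _ , εδ≡1) =
    proj₁ (archimedean δ) , step δ _ εδ≡1 (proj₂ (archimedean δ))

IsCauchy : (ℕ → ℚ) → Set
IsCauchy x = ∀ ε → 0ℚ < ε →
  ∃[ N ] ∀ m n → N ℕ.≤ m → N ℕ.≤ n → ∣ x m - x n ∣ < ε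

record ℝ : Set where
  constructor mkℝ
  field
    seq    : ℕ → ℚ
    cauchy : IsCauchy seq
open ℝ public

infix 4 _≃ℝ_ _<ℝ_

_≃ℝ_ : ℝ → ℝ → Set
x ≃ℝ y = ∀ ε → 0ℚ < ε → ∃[ N ] ∀ n → N ℕ.≤ n → ∣ seq x n - seq y n ∣ < ε

_<ℝ_ : ℝ → ℝ → Set
x <ℝ y = ∃[ ε ] 0ℚ < ε × ∃[ N ] ∀ n → N ℕ.≤ n → seq x n + ε ≤ seq y n

maxUpTo : (ℕ → ℚ) → ℕ → ℚ
maxUpTo x zero    = ∣ x 0 ∣
maxUpTo x (suc n) = maxUpTo x n + ∣ x (suc n) ∣

0≤maxUpTo : ∀ x n → 0ℚ ≤ maxUpTo x n
0≤maxUpTo x zero    = 0≤∣p∣ (x 0)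
0≤maxUpTo x (suc n) = 0≤-+ (0≤maxUpTo x n) (0≤∣p∣ (x (suc n)))

≤maxUpTo : ∀ x n k → k ℕ.≤ n → ∣ x k ∣ ≤ maxUpTo x n
≤maxUpTo x zero    .zero z≤n = ≤-refl
≤maxUpTo x (suc n) k k≤1+n with ℕₚ.m≤n⇒m<n∨m≡n k≤1+n
... | inj₁ (s≤s k≤n) =
  ≤-trans (≤maxUpTo x n k k≤n) (p≤p+q (maxUpTo x n) (0≤∣p∣ (x (suc n))))
... | inj₂ refl = p≤q+p ∣ x (suc n) ∣ (0≤maxUpTo x n)

cauchy⇒bounded : ∀ x → IsCauchy x → ∃[ B ] 0ℚ ≤ B × ∀ n → ∣ x n ∣ ≤ B
cauchy⇒bounded x cx = go (cx 1ℚ 0<1ℚ)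
  where
  go : (∃[ N ] ∀ m n → N ℕ.≤ m → N ℕ.≤ n → ∣ x m - x n ∣ < 1ℚ) →
       ∃[ B ] 0ℚ ≤ B × ∀ n → ∣ x n ∣ ≤ B
  go (N , h) = B , 0≤B , bound
    where
    M = maxUpTo x N
    B = M + 1ℚ
    0≤B = 0≤-+ (0≤maxUpTo x N) 0≤1ℚ
    bound : ∀ n → ∣ x n ∣ ≤ B
    bound n with ℕₚ.≤-total n N
    ... | inj₁ n≤N = ≤-trans (≤maxUpTo x N n n≤N) (p≤p+q M 0≤1ℚ)
    ... | inj₂ N≤n =
      ≤-trans (≤-reflexive (cong ∣_∣ (solve 2
                 (λ a b → a := b :+ (a :+ :- b)) refl (x n) (x N))))
        (≤-trans (∣p+q∣≤∣p∣+∣q∣ (x N) (x n - x N))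
          (+-mono-≤ (≤maxUpTo x N N ℕₚ.≤-refl)
                    (<⇒≤ (h n N N≤n ℕₚ.≤-refl))))

+-cauchy : ∀ x y → IsCauchy x → IsCauchy y → IsCauchy (λ n → x n + y n)
+-cauchy x y cx cy ε 0<ε = go (shrink (1ℚ + 1ℚ) ε 0<2 0<ε)
  where
  0<2 : 0ℚ < 1ℚ + 1ℚ
  0<2 = *<* (ℤ.+<+ (s≤s z≤n))
  go : (∃[ δ ] 0ℚ < δ × (1ℚ + 1ℚ) * δ ≡ ε) →
       ∃[ N ] ∀ m n → N ℕ.≤ m → N ℕ.≤ n → ∣ x m + y m - (x n + y n) ∣ < ε
  go (δ , 0<δ , eq) = go′ (cx δ 0<δ) (cy δ 0<δ)
    where
    go′ : (∃[ N ] ∀ m n → N ℕ.≤ m → N ℕ.≤ n → ∣ x m - x n ∣ < δ) →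
          (∃[ N ] ∀ m n → N ℕ.≤ m → N ℕ.≤ n → ∣ y m - y n ∣ < δ) →
          ∃[ N ] ∀ m n → N ℕ.≤ m → N ℕ.≤ n → ∣ x m + y m - (x n + y n) ∣ < ε
    go′ (N₁ , h₁) (N₂ , h₂) = N₁ ℕ.⊔ N₂ , λ m n hm hn →
      ≤-<-trans (≤-reflexive (cong ∣_∣ (solve 4
          (λ a b c d → a :+ b :+ :- (c :+ d) := (a :+ :- c) :+ (b :+ :- d))
          refl (x m) (y m) (x n) (y n))))
        (≤-<-trans (∣p+q∣≤∣p∣+∣q∣ (x m - x n) (y m - y n))
          (<-≤-trans
            (+-mono-< (h₁ m n (ℕₚ.m⊔n≤o⇒m≤o N₁ N₂ hm) (ℕₚ.m⊔n≤o⇒m≤o N₁ N₂ hn))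
                      (h₂ m n (ℕₚ.m⊔n≤o⇒n≤o N₁ N₂ hm) (ℕₚ.m⊔n≤o⇒n≤o N₁ N₂ hn)))
            (≤-reflexive (trans
              (sym (trans (*-distribʳ-+ δ 1ℚ 1ℚ)
                (cong₂ _+_ (*-identityˡ δ) (*-identityˡ δ)))) eq))))

neg-cauchy : ∀ x → IsCauchy x → IsCauchy (λ n → - x n)
neg-cauchy x cx ε 0<ε = proj₁ (cx ε 0<ε) , λ m n hm hn →
  subst (_< ε) (trans (∣p-q∣≡∣q-p∣ (x m) (x n)) (cong ∣_∣ (solve 2
      (λ a b → b :+ :- a := :- a :+ :- (:- b)) refl (x m) (x n))))
    (proj₂ (cx ε 0<ε) m n hm hn)

*-diff : ∀ {B} p q r s → 0ℚ ≤ B → ∣ p ∣ ≤ B → ∣ s ∣ ≤ B →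
         ∣ p * q - r * s ∣ ≤ B * (∣ p - r ∣ + ∣ q - s ∣)
*-diff {B} p q r s 0≤B hp hs =
  ≤-trans (≤-reflexive (cong ∣_∣ (solve 4
      (λ p q r s → p :* q :+ :- (r :* s) :=
                   s :* (p :+ :- r) :+ p :* (q :+ :- s)) refl p q r s)))
  (≤-trans (∣p+q∣≤∣p∣+∣q∣ (s * (p - r)) (p * (q - s)))
  (≤-trans (≤-reflexive (cong₂ _+_ (∣p*q∣≡∣p∣*∣q∣ s (p - r))
                                   (∣p*q∣≡∣p∣*∣q∣ p (q - s))))
  (≤-trans (+-mono-≤ (*-monoʳ-0≤ (0≤∣p∣ (p - r)) hs)
                     (*-monoʳ-0≤ (0≤∣p∣ (q - s)) hp))
    (≤-reflexive (sym (*-distribˡ-+ B ∣ p - r ∣ ∣ q - s ∣))))))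

combine-< : ∀ {C δ d₁ d₂ d₃} → 0ℚ ≤ C → d₁ < δ → d₂ < δ → d₃ < δ →
            C * (d₁ + d₂) + d₃ < (C + C + 1ℚ) * δ
combine-< {C} {δ} {d₁} {d₂} {d₃} 0≤C h₁ h₂ h₃ =
  <-≤-trans (+-mono-≤-< (*-monoˡ-0≤ 0≤C (+-mono-≤ (<⇒≤ h₁) (<⇒≤ h₂))) h₃)
    (≤-reflexive (trans
      (solve 2 (λ c d → c :* (d :+ d) :+ d := (c :+ c) :* d :+ d) refl C δ)
      (trans (cong (λ z → (C + C) * δ + z) (sym (*-identityˡ δ)))
             (sym (*-distribʳ-+ δ (C + C) 1ℚ)))))

0<2C+1 : ∀ {C} → 0ℚ ≤ C → 0ℚ < C + C + 1ℚ
0<2C+1 {C} 0≤C =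
  subst (_< C + C + 1ℚ) (+-identityˡ 0ℚ) (+-mono-≤-< (0≤-+ 0≤C 0≤C) 0<1ℚ)

*-cauchy : ∀ x y → IsCauchy x → IsCauchy y → IsCauchy (λ n → x n * y n)
*-cauchy x y cx cy ε 0<ε = go (cauchy⇒bounded x cx) (cauchy⇒bounded y cy)
  where
  Goal = ∃[ N ] ∀ m n → N ℕ.≤ m → N ℕ.≤ n → ∣ x m * y m - x n * y n ∣ < ε
  go : (∃[ B ] 0ℚ ≤ B × ∀ n → ∣ x n ∣ ≤ B) →
       (∃[ B ] 0ℚ ≤ B × ∀ n → ∣ y n ∣ ≤ B) → Goal
  go (B₁ , 0≤B₁ , b₁) (B₂ , 0≤B₂ , b₂) =
    go′ (shrink (B + B + 1ℚ) ε (0<2C+1 0≤B) 0<ε)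
    where
    B = B₁ + B₂
    0≤B = 0≤-+ 0≤B₁ 0≤B₂
    go′ : (∃[ δ ] 0ℚ < δ × (B + B + 1ℚ) * δ ≡ ε) → Goal
    go′ (δ , 0<δ , eq) = go″ (cx δ 0<δ) (cy δ 0<δ)
      where
      go″ : (∃[ N ] ∀ m n → N ℕ.≤ m → N ℕ.≤ n → ∣ x m - x n ∣ < δ) →
            (∃[ N ] ∀ m n → N ℕ.≤ m → N ℕ.≤ n → ∣ y m - y n ∣ < δ) → Goal
      go″ (N₁ , h₁) (N₂ , h₂) = N₁ ℕ.⊔ N₂ , λ m n hm hn →
        ≤-<-trans
          (*-diff (x m) (y m) (x n) (y n) 0≤B
            (≤-trans (b₁ m) (p≤p+q B₁ 0≤B₂)) (≤-trans (b₂ n) (p≤q+p B₂ 0≤B₁)))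
          (subst₂ _<_ (+-identityʳ _) eq
            (combine-< 0≤B
              (h₁ m n (ℕₚ.m⊔n≤o⇒m≤o N₁ N₂ hm) (ℕₚ.m⊔n≤o⇒m≤o N₁ N₂ hn))
              (h₂ m n (ℕₚ.m⊔n≤o⇒n≤o N₁ N₂ hm) (ℕₚ.m⊔n≤o⇒n≤o N₁ N₂ hn))
              0<δ))

infix  8 -ℝ_
infixl 7 _*ℝ_
infixl 6 _+ℝ_ _-ℝ_

ℚ→ℝ : ℚ → ℝ
ℚ→ℝ p = mkℝ (λ _ → p) λ ε 0<ε → 0 , λ _ _ _ _ →
  subst (_< ε) (sym (cong ∣_∣ (+-inverseʳ p))) 0<ε

ℤ→ℝ : ℤ → ℝ
ℤ→ℝ i = ℚ→ℝ (fromℤ i)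

0ℝ : ℝ
0ℝ = ℤ→ℝ 0ℤ

_+ℝ_ : ℝ → ℝ → ℝ
x +ℝ y = mkℝ (λ n → seq x n + seq y n)
             (+-cauchy (seq x) (seq y) (cauchy x) (cauchy y))

-ℝ_ : ℝ → ℝ
-ℝ x = mkℝ (λ n → - seq x n) (neg-cauchy (seq x) (cauchy x))

_-ℝ_ : ℝ → ℝ → ℝ
x -ℝ y = x +ℝ (-ℝ y)

_*ℝ_ : ℝ → ℝ → ℝ
x *ℝ y = mkℝ (λ n → seq x n * seq y n)
             (*-cauchy (seq x) (seq y) (cauchy x) (cauchy y))

isqrt : ℕ → ℕ
isqrt zero = 0
isqrt (suc n) with suc (isqrt n) ℕ.* suc (isqrt n) ℕₚ.≤? suc n
... | yes _ = suc (isqrt n)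
... | no  _ = isqrt n

isqrt-lower : ∀ n → isqrt n ℕ.* isqrt n ℕ.≤ n
isqrt-lower zero = z≤n
isqrt-lower (suc n) with suc (isqrt n) ℕ.* suc (isqrt n) ℕₚ.≤? suc n
... | yes h = h
... | no  _ = ℕₚ.m≤n⇒m≤1+n (isqrt-lower n)

isqrt-upper : ∀ n → n ℕ.< suc (isqrt n) ℕ.* suc (isqrt n)
isqrt-upper zero = s≤s z≤n
isqrt-upper (suc n) with suc (isqrt n) ℕ.* suc (isqrt n) ℕₚ.≤? suc n
... | no  h = ℕₚ.≰⇒> h
... | yes h = ℕₚ.≤-<-trans (isqrt-upper n)
  (ℕₚ.*-mono-< (ℕₚ.n<1+n (suc (isqrt n))) (ℕₚ.n<1+n (suc (isqrt n))))

-- The truncation of √ n to a multiple of 1 / (k + 1).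
√approx : ℕ → ℕ → ℚ
√approx n k = fromℕ (isqrt (n ℕ.* (suc k ℕ.* suc k))) * 1/suc k

fromℕ-* : ∀ m n → fromℕ (m ℕ.* n) ≡ fromℕ m * fromℕ n
fromℕ-* m n = toℚᵘ-injective
  (ℚᵘₚ.≃-trans (ℚᵘₚ.≃-reflexive (cong (λ k → ℚᵘ.mkℚᵘ k 0) (ℤₚ.pos-* m n)))
    (ℚᵘₚ.≃-sym (toℚᵘ-homo-* (fromℕ m) (fromℕ n))))

√approx-≤ : ∀ n k l → √approx n k ≤ √approx n l + 1/suc l
√approx-≤ n k l = subst₂ _≤_ lhs rhs
  (*-monoʳ-0≤ (0≤-* (0≤1/suc k) (0≤1/suc l)) (fromℕ-mono (ℕₚ.<⇒≤ r<s)))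
  where
  K = suc k
  L = suc l
  r = isqrt (n ℕ.* (K ℕ.* K))
  s = isqrt (n ℕ.* (L ℕ.* L))
  open ℕ-Solver.+-*-Solver
    renaming (solve to ℕ-solve; _:=_ to _:≡_; _:*_ to _:×_) using ()
  r<s : r ℕ.* L ℕ.< suc s ℕ.* K
  r<s = ℕₚ.≰⇒> λ h → ℕₚ.<⇒≱ sq (ℕₚ.*-mono-≤ h h)
    where
    sq : (r ℕ.* L) ℕ.* (r ℕ.* L) ℕ.< (suc s ℕ.* K) ℕ.* (suc s ℕ.* K)
    sq = ℕₚ.≤-<-trans
      (ℕₚ.≤-trans
        (ℕₚ.≤-reflexive (ℕ-solve 2 (λ r l → (r :× l) :× (r :× l) :≡
            (r :× r) :× (l :× l)) refl r L))
        (ℕₚ.≤-trans (ℕₚ.*-monoˡ-≤ (L ℕ.* L) (isqrt-lower (n ℕ.* (K ℕ.* K))))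
          (ℕₚ.≤-reflexive (ℕ-solve 3 (λ n k l → (n :× (k :× k)) :× (l :× l) :≡
            (n :× (l :× l)) :× (k :× k)) refl n K L))))
      (ℕₚ.<-≤-trans
        (ℕₚ.*-monoˡ-< (K ℕ.* K) (isqrt-upper (n ℕ.* (L ℕ.* L))))
        (ℕₚ.≤-reflexive (ℕ-solve 2 (λ s k → (s :× s) :× (k :× k) :≡
            (s :× k) :× (s :× k)) refl (suc s) K)))
  lhs : fromℕ (r ℕ.* L) * (1/suc k * 1/suc l) ≡ √approx n k
  lhs = trans (cong (_* (1/suc k * 1/suc l)) (fromℕ-* r L))
    (trans (solve 4 (λ r l i j → r :* l :* (i :* j) := (r :* i) :* (l :* j)) refl
             (fromℕ r) (fromℕ L) (1/suc k) (1/suc l))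
    (trans (cong ((fromℕ r * 1/suc k) *_) (suc*1/suc l))
           (*-identityʳ (fromℕ r * 1/suc k))))
  rhs : fromℕ (suc s ℕ.* K) * (1/suc k * 1/suc l) ≡ √approx n l + 1/suc l
  rhs = trans (cong (_* (1/suc k * 1/suc l)) (fromℕ-* (suc s) K))
    (trans (solve 4 (λ s k i j → s :* k :* (i :* j) := (k :* i) :* (s :* j)) refl
             (fromℕ (suc s)) (fromℕ K) (1/suc k) (1/suc l))
    (trans (cong (_* (fromℕ (suc s) * 1/suc l)) (suc*1/suc k))
    (trans (*-identityˡ (fromℕ (suc s) * 1/suc l))
    (trans (cong (_* 1/suc l) (fromℕ-suc s))
    (trans (*-distribʳ-+ (1/suc l) 1ℚ (fromℕ s))
    (trans (+-comm (1ℚ * 1/suc l) (fromℕ s * 1/suc l))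
           (cong (λ z → fromℕ s * 1/suc l + z) (*-identityˡ (1/suc l)))))))))

1/suc-anti : ∀ {m n} → m ℕ.≤ n → 1/suc n ≤ 1/suc m
1/suc-anti {m} {n} h = *≤*
  (subst₂ ℤ._≤_ (sym (ℤₚ.*-identityˡ (+ suc m))) (sym (ℤₚ.*-identityˡ (+ suc n)))
    (ℤ.+≤+ (s≤s h)))

√approx-cauchy : ∀ n → IsCauchy (√approx n)
√approx-cauchy n ε 0<ε = N , λ k l hk hl → ∣∣-<
    (near k l hl)
    (subst (_< ε) (solve 2 (λ a b → b :+ :- a := :- (a :+ :- b)) refl
        (√approx n k) (√approx n l)) (near l k hk))
  where
  N = proj₁ (small ε 0<ε)
  near : ∀ k l → N ℕ.≤ l → √approx n k - √approx n l < ε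
  near k l hl = ≤-<-trans (p≤q+r⇒p-q≤r (√approx-≤ n k l))
    (≤-<-trans (1/suc-anti hl) (proj₂ (small ε 0<ε)))

√_ : ℕ → ℝ
√ n = mkℝ (√approx n) (√approx-cauchy n)

infix 5 _+i_

record Cartesian (A : Set) : Set where
  constructor _+i_
  field
    re : A
    im : A
open Cartesian public

ℚ[i] : Set
ℚ[i] = Cartesian ℚ

infixl 7 _*ᵢ_
infixl 6 _+ᵢ_ _-ᵢ_
infixr 7 _•_

_+ᵢ_ _-ᵢ_ _*ᵢ_ : ℚ[i] → ℚ[i] → ℚ[i]
(a +i b) +ᵢ (c +i d) = (a + c) +i (b + d)
(a +i b) -ᵢ (c +i d) = (a - c) +i (b - d)
(a +i b) *ᵢ (c +i d) = (a * c - b * d) +i (a * d + b * c)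

_•_ : ℚ → ℚ[i] → ℚ[i]
q • (a +i b) = (q * a) +i (q * b)

expTerm : ℕ → ℚ[i] → ℚ[i]
expTerm zero    z = 1ℚ +i 0ℚ
expTerm (suc k) z = 1/suc k • (expTerm k z *ᵢ z)

expSum : ℕ → ℚ[i] → ℚ[i]
expSum zero    z = 0ℚ +i 0ℚ
expSum (suc n) z = expSum n z +ᵢ expTerm n z

norm₁ : ℚ[i] → ℚ
norm₁ (a +i b) = ∣ a ∣ + ∣ b ∣

0≤norm₁ : ∀ z → 0ℚ ≤ norm₁ z
0≤norm₁ (a +i b) = 0≤-+ (0≤∣p∣ a) (0≤∣p∣ b)

norm₁-+ : ∀ z w → norm₁ (z +ᵢ w) ≤ norm₁ z + norm₁ w
norm₁-+ (a +i b) (c +i d) =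
  ≤-trans (+-mono-≤ (∣p+q∣≤∣p∣+∣q∣ a c) (∣p+q∣≤∣p∣+∣q∣ b d))
    (≤-reflexive (solve 4 (λ a b c d → a :+ c :+ (b :+ d) := a :+ b :+ (c :+ d))
      refl (∣ a ∣) (∣ b ∣) (∣ c ∣) (∣ d ∣)))

norm₁-* : ∀ z w → norm₁ (z *ᵢ w) ≤ norm₁ z * norm₁ w
norm₁-* (a +i b) (c +i d) =
  ≤-trans (+-mono-≤ (∣p-q∣≤∣p∣+∣q∣ (a * c) (b * d))
                    (∣p+q∣≤∣p∣+∣q∣ (a * d) (b * c)))
    (≤-reflexive (trans
      (cong₂ _+_ (cong₂ _+_ (∣p*q∣≡∣p∣*∣q∣ a c) (∣p*q∣≡∣p∣*∣q∣ b d))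
                 (cong₂ _+_ (∣p*q∣≡∣p∣*∣q∣ a d) (∣p*q∣≡∣p∣*∣q∣ b c)))
      (solve 4 (λ a b c d →
          a :* c :+ b :* d :+ (a :* d :+ b :* c) := (a :+ b) :* (c :+ d))
        refl (∣ a ∣) (∣ b ∣) (∣ c ∣) (∣ d ∣))))

norm₁-• : ∀ q z → 0ℚ ≤ q → norm₁ (q • z) ≡ q * norm₁ z
norm₁-• q (a +i b) 0≤q = trans
  (cong₂ _+_ (trans (∣p*q∣≡∣p∣*∣q∣ q a) (cong (_* ∣ a ∣) (0≤p⇒∣p∣≡p 0≤q)))
             (trans (∣p*q∣≡∣p∣*∣q∣ q b) (cong (_* ∣ b ∣) (0≤p⇒∣p∣≡p 0≤q))))
  (sym (*-distribˡ-+ q ∣ a ∣ ∣ b ∣))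

module Majorant (B : ℚ) (0≤B : 0ℚ ≤ B) where

  t : ℕ → ℚ
  t zero    = 1ℚ
  t (suc k) = 1/suc k * (t k * B)

  s : ℕ → ℚ
  s zero    = 0ℚ
  s (suc n) = s n + t n

  0≤t : ∀ k → 0ℚ ≤ t k
  0≤t zero    = 0≤1ℚ
  0≤t (suc k) = 0≤-* (0≤1/suc k) (0≤-* (0≤t k) 0≤B)

  s-mono-+ : ∀ d m → s m ≤ s (d ℕ.+ m)
  s-mono-+ zero    m = ≤-refl
  s-mono-+ (suc d) m =
    ≤-trans (s-mono-+ d m) (p≤p+q (s (d ℕ.+ m)) (0≤t (d ℕ.+ m)))

  K : ℕ
  K = proj₁ (archimedean (B + B))

  t-halves : ∀ d → t (suc (d ℕ.+ K)) + t (suc (d ℕ.+ K)) ≤ t (d ℕ.+ K)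
  t-halves d = ≤-trans
    (≤-reflexive (solve 3 (λ r t b → r :* (t :* b) :+ r :* (t :* b) :=
        t :* (r :* (b :+ b))) refl (1/suc k) (t k) B))
    (≤-trans (*-monoˡ-0≤ (0≤t k) r2B≤1) (≤-reflexive (*-identityʳ (t k))))
    where
    k = d ℕ.+ K
    2B≤1+k : B + B ≤ fromℕ (suc k)
    2B≤1+k = ≤-trans (proj₂ (archimedean (B + B)))
      (fromℕ-mono (ℕₚ.m≤n⇒m≤1+n (ℕₚ.m≤n+m K d)))
    r2B≤1 : 1/suc k * (B + B) ≤ 1ℚ
    r2B≤1 = ≤-trans (*-monoˡ-0≤ (0≤1/suc k) 2B≤1+k)
      (≤-reflexive (trans (*-comm (1/suc k) (fromℕ (suc k))) (suc*1/suc k)))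

  s+2t-decreasing : ∀ d e →
    s (d ℕ.+ (e ℕ.+ K)) + (t (d ℕ.+ (e ℕ.+ K)) + t (d ℕ.+ (e ℕ.+ K))) ≤
    s (e ℕ.+ K) + (t (e ℕ.+ K) + t (e ℕ.+ K))
  s+2t-decreasing zero    e = ≤-refl
  s+2t-decreasing (suc d) e = ≤-trans
    (+-monoʳ-≤ (s (suc k)) halves)
    (≤-trans (≤-reflexive (+-assoc (s k) (t k) (t k))) (s+2t-decreasing d e))
    where
    k = d ℕ.+ (e ℕ.+ K)
    halves : t (suc k) + t (suc k) ≤ t k
    halves = subst (λ n → t (suc n) + t (suc n) ≤ t n) (ℕₚ.+-assoc d e K)
      (t-halves (d ℕ.+ e))

  t-decay : ∀ d → fromℕ (suc d) * t (d ℕ.+ K) ≤ t K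
  t-decay zero    = ≤-reflexive (*-identityˡ (t K))
  t-decay (suc d) = ≤-trans (*-monoʳ-0≤ (0≤t (suc k)) 2+d≤2c)
    (≤-trans (≤-reflexive (double c (t (suc k))))
      (≤-trans (*-monoˡ-0≤ (0≤fromℕ (suc d)) (t-halves d)) (t-decay d)))
    where
    k = d ℕ.+ K
    c = fromℕ (suc d)
    double : ∀ c u → (c + c) * u ≡ c * (u + u)
    double = solve 2 (λ c u → (c :+ c) :* u := c :* (u :+ u)) refl
    2+d≤2c : fromℕ (suc (suc d)) ≤ c + c
    2+d≤2c = ≤-trans (≤-reflexive (fromℕ-suc (suc d)))
      (+-monoˡ-≤ c (fromℕ-mono {1} {suc d} (s≤s z≤n)))

  2t-small : ∀ ε → 0ℚ < ε → ∃[ d ] t (d ℕ.+ K) + t (d ℕ.+ K) < ε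
  2t-small ε 0<ε = go (shrink (T + T + 1ℚ) ε (0<2C+1 (0≤t K)) 0<ε)
    where
    T = t K
    go : (∃[ δ ] 0ℚ < δ × (T + T + 1ℚ) * δ ≡ ε) →
         ∃[ d ] t (d ℕ.+ K) + t (d ℕ.+ K) < ε
    go (δ , 0<δ , eq) = d , ≤-<-trans 2u≤ (<-≤-trans 2Tr< (≤-reflexive eq))
      where
      d = proj₁ (small δ 0<δ)
      r = 1/suc d
      u = t (d ℕ.+ K)
      u≤ : u ≤ T * r
      u≤ = ≤-trans
        (≤-reflexive (trans (sym (*-identityˡ u)) (trans
          (cong (_* u) (sym (suc*1/suc d)))
          (solve 3 (λ c r u → c :* r :* u := c :* u :* r) refl
             (fromℕ (suc d)) r u))))
        (*-monoʳ-0≤ (0≤1/suc d) (t-decay d))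
      2u≤ : u + u ≤ T * (r + r) + 0ℚ
      2u≤ = ≤-trans (+-mono-≤ u≤ u≤)
        (≤-reflexive (trans (sym (*-distribˡ-+ T r r))
          (sym (+-identityʳ (T * (r + r))))))
      2Tr< : T * (r + r) + 0ℚ < (T + T + 1ℚ) * δ
      2Tr< = combine-< (0≤t K) (proj₂ (small δ 0<δ)) (proj₂ (small δ 0<δ)) 0<δ

  s-cauchy : IsCauchy s
  s-cauchy ε 0<ε = go (2t-small ε 0<ε)
    where
    go : (∃[ d ] t (d ℕ.+ K) + t (d ℕ.+ K) < ε) →
         ∃[ N ] ∀ m n → N ℕ.≤ m → N ℕ.≤ n → ∣ s m - s n ∣ < ε
    go (d , h) = N , λ m n hm hn → ∣∣-<
        (near m n hm hn)
        (subst (_< ε) (solve 2 (λ a b → b :+ :- a := :- (a :+ :- b)) refl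
            (s m) (s n)) (near n m hn hm))
      where
      N = d ℕ.+ K
      lower : ∀ n → N ℕ.≤ n → s N ≤ s n
      lower n hn = subst (λ k → s N ≤ s k) (ℕₚ.m∸n+n≡m hn) (s-mono-+ (n ℕ.∸ N) N)
      upper : ∀ n → N ℕ.≤ n → s n ≤ s N + (t N + t N)
      upper n hn = ≤-trans (p≤p+q (s n) (0≤-+ (0≤t n) (0≤t n)))
        (subst (λ k → s k + (t k + t k) ≤ s N + (t N + t N)) (ℕₚ.m∸n+n≡m hn)
          (s+2t-decreasing (n ℕ.∸ N) d))
      near : ∀ m n → N ℕ.≤ m → N ℕ.≤ n → s m - s n < ε
      near m n hm hn = ≤-<-trans
        (p≤q+r⇒p-q≤r (≤-trans (upper m hm) (+-monoˡ-≤ (t N + t N) (lower n hn)))) h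

  s-bound : ∃[ C ] 0ℚ ≤ C × ∀ n → s n ≤ C
  s-bound = go (cauchy⇒bounded s s-cauchy)
    where
    go : (∃[ C ] 0ℚ ≤ C × ∀ n → ∣ s n ∣ ≤ C) → ∃[ C ] 0ℚ ≤ C × ∀ n → s n ≤ C
    go (C , 0≤C , h) = C , 0≤C , λ n → ≤-trans (p≤∣p∣ (s n)) (h n)

  term-bound : ∀ k z → norm₁ z ≤ B → norm₁ (expTerm k z) ≤ t k
  term-bound zero    z hz = ≤-refl
  term-bound (suc k) z hz = ≤-trans
    (≤-reflexive (norm₁-• (1/suc k) (expTerm k z *ᵢ z) (0≤1/suc k)))
    (*-monoˡ-0≤ (0≤1/suc k) (≤-trans (norm₁-* (expTerm k z) z)
      (*-mono-0≤ (0≤t k) (0≤norm₁ z) (term-bound k z hz) hz)))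

  -- t′ is the derivative of t with respect to B.
  t′ : ℕ → ℚ
  t′ zero    = 0ℚ
  t′ (suc k) = t k

  t′*B : ∀ k → t′ k * B ≡ fromℕ k * t k
  t′*B zero    = trans (*-zeroˡ B) (sym (*-zeroˡ 1ℚ))
  t′*B (suc k) = sym (trans
    (sym (*-assoc (fromℕ (suc k)) (1/suc k) (t k * B)))
    (trans (cong (_* (t k * B)) (suc*1/suc k)) (*-identityˡ (t k * B))))

  t′-step : ∀ k → 1/suc k * (t k + t′ k * B) ≡ t k
  t′-step k = trans (cong (λ v → 1/suc k * (t k + v)) (t′*B k))
    (trans (cong (λ v → 1/suc k * (v + fromℕ k * t k)) (sym (*-identityˡ (t k))))
    (trans (cong (1/suc k *_) (sym (*-distribʳ-+ (t k) 1ℚ (fromℕ k))))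
    (trans (cong (λ v → 1/suc k * (v * t k)) (sym (fromℕ-suc k)))
    (trans (solve 3 (λ r c u → r :* (c :* u) := c :* r :* u) refl
             (1/suc k) (fromℕ (suc k)) (t k))
    (trans (cong (_* t k) (suc*1/suc k)) (*-identityˡ (t k)))))))

  product-diff : ∀ q u z v w →
    (q • (u *ᵢ z)) -ᵢ (q • (v *ᵢ w)) ≡
    q • ((u *ᵢ (z -ᵢ w)) +ᵢ ((u -ᵢ v) *ᵢ w))
  product-diff q (a +i b) (c +i d) (e +i f) (g +i h) = cong₂ _+i_
    (solve 9 (λ q a b c d e f g h →
        q :* (a :* c :+ :- (b :* d)) :+ :- (q :* (e :* g :+ :- (f :* h))) :=
        q :* (a :* (c :+ :- g) :+ :- (b :* (d :+ :- h)) :+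
              ((a :+ :- e) :* g :+ :- ((b :+ :- f) :* h))))
      refl q a b c d e f g h)
    (solve 9 (λ q a b c d e f g h →
        q :* (a :* d :+ b :* c) :+ :- (q :* (e :* h :+ f :* g)) :=
        q :* (a :* (d :+ :- h) :+ b :* (c :+ :- g) :+
              ((a :+ :- e) :* h :+ (b :+ :- f) :* g)))
      refl q a b c d e f g h)

  term-diff : ∀ k z w → norm₁ z ≤ B → norm₁ w ≤ B →
    norm₁ (expTerm k z -ᵢ expTerm k w) ≤ norm₁ (z -ᵢ w) * t′ k
  term-diff zero    z w hz hw = ≤-reflexive (sym (*-zeroʳ (norm₁ (z -ᵢ w))))
  term-diff (suc k) z w hz hw = ≤-trans
    (≤-reflexive (trans
      (cong norm₁ (product-diff r u z v w))
      (norm₁-• r ((u *ᵢ (z -ᵢ w)) +ᵢ ((u -ᵢ v) *ᵢ w)) (0≤1/suc k))))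
    (≤-trans (*-monoˡ-0≤ (0≤1/suc k) (≤-trans
        (norm₁-+ (u *ᵢ (z -ᵢ w)) ((u -ᵢ v) *ᵢ w))
        (+-mono-≤
          (≤-trans (norm₁-* u (z -ᵢ w))
            (*-monoʳ-0≤ (0≤norm₁ (z -ᵢ w)) (term-bound k z hz)))
          (≤-trans (norm₁-* (u -ᵢ v) w)
            (*-mono-0≤ (0≤-* (0≤norm₁ (z -ᵢ w)) (0≤t′ k)) (0≤norm₁ w)
              (term-diff k z w hz hw) hw)))))
      (≤-reflexive (trans
        (solve 5 (λ r t D t′ B → r :* (t :* D :+ D :* t′ :* B) :=
                                 D :* (r :* (t :+ t′ :* B)))
          refl r (t k) (norm₁ (z -ᵢ w)) (t′ k) B)
        (cong (norm₁ (z -ᵢ w) *_) (t′-step k)))))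
    where
    r = 1/suc k
    u = expTerm k z
    v = expTerm k w
    0≤t′ : ∀ k → 0ℚ ≤ t′ k
    0≤t′ zero    = ≤-refl
    0≤t′ (suc k) = 0≤t k

  +ᵢ-diff : ∀ z w u v → (z +ᵢ w) -ᵢ (u +ᵢ v) ≡ (z -ᵢ u) +ᵢ (w -ᵢ v)
  +ᵢ-diff (a +i b) (c +i d) (e +i f) (g +i h) = cong₂ _+i_
    (solve 4 (λ a c e g → a :+ c :+ :- (e :+ g) := a :+ :- e :+ (c :+ :- g))
      refl a c e g)
    (solve 4 (λ a c e g → a :+ c :+ :- (e :+ g) := a :+ :- e :+ (c :+ :- g))
      refl b d f h)

  s′ : ℕ → ℚ
  s′ zero    = 0ℚ
  s′ (suc n) = s′ n + t′ n

  s′≡s : ∀ n → s′ (suc n) ≡ s n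
  s′≡s zero    = +-identityˡ 0ℚ
  s′≡s (suc n) = cong (_+ t n) (s′≡s n)

  sum-diff′ : ∀ n z w → norm₁ z ≤ B → norm₁ w ≤ B →
    norm₁ (expSum n z -ᵢ expSum n w) ≤ norm₁ (z -ᵢ w) * s′ n
  sum-diff′ zero    z w hz hw = ≤-reflexive (sym (*-zeroʳ (norm₁ (z -ᵢ w))))
  sum-diff′ (suc n) z w hz hw = ≤-trans
    (≤-reflexive (cong norm₁
      (+ᵢ-diff (expSum n z) (expTerm n z) (expSum n w) (expTerm n w))))
    (≤-trans (norm₁-+ (expSum n z -ᵢ expSum n w) (expTerm n z -ᵢ expTerm n w))
    (≤-trans (+-mono-≤ (sum-diff′ n z w hz hw) (term-diff n z w hz hw))
      (≤-reflexive (sym (*-distribˡ-+ (norm₁ (z -ᵢ w)) (s′ n) (t′ n))))))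

  sum-diff : ∀ {C} → 0ℚ ≤ C → (∀ n → s n ≤ C) →
    ∀ n z w → norm₁ z ≤ B → norm₁ w ≤ B →
    norm₁ (expSum n z -ᵢ expSum n w) ≤ norm₁ (z -ᵢ w) * C
  sum-diff {C} 0≤C h n z w hz hw = ≤-trans (sum-diff′ n z w hz hw)
    (*-monoˡ-0≤ (0≤norm₁ (z -ᵢ w)) (s′≤C n))
    where
    s′≤C : ∀ n → s′ n ≤ C
    s′≤C zero    = 0≤C
    s′≤C (suc n) = subst (_≤ C) (sym (s′≡s n)) (h n)

  sum-tail-+ : ∀ d m z → norm₁ z ≤ B →
    norm₁ (expSum (d ℕ.+ m) z -ᵢ expSum m z) ≤ s (d ℕ.+ m) - s m
  sum-tail-+ zero m z hz = ≤-reflexive (trans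
    (cong norm₁ (cong₂ _+i_ (+-inverseʳ (re (expSum m z)))
                            (+-inverseʳ (im (expSum m z)))))
    (sym (+-inverseʳ (s m))))
  sum-tail-+ (suc d) m z hz = ≤-trans
    (≤-reflexive (cong norm₁ (cong₂ _+i_ (shift (re S) (re T) (re R))
                                         (shift (im S) (im T) (im R)))))
    (≤-trans (norm₁-+ (S -ᵢ R) T)
    (≤-trans (+-mono-≤ (sum-tail-+ d m z hz) (term-bound (d ℕ.+ m) z hz))
      (≤-reflexive (sym (shift (s (d ℕ.+ m)) (t (d ℕ.+ m)) (s m))))))
    where
    S = expSum (d ℕ.+ m) z
    T = expTerm (d ℕ.+ m) z
    R = expSum m z
    shift : ∀ a b c → a + b - c ≡ a - c + b
    shift = solve 3 (λ a b c → a :+ b :+ :- c := a :+ :- c :+ b) refl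

  norm₁-sym : ∀ z w → norm₁ (z -ᵢ w) ≡ norm₁ (w -ᵢ z)
  norm₁-sym (a +i b) (c +i d) = cong₂ _+_ (∣p-q∣≡∣q-p∣ a c) (∣p-q∣≡∣q-p∣ b d)

  sum-tail : ∀ m n z → norm₁ z ≤ B →
    norm₁ (expSum m z -ᵢ expSum n z) ≤ ∣ s m - s n ∣
  sum-tail m n z hz with ℕₚ.≤-total n m
  ... | inj₁ n≤m = ≤-trans
    (subst (λ k → norm₁ (expSum k z -ᵢ expSum n z) ≤ s k - s n) (ℕₚ.m∸n+n≡m n≤m)
      (sum-tail-+ (m ℕ.∸ n) n z hz))
    (p≤∣p∣ (s m - s n))
  ... | inj₂ m≤n = ≤-trans (≤-reflexive (norm₁-sym (expSum m z) (expSum n z)))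
    (≤-trans
      (subst (λ k → norm₁ (expSum k z -ᵢ expSum m z) ≤ s k - s m) (ℕₚ.m∸n+n≡m m≤n)
        (sum-tail-+ (n ℕ.∸ m) m z hz))
    (≤-trans (p≤∣p∣ (s n - s m)) (≤-reflexive (∣p-q∣≡∣q-p∣ (s n) (s m)))))

-- The partial sums are taken along the sequences approximating x and y.
expSeq : ℝ → ℝ → ℕ → ℚ[i]
expSeq x y n = expSum n (seq x n +i seq y n)

expSeq-cauchy : ∀ x y ε → 0ℚ < ε → ∃[ N ] ∀ m n → N ℕ.≤ m → N ℕ.≤ n →
  norm₁ (expSeq x y m -ᵢ expSeq x y n) < ε
expSeq-cauchy x y ε 0<ε =
  go (cauchy⇒bounded (seq x) (cauchy x)) (cauchy⇒bounded (seq y) (cauchy y))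
  where
  Goal = ∃[ N ] ∀ m n → N ℕ.≤ m → N ℕ.≤ n →
    norm₁ (expSeq x y m -ᵢ expSeq x y n) < ε
  go : (∃[ B ] 0ℚ ≤ B × ∀ n → ∣ seq x n ∣ ≤ B) →
       (∃[ B ] 0ℚ ≤ B × ∀ n → ∣ seq y n ∣ ≤ B) → Goal
  go (B₁ , 0≤B₁ , b₁) (B₂ , 0≤B₂ , b₂) = go₁ s-bound
    where
    open Majorant (B₁ + B₂) (0≤-+ 0≤B₁ 0≤B₂)
    z : ℕ → ℚ[i]
    z n = seq x n +i seq y n
    hz : ∀ n → norm₁ (z n) ≤ B₁ + B₂
    hz n = +-mono-≤ (b₁ n) (b₂ n)
    go₁ : (∃[ C ] 0ℚ ≤ C × ∀ n → s n ≤ C) → Goal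
    go₁ (C , 0≤C , hC) = go₂ (shrink (C + C + 1ℚ) ε (0<2C+1 0≤C) 0<ε)
      where
      go₂ : (∃[ δ ] 0ℚ < δ × (C + C + 1ℚ) * δ ≡ ε) → Goal
      go₂ (δ , 0<δ , eq) =
        go₃ (cauchy x δ 0<δ) (cauchy y δ 0<δ) (s-cauchy δ 0<δ)
        where
        go₃ : (∃[ N ] ∀ m n → N ℕ.≤ m → N ℕ.≤ n → ∣ seq x m - seq x n ∣ < δ) →
              (∃[ N ] ∀ m n → N ℕ.≤ m → N ℕ.≤ n → ∣ seq y m - seq y n ∣ < δ) →
              (∃[ N ] ∀ m n → N ℕ.≤ m → N ℕ.≤ n → ∣ s m - s n ∣ < δ) → Goal
        go₃ (N₁ , h₁) (N₂ , h₂) (N₃ , h₃) = N₁ ℕ.⊔ N₂ ℕ.⊔ N₃ , λ m n hm hn →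
          ≤-<-trans
            (≤-trans (≤-reflexive (cong norm₁ (cong₂ _+i_
                (split (re (expSeq x y m)) (re (expSum m (z n))) _)
                (split (im (expSeq x y m)) (im (expSum m (z n))) _))))
            (≤-trans (norm₁-+ (expSum m (z m) -ᵢ expSum m (z n))
                              (expSum m (z n) -ᵢ expSum n (z n)))
              (+-mono-≤
                (≤-trans (sum-diff 0≤C hC m (z m) (z n) (hz m) (hz n))
                  (≤-reflexive (*-comm (norm₁ (z m -ᵢ z n)) C)))
                (sum-tail m n (z n) (hz n)))))
            (<-≤-trans (combine-< 0≤C (h₁ m n (l₁ hm) (l₁ hn))
                                      (h₂ m n (l₂ hm) (l₂ hn))
                                      (h₃ m n (l₃ hm) (l₃ hn)))
              (≤-reflexive eq))
          where
          split : ∀ a b c → a - c ≡ (a - b) + (b - c)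
          split = solve 3 (λ a b c → a :+ :- c := a :+ :- b :+ (b :+ :- c)) refl
          l₁ : ∀ {m} → N₁ ℕ.⊔ N₂ ℕ.⊔ N₃ ℕ.≤ m → N₁ ℕ.≤ m
          l₁ h = ℕₚ.m⊔n≤o⇒m≤o N₁ N₂ (ℕₚ.m⊔n≤o⇒m≤o (N₁ ℕ.⊔ N₂) N₃ h)
          l₂ : ∀ {m} → N₁ ℕ.⊔ N₂ ℕ.⊔ N₃ ℕ.≤ m → N₂ ℕ.≤ m
          l₂ h = ℕₚ.m⊔n≤o⇒n≤o N₁ N₂ (ℕₚ.m⊔n≤o⇒m≤o (N₁ ℕ.⊔ N₂) N₃ h)
          l₃ : ∀ {m} → N₁ ℕ.⊔ N₂ ℕ.⊔ N₃ ℕ.≤ m → N₃ ℕ.≤ m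
          l₃ h = ℕₚ.m⊔n≤o⇒n≤o (N₁ ℕ.⊔ N₂) N₃ h

ℂ : Set
ℂ = Cartesian ℝ

infixl 7 _*ℂ_
infixl 6 _+ℂ_

_+ℂ_ _*ℂ_ : ℂ → ℂ → ℂ
(a +i b) +ℂ (c +i d) = (a +ℝ c) +i (b +ℝ d)
(a +i b) *ℂ (c +i d) = (a *ℝ c -ℝ b *ℝ d) +i (a *ℝ d +ℝ b *ℝ c)

0ℂ : ℂ
0ℂ = 0ℝ +i 0ℝ

ℝ→ℂ : ℝ → ℂ
ℝ→ℂ x = x +i 0ℝ

∣_∣² : ℂ → ℝ
∣ a +i b ∣² = a *ℝ a +ℝ b *ℝ b

exp : ℂ → ℂ
exp (x +i y) =
  mkℝ (λ n → re (expSeq x y n)) (λ ε 0<ε → proj₁ (expSeq-cauchy x y ε 0<ε) ,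
    λ m n hm hn → ≤-<-trans
      (p≤p+q _ (0≤∣p∣ (im (expSeq x y m) - im (expSeq x y n))))
      (proj₂ (expSeq-cauchy x y ε 0<ε) m n hm hn)) +i
  mkℝ (λ n → im (expSeq x y n)) (λ ε 0<ε → proj₁ (expSeq-cauchy x y ε 0<ε) ,
    λ m n hm hn → ≤-<-trans
      (p≤q+p _ (0≤∣p∣ (re (expSeq x y m) - re (expSeq x y n))))
      (proj₂ (expSeq-cauchy x y ε 0<ε) m n hm hn))

sin : ℝ → ℝ
sin x = im (exp (0ℝ +i x))

-- π is the first positive zero of the sine, which is positive before it.
record IsPi (π : ℝ) : Set where
  field
    0<π    : 0ℝ <ℝ π
    sinπ≃0 : sin π ≃ℝ 0ℝ
    0<sin  : ∀ x → 0ℝ <ℝ x → x <ℝ π → 0ℝ <ℝ sin x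

infixl 6 _⊖_

_⊖_ : ∀ {N} → Fin N → Fin N → Fin N
_⊖_ {suc n} i j = (toℕ i ℕ.+ (suc n ℕ.∸ toℕ j)) mod suc n

open RawMonoidOps ℤ.+-0-rawMonoid public using () renaming (sum to sumℤ)

PAF : ∀ {N} → (Fin N → ℤ) → Fin N → ℤ
PAF a j = sumℤ λ i → a i ℤ.* a (i ⊖ j)

p₂ : ∀ {N} → (Fin N → ℤ) → ℤ
p₂ a = sumℤ λ i → a i ℤ.* a i

-- combine i j is the index n i + j.
compress : ∀ m {n} → (Fin (m ℕ.* n) → ℤ) → Fin n → ℤ
compress m a j = sumℤ {m} λ i → a (combine i j)

record LegendrePair {ℓ : ℕ} (a b : Fin ℓ → ℤ) : Set where
  field
    a-binary : ∀ i → a i ≡ -1ℤ ⊎ a i ≡ 1ℤ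
    b-binary : ∀ i → b i ≡ -1ℤ ⊎ b i ≡ 1ℤ
    PAF-sum  : ∀ j → toℕ j ≢ 0 → PAF a j ℤ.+ PAF b j ≡ -[1+ 1 ]
    sum-eq   : sumℤ a ≡ sumℤ b

ℂ-+-rawMonoid : RawMonoid 0ℓ 0ℓ
ℂ-+-rawMonoid = record
  { Carrier = ℂ
  ; _≈_     = λ z w → re z ≃ℝ re w × im z ≃ℝ im w
  ; _∙_     = _+ℂ_
  ; ε       = 0ℂ
  }

open RawMonoidOps ℂ-+-rawMonoid public using () renaming (sum to sumℂ)

2jr/N : ∀ {N} → ℕ → Fin N → ℚ
2jr/N {suc n} j r = + (2 ℕ.* j ℕ.* toℕ r) / suc n

-- e^(2πijr/N) depends only on j modulo N, so the DFT is indexed by ℕ.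
module Fourier (π : ℝ) where

  DFT : ∀ {N} → (Fin N → ℝ) → ℕ → ℂ
  DFT a j = sumℂ λ r → exp (0ℝ +i (ℚ→ℝ (2jr/N j r) *ℝ π)) *ℂ ℝ→ℂ (a r)

  PSD : ∀ {N} → (Fin N → ℝ) → ℕ → ℝ
  PSD a j = ∣ DFT a j ∣²

infix 4 _≡_[mod_]

_≡_[mod_] : ℤ → ℤ → ℕ → Set
i ≡ j [mod n ] = + n ℤ.∣ i ℤ.- j

-- Not symmetric in a and b: as x ≥ 0, it makes PSD a m the larger of the two.
-- A condition symmetric in a and b can match it only up to interchanging them.
PSDCondition : ℝ → ∀ m → (a b : Fin (m ℕ.* 5) → ℤ) → Set
PSDCondition π m a b = ∃[ x ]
  + x ≡ ℤ.- ℓ+1 [mod 4 ] × + x ≡ ℓ+1 [mod 4 ] ×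
  (∀ r → 1 ℕ.≤ r → r ℕ.≤ 4 →
    PSD (ℤ→ℝ ∘ a) (r ℕ.* m) ≃ℝ
      ℤ→ℝ ℓ+1 +ℝ ℤ→ℝ (-1ℤ ℤ.^ ⌊ r /2⌋) *ℝ (√ 5) *ℝ ℤ→ℝ (+ x) ×
    PSD (ℤ→ℝ ∘ b) (r ℕ.* m) ≃ℝ
      ℤ→ℝ ℓ+1 -ℝ ℤ→ℝ (-1ℤ ℤ.^ ⌊ r /2⌋) *ℝ (√ 5) *ℝ ℤ→ℝ (+ x))
  where
  open Fourier π
  ℓ+1 = + (m ℕ.* 5 ℕ.+ 1)

CompressionCondition : ∀ m → (a b : Fin (m ℕ.* 5) → ℤ) → Set
CompressionCondition m a b =
  p₂ A ≡ PAF A zero × PAF A zero ≡ p₂ B × p₂ B ≡ PAF B zero ×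
  PAF B zero ≡ + (4 ℕ.* m ℕ.+ 1)
  where
  A B : Fin 5 → ℤ
  A = compress m a
  B = compress m b

{-# OPTIONS --safe #-}
-- Put ζ = e^(2πi/5).  The DFT of a at r m is the sum of ζ^(r j) A_j, so its squared
-- modulus is P₀ + 2 cos(2πr/5) P₁ + 2 cos(4πr/5) P₂ with P_j = PAF_A(j).  As
-- 4 cos(2πr/5) = ± √5 - 1 and 4 cos(4πr/5) = ∓ √5 - 1, and P₀ + 2 P₁ + 2 P₂ = 1,
--   4 PSD_a(r m) = 5 P₀ - 1 ± 2 √5 (P₁ - P₂).
-- Adding the values at r = 1 and r = 2 eliminates √5 and determines P₀.  Conversely
-- P₀ = 4 m + 1 gives PSD_a(r m) = ℓ + 1 ± √5 y with y = - m - P₂, an integer that is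
-- fixed modulo 4 because every A_j is odd; PAF_A(1) + PAF_B(1) = - 2 m makes the
-- corresponding integer of b equal to - y.
--
-- The cosines come from the series of exp: the addition theorem gives ζ⁵ = 1, and
-- the positivity of the sine on (0, π) singles out ζ among the roots of unity.
module Submission where

open import Defs
open import Algebra.Bundles
  using (AbelianGroup; CommutativeMonoid; CommutativeRing; CommutativeSemiring)
import Algebra.Properties.CommutativeMonoid.Sum as MonoidSum
import Algebra.Properties.Group as GroupProperties
import Algebra.Properties.Semiring.Sum as SemiringSum
import Algebra.Solver.Ring as RingSolver
open import Algebra.Solver.Ring.AlmostCommutativeRing
  using (fromCommutativeRing; _-Raw-AlmostCommutative⟶_)
import Algebra.Solver.Ring.NaturalCoefficients.Default as SemiringSolver
open import Data.Empty using (⊥-elim)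
open import Data.Fin.Base using (Fin; toℕ; combine; opposite; _↑ˡ_; _↑ʳ_)
open import Data.Fin.Patterns using (0F; 1F; 2F; 3F; 4F)
open import Data.Fin.Permutation using (reverse)
open import Data.Fin.Properties
  using (toℕ-combine; toℕ-fromℕ<; toℕ<n; toℕ-injective; opposite-prop; fromℕ<-cong)
open import Data.Integer.Base as ℤ using (ℤ; +_; -[1+_]; 0ℤ; 1ℤ; -1ℤ)
open import Data.Integer.Divisibility.Signed using (divides; ∣⇒∣ᵤ)
import Data.Integer.Properties as ℤₚ
import Data.Integer.Solver as ℤ-Solver
open import Data.Maybe.Base using (map)
open import Data.Nat.Base as ℕ using (ℕ; zero; suc; z≤n; s≤s; ⌊_/2⌋; _∸_)
open import Data.Nat.Divisibility as ℕ using (_∣_)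
open import Data.Nat.DivMod
  using (_mod_; _%_; m≡m%n+[m/n]*n; [m+n]%n≡m%n; m<n⇒m%n≡m; m%n<n)
import Data.Nat.Properties as ℕₚ
import Data.Nat.Solver as ℕ-Solver
open import Data.Product.Base using (∃-syntax; _×_; _,_; proj₁; proj₂)
open import Data.Rational.Literals using (fromℤ)
open import Data.Rational.Solver using (module +-*-Solver)
import Data.Rational.Unnormalised.Base as ℚᵘ
import Data.Rational.Unnormalised.Properties as ℚᵘₚ
open import Data.Sum.Base using (_⊎_; inj₁; inj₂)
open import Function.Base using (_∘_)
open import Function.Bundles using (_⇔_; mk⇔)
open import Level using (0ℓ; _⊔_)
open import Relation.Binary.Consequences using (dec⇒weaklyDec)
open import Relation.Binary.PropositionalEquality as ≡
  using (_≡_; _≢_; cong; cong₂; subst; subst₂; isEquivalence; module ≡-Reasoning)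
import Relation.Binary.Reasoning.Setoid as SetoidReasoning
open import Relation.Nullary.Negation.Core using (¬_)

-- Over these reals a product can vanish without a decision which factor does, so each cancellation
-- needs a factor with an explicit positive lower bound. This shapes the computation of c₁ =
-- cos(2π/5). From ζ⁵ = 1 comes s₁ (4 c₁² + 2 c₁ - 1) = 0, where s₁ = sin(2π/5) may be cancelled.
-- The quadratic factors as (4 c₁ + 1 - √5)(4 c₁ + 1 + √5) up to a constant, but no lower bound for
-- the second factor is at hand, since the sign of c₁ is unknown. Multiplied by s₁, however, it is a
-- sum of nonnegative terms, one of them bounded away from 0. The addition theorem has a formal and
-- an analytic half. Formally, the coefficients z^k / k! are characterised by f 0 = 1 and f′ = z f,
-- so that the Leibniz rule takes the place of the binomial theorem. This half is used twice: over
-- ℚ[i] for the series, and over ℚ for its majorant, whose Cauchy modulus then bounds the analytic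
-- error.

-- Cauchy products and formal exponential series.

module RangeSum {c ℓ} (M : CommutativeMonoid c ℓ) where

  open CommutativeMonoid M

  Σ< : (ℕ → Carrier) → ℕ → Carrier
  Σ< f zero    = ε
  Σ< f (suc n) = Σ< f n ∙ f n

  Σ<-cong : ∀ {f g} → (∀ k → f k ≈ g k) → ∀ n → Σ< f n ≈ Σ< g n
  Σ<-cong h zero    = refl
  Σ<-cong h (suc n) = ∙-cong (Σ<-cong h n) (h n)

  Σ<-head : ∀ f n → Σ< f (suc n) ≈ f 0 ∙ Σ< (f ∘ suc) n
  Σ<-head f zero    = comm ε (f 0)
  Σ<-head f (suc n) = trans (∙-congʳ (Σ<-head f n)) (assoc _ _ _)

module Convolution {c ℓ} (R : CommutativeSemiring c ℓ)
  (ι : ℕ → CommutativeSemiring.Carrier R) where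

  open CommutativeSemiring R
  open SemiringSolver R using (solve; _:=_; _:+_; _:*_; con)
  open SetoidReasoning setoid

  open RangeSum +-commutativeMonoid public

  conv : (ℕ → Carrier) → (ℕ → Carrier) → ℕ → Carrier
  conv f g zero    = f 0 * g 0
  conv f g (suc n) = f 0 * g (suc n) + conv (f ∘ suc) g n

  -- The sum of f j * g k over the triangle j + k < n, taken by columns j. Taken by antidiagonals it
  -- is a partial sum of the Cauchy product, which is `tri≈Σ<conv`.
  tri : (ℕ → Carrier) → (ℕ → Carrier) → ℕ → Carrier
  tri f g zero    = 0#
  tri f g (suc n) = f 0 * Σ< g (suc n) + tri (f ∘ suc) g n

  conv-cong : ∀ {f f′ g g′} → (∀ k → f k ≈ f′ k) → (∀ k → g k ≈ g′ k) →
              ∀ n → conv f g n ≈ conv f′ g′ n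
  conv-cong hf hg zero    = *-cong (hf 0) (hg 0)
  conv-cong hf hg (suc n) =
    +-cong (*-cong (hf 0) (hg (suc n))) (conv-cong (hf ∘ suc) hg n)

  conv-+ˡ : ∀ f f′ g n →
            conv (λ k → f k + f′ k) g n ≈ conv f g n + conv f′ g n
  conv-+ˡ f f′ g zero    = distribʳ (g 0) (f 0) (f′ 0)
  conv-+ˡ f f′ g (suc n) = trans
    (+-congˡ (conv-+ˡ (f ∘ suc) (f′ ∘ suc) g n))
    (solve 5 (λ a b c x y → (a :+ b) :* c :+ (x :+ y) :=
                            (a :* c :+ x) :+ (b :* c :+ y)) refl
      (f 0) (f′ 0) (g (suc n)) (conv (f ∘ suc) g n) (conv (f′ ∘ suc) g n))

  conv-*ˡ : ∀ f g z n → conv (λ k → f k * z) g n ≈ conv f g n * z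
  conv-*ˡ f g z zero    =
    solve 3 (λ a b z → a :* z :* b := a :* b :* z) refl (f 0) (g 0) z
  conv-*ˡ f g z (suc n) = trans (+-congˡ (conv-*ˡ (f ∘ suc) g z n))
    (solve 4 (λ a b x z → a :* z :* b :+ x :* z := (a :* b :+ x) :* z) refl
      (f 0) (g (suc n)) (conv (f ∘ suc) g n) z)

  conv-*ʳ : ∀ f g z n → conv f (λ k → g k * z) n ≈ conv f g n * z
  conv-*ʳ f g z zero    = sym (*-assoc (f 0) (g 0) z)
  conv-*ʳ f g z (suc n) = trans (+-congˡ (conv-*ʳ (f ∘ suc) g z n))
    (solve 4 (λ a b x z → a :* (b :* z) :+ x :* z := (a :* b :+ x) :* z) refl
      (f 0) (g (suc n)) (conv (f ∘ suc) g n) z)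

  tri-suc : ∀ f g n → tri f g (suc n) ≈ tri f g n + conv f g n
  tri-suc f g zero    =
    solve 2 (λ a b → a :* (con 0 :+ b) :+ con 0 := con 0 :+ a :* b) refl (f 0) (g 0)
  tri-suc f g (suc n) = trans (+-congˡ (tri-suc (f ∘ suc) g n))
    (solve 5 (λ a s b x y → a :* (s :+ b) :+ (x :+ y) :=
                            (a :* s :+ x) :+ (a :* b :+ y)) refl
      (f 0) (Σ< g (suc n)) (g (suc n)) (tri (f ∘ suc) g n) (conv (f ∘ suc) g n))

  tri≈Σ<conv : ∀ f g n → tri f g n ≈ Σ< (conv f g) n
  tri≈Σ<conv f g zero    = refl
  tri≈Σ<conv f g (suc n) = trans (tri-suc f g n) (+-congʳ (tri≈Σ<conv f g n))

  -- The derivative of the power series with coefficients f.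
  D : (ℕ → Carrier) → ℕ → Carrier
  D f k = ι (suc k) * f (suc k)

  record IsExp (z : Carrier) (f : ℕ → Carrier) : Set (c ⊔ ℓ) where
    field
      initial    : f 0 ≈ 1#
      derivative : ∀ k → D f k ≈ f k * z
  open IsExp public

  module _ (ι-zero : ι 0 ≈ 0#) (ι-suc : ∀ n → ι (suc n) ≈ 1# + ι n) where

    ι-1 : ι 1 ≈ 1#
    ι-1 = trans (ι-suc 0) (trans (+-congˡ ι-zero) (+-identityʳ 1#))

    -- Induction along the recursion of `conv`, which shifts f. On the shifted part the factor n + 2
    -- is split into 1 + (n + 1): the second summand is the induction hypothesis, the first makes up
    -- for the difference between `D (f ∘ suc)` and the shift of `D f`.
    leibniz : ∀ f g n → D (conv f g) n ≈ conv (D f) g n + conv f (D g) n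
    leibniz f g zero = begin
      ι 1 * (f 0 * g 1 + f 1 * g 0)
        ≈⟨ solve 5 (λ i a b c d → i :* (a :* b :+ c :* d) :=
                                  i :* c :* d :+ a :* (i :* b)) refl
             (ι 1) (f 0) (g 1) (f 1) (g 0) ⟩
      ι 1 * f 1 * g 0 + f 0 * (ι 1 * g 1) ∎
    leibniz f g (suc n) = begin
      ι (suc (suc n)) * (f 0 * g (suc (suc n)) + conv (f ∘ suc) g (suc n))
        ≈⟨ distribˡ _ _ _ ⟩
      ι (suc (suc n)) * (f 0 * g (suc (suc n))) +
      ι (suc (suc n)) * conv (f ∘ suc) g (suc n)
        ≈⟨ +-congˡ (*-congʳ (ι-suc (suc n))) ⟩
      ι (suc (suc n)) * (f 0 * g (suc (suc n))) +
      (1# + ι (suc n)) * conv (f ∘ suc) g (suc n)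
        ≈⟨ +-congˡ (trans (distribʳ _ _ _) (+-cong (*-identityˡ _)
             (leibniz (f ∘ suc) g n))) ⟩
      ι (suc (suc n)) * (f 0 * g (suc (suc n))) +
      (f 1 * g (suc n) + conv (f ∘ suc ∘ suc) g n +
       (conv (D (f ∘ suc)) g n + conv (f ∘ suc) (D g) n))
        ≈⟨ solve 8 (λ i a b c d x y z →
               i :* (a :* b) :+ (c :* d :+ x :+ (y :+ z)) :=
               c :* d :+ (x :+ y) :+ (a :* (i :* b) :+ z)) refl
             (ι (suc (suc n))) (f 0) (g (suc (suc n))) (f 1) (g (suc n))
             (conv (f ∘ suc ∘ suc) g n) (conv (D (f ∘ suc)) g n)
             (conv (f ∘ suc) (D g) n) ⟩
      f 1 * g (suc n) + (conv (f ∘ suc ∘ suc) g n + conv (D (f ∘ suc)) g n) +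
      (f 0 * D g (suc n) + conv (f ∘ suc) (D g) n)
        ≈⟨ +-congʳ (+-cong (*-congʳ (sym (trans (*-congʳ ι-1) (*-identityˡ (f 1)))))
             (trans (sym (conv-+ˡ (f ∘ suc ∘ suc) (D (f ∘ suc)) g n))
                    (conv-cong D-shift (λ _ → refl) n))) ⟩
      conv (D f) g (suc n) + conv f (D g) (suc n) ∎
      where
      D-shift : ∀ k → f (suc (suc k)) + D (f ∘ suc) k ≈ D f (suc k)
      D-shift k = sym (trans (*-congʳ (ι-suc (suc k)))
        (trans (distribʳ _ _ _) (+-congʳ (*-identityˡ _))))

    conv-exp : ∀ {z w f g} → IsExp z f → IsExp w g → IsExp (z + w) (conv f g)
    conv-exp {z} {w} {f} {g} hf hg = record
      { initial    = trans (*-cong (initial hf) (initial hg)) (*-identityˡ 1#)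
      ; derivative = λ k → begin
          D (conv f g) k
            ≈⟨ leibniz f g k ⟩
          conv (D f) g k + conv f (D g) k
            ≈⟨ +-cong (conv-cong (derivative hf) (λ _ → refl) k)
                      (conv-cong (λ _ → refl) (derivative hg) k) ⟩
          conv (λ i → f i * z) g k + conv f (λ i → g i * w) k
            ≈⟨ +-cong (conv-*ˡ f g z k) (conv-*ʳ f g w k) ⟩
          conv f g k * z + conv f g k * w
            ≈⟨ distribˡ _ _ _ ⟨
          conv f g k * (z + w) ∎
      }

  module _ (ι⁻¹ : ℕ → Carrier) (inverse : ∀ k → ι⁻¹ k * ι (suc k) ≈ 1#) where

    -- The differential equation prescribes (k + 1) f (k + 1) from f k, and k + 1 is invertible.
    exp-unique : ∀ {z f g} → IsExp z f → IsExp z g → ∀ k → f k ≈ g k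
    exp-unique hf hg zero = trans (initial hf) (sym (initial hg))
    exp-unique {z} {f} {g} hf hg (suc k) = begin
      f (suc k)                         ≈⟨ unit (f (suc k)) ⟩
      ι⁻¹ k * D f k                     ≈⟨ *-congˡ (derivative hf k) ⟩
      ι⁻¹ k * (f k * z)                 ≈⟨ *-congˡ (*-congʳ (exp-unique hf hg k)) ⟩
      ι⁻¹ k * (g k * z)                 ≈⟨ *-congˡ (derivative hg k) ⟨
      ι⁻¹ k * D g k                     ≈⟨ unit (g (suc k)) ⟨
      g (suc k)                         ∎
      where
      unit : ∀ x → x ≈ ι⁻¹ k * (ι (suc k) * x)
      unit x = sym (trans (sym (*-assoc _ _ x))
        (trans (*-congʳ (inverse k)) (*-identityˡ x)))

open import Data.Fin.Base using (zero; suc)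

-- Sums over the indices n i + j as double sums.

module SumOverPairs {c ℓ} (M : CommutativeMonoid c ℓ) where

  open CommutativeMonoid M
  open MonoidSum M

  sum-++ : ∀ m {n} (f : Fin (m ℕ.+ n) → Carrier) →
    sum f ≈ sum (λ i → f (i ↑ˡ n)) ∙ sum (λ i → f (m ↑ʳ i))
  sum-++ zero    f = sym (identityˡ _)
  sum-++ (suc m) f = trans (∙-congˡ (sum-++ m (f ∘ suc))) (sym (assoc _ _ _))

  sum-combine : ∀ m {n} (f : Fin (m ℕ.* n) → Carrier) →
    sum f ≈ sum {m} (λ i → sum (λ j → f (combine i j)))
  sum-combine zero        f = refl
  sum-combine (suc m) {n} f =
    trans (sum-++ n f) (∙-congˡ (sum-combine m (λ i → f (n ↑ʳ i))))

module WeightedSum {c ℓ} (R : CommutativeSemiring c ℓ) where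

  open CommutativeSemiring R
  open SemiringSum semiring
  open SumOverPairs +-commutativeMonoid

  sum-cong : ∀ {n} {f g : Fin n → Carrier} → (∀ i → f i ≈ g i) → sum f ≈ sum g
  sum-cong {n} = sum-cong-≋ {n}

  -- A weight depending only on the residue j comes out of the sum over i. With u j = ζ^(r j) this
  -- passes from the transform of a vector to that of its compression.
  sum-combine-* : ∀ m {n} (g : Fin m → Fin n → Carrier) (u : Fin n → Carrier)
    {s : Fin (m ℕ.* n) → Carrier} {t : Fin n → Carrier} →
    (∀ i j → s (combine i j) ≈ u j * g i j) →
    (∀ j → t j ≈ u j * sum (λ i → g i j)) → sum s ≈ sum t
  sum-combine-* m {n} g u {s} {t} hs ht = begin
    sum s
      ≈⟨ sum-combine m s ⟩
    sum {m} (λ i → sum (λ j → s (combine i j)))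
      ≈⟨ sum-cong (λ i → sum-cong (λ j → hs i j)) ⟩
    sum {m} (λ i → sum (λ j → u j * g i j))
      ≈⟨ ∑-comm {m} {n} (λ i j → u j * g i j) ⟩
    sum (λ j → sum {m} (λ i → u j * g i j))
      ≈⟨ sum-cong (λ j → *-distribˡ-sum {m} (u j) (λ i → g i j)) ⟨
    sum (λ j → u j * sum (λ i → g i j))
      ≈⟨ sum-cong ht ⟨
    sum t ∎
    where open SetoidReasoning setoid

-- Polynomial identities for fifth roots of unity.

module ℤ-Algebra {c ℓ} (R : CommutativeRing c ℓ)
  (hom : ℤ.+-*-rawRing -Raw-AlmostCommutative⟶ fromCommutativeRing R) where

  open CommutativeRing R
  open _-Raw-AlmostCommutative⟶_ hom renaming (⟦_⟧ to φ)
  open GroupProperties +-group using (x∙y⁻¹≈ε⇒x≈y; x≈y⇒x∙y⁻¹≈ε)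
  open RingSolver ℤ.+-*-rawRing (fromCommutativeRing R) hom
    (λ i j → map (λ i≡j → reflexive (≡.cong φ i≡j)) (dec⇒weaklyDec ℤₚ._≟_ i j))
    using (solve; _:=_; _:+_; _:*_; :-_; con; Polynomial)

  infixl 6 _⊕_
  infixr 7 _⊛_

  -- Below, polynomial consequences are proved by ideal membership: the solver expands the
  -- difference of the two sides as a combination of the hypotheses, each brought to the form x ≈ 0,
  -- and `_⊕_` and `_⊛_` make that combination vanish.
  _⊕_ : ∀ {x y} → x ≈ 0# → y ≈ 0# → x + y ≈ 0#
  x≈0 ⊕ y≈0 = trans (+-cong x≈0 y≈0) (+-identityʳ 0#)

  _⊛_ : ∀ k {x} → x ≈ 0# → k * x ≈ 0#
  k ⊛ x≈0 = trans (*-congˡ x≈0) (zeroʳ k)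

  private
    infixl 7 _:−_
    _:−_ : ∀ {n} → Polynomial n → Polynomial n → Polynomial n
    p :− q = p :+ :- q

  conj-norm : ∀ {x y} → x * x - y * - y ≈ φ (+ 1) → x * x + y * y ≈ φ (+ 1)
  conj-norm {x} {y} = trans
    (solve 2 (λ x y → x :* x :+ y :* y := x :* x :− y :* :- y) refl x y)

  real-square : ∀ {x y} → y ≈ 0# → x * x + y * y ≈ φ (+ 1) →
    x * x - y * y ≈ φ (+ 1)
  real-square {x} {y} y≈0 unit = x∙y⁻¹≈ε⇒x≈y _ _ (trans
    (solve 2 (λ x y → x :* x :− y :* y :− con (+ 1) :=
        x :* x :+ y :* y :− con (+ 1) :+ (con -[1+ 1 ] :* y) :* y) refl x y)
    (x≈y⇒x∙y⁻¹≈ε unit ⊕ (φ -[1+ 1 ] * y) ⊛ y≈0))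

  imaginary-square : ∀ {x y} → y ≈ 0# → x * y + y * x ≈ 0#
  imaginary-square {x} {y} y≈0 = trans
    (solve 2 (λ x y → x :* y :+ y :* x := (con (+ 2) :* x) :* y) refl x y)
    ((φ (+ 2) * x) ⊛ y≈0)

  -- The relations between c₁ + i s₁ = e^(2πi/5), c₂ + i s₂ = (c₁ + i s₁)² and
  -- q = √ 5; the last relation says that the imaginary part of the cube is - s₂.
  module GoldenCosine {c₁ s₁ c₂ s₂ q : Carrier}
    (unit : c₁ * c₁ + s₁ * s₁ ≈ φ (+ 1))
    (double-c : c₁ * c₁ - s₁ * s₁ ≈ c₂)
    (double-s : c₁ * s₁ + s₁ * c₁ ≈ s₂)
    (triple-s : c₁ * s₂ + s₁ * c₂ ≈ - s₂)
    (q² : q * q ≈ φ (+ 5)) where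

    quadratic linear : Carrier
    quadratic = φ (+ 4) * (c₁ * c₁) + φ (+ 2) * c₁ - φ (+ 1)
    linear    = φ (+ 4) * c₁ + φ (+ 1) - q

    -- For θ = 2π/5, sin 3θ + sin 2θ = 0 by `triple-s`, while sin 3θ = s₁ (4 c₁² - 1) and sin 2θ = 2
    -- s₁ c₁.
    s₁*quadratic≈0 : s₁ * quadratic ≈ 0#
    s₁*quadratic≈0 = trans
      (solve 4 (λ c s c′ s′ →
          s :* (con (+ 4) :* (c :* c) :+ con (+ 2) :* c :− con (+ 1)) :=
          (c :* s′ :+ s :* c′ :− :- s′) :+ s :* (c :* c :+ s :* s :− con (+ 1))
          :+ s :* (c :* c :− s :* s :− c′)
          :+ (c :+ con (+ 1)) :* (c :* s :+ s :* c :− s′))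
        refl c₁ s₁ c₂ s₂)
      (x≈y⇒x∙y⁻¹≈ε triple-s
        ⊕ s₁ ⊛ x≈y⇒x∙y⁻¹≈ε unit
        ⊕ s₁ ⊛ x≈y⇒x∙y⁻¹≈ε double-c
        ⊕ (c₁ + φ (+ 1)) ⊛ x≈y⇒x∙y⁻¹≈ε double-s)

    -- The first factor is s₁ (4 c₁ + 1 + q), rewritten as a sum of positive terms.
    factored≈0 : quadratic ≈ 0# →
      (φ (+ 2) * s₂ + (s₁ + s₁ * q)) * linear ≈ 0#
    factored≈0 quadratic≈0 = trans
      (solve 4 (λ c s s′ q →
          (con (+ 2) :* s′ :+ (s :+ s :* q)) :* (con (+ 4) :* c :+ con (+ 1) :− q) :=
          (con (+ 4) :* s) :* (con (+ 4) :* (c :* c) :+ con (+ 2) :* c :− con (+ 1))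
          :+ (:- s) :* (q :* q :− con (+ 5))
          :+ (:- (con (+ 2) :* (con (+ 4) :* c :+ con (+ 1) :− q)))
             :* (c :* s :+ s :* c :− s′))
        refl c₁ s₁ s₂ q)
      ((φ (+ 4) * s₁) ⊛ quadratic≈0
        ⊕ (- s₁) ⊛ x≈y⇒x∙y⁻¹≈ε q²
        ⊕ (- (φ (+ 2) * linear)) ⊛ x≈y⇒x∙y⁻¹≈ε double-s)

    4c₁ : linear ≈ 0# → φ (+ 4) * c₁ ≈ φ (+ 1) * q - φ (+ 1)
    4c₁ linear≈0 = x∙y⁻¹≈ε⇒x≈y _ _ (trans
      (solve 2 (λ c q → con (+ 4) :* c :− (con (+ 1) :* q :− con (+ 1)) :=
                        con (+ 4) :* c :+ con (+ 1) :− q) refl c₁ q)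
      linear≈0)

    -- c₂ = 2 c₁² - 1 and 4 c₁² = 1 - 2 c₁ give 4 c₂ = - 2 - 4 c₁. The coefficient -1 of q is
    -- written out so that both cosines have the form σ q - 1.
    4c₂ : quadratic ≈ 0# → linear ≈ 0# → φ (+ 4) * c₂ ≈ φ -[1+ 0 ] * q - φ (+ 1)
    4c₂ quadratic≈0 linear≈0 = x∙y⁻¹≈ε⇒x≈y _ _ (trans
      (solve 4 (λ c s c′ q →
          con (+ 4) :* c′ :− (con -[1+ 0 ] :* q :− con (+ 1)) :=
          con (+ 2) :* (con (+ 4) :* (c :* c) :+ con (+ 2) :* c :− con (+ 1))
          :+ con -[1+ 0 ] :* (con (+ 4) :* c :+ con (+ 1) :− q)
          :+ con -[1+ 3 ] :* (c :* c :+ s :* s :− con (+ 1))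
          :+ con -[1+ 3 ] :* (c :* c :− s :* s :− c′))
        refl c₁ s₁ c₂ q)
      (φ (+ 2) ⊛ quadratic≈0
        ⊕ φ -[1+ 0 ] ⊛ linear≈0
        ⊕ φ -[1+ 3 ] ⊛ x≈y⇒x∙y⁻¹≈ε unit
        ⊕ φ -[1+ 3 ] ⊛ x≈y⇒x∙y⁻¹≈ε double-c))

  -- The squared modulus of x₀ + ζ x₁ + ζ² x₂ + ζ³ x₃ + ζ⁴ x₄ for a fifth root of
  -- unity ζ = c + i s with square c′ + i s′, in terms of the autocorrelations of x.
  module FifthRootNorm {c s c′ s′ : Carrier}
    (unit   : c * c + s * s ≈ φ (+ 1))
    (unit′  : c′ * c′ + s′ * s′ ≈ φ (+ 1))
    (power₂ : c * c - s * s ≈ c′)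
    (power₂-im : c * s + s * c ≈ s′)
    (power₃ : c * c′ - s * s′ ≈ c′)
    (power₄ : c′ * c′ - s′ * s′ ≈ c) (x₀ x₁ x₂ x₃ x₄ : Carrier) where

    real imaginary power lag₁ lag₂ : Carrier
    real      = x₀ + c * x₁ + c′ * x₂ + c′ * x₃ + c * x₄
    imaginary = s * x₁ + s′ * x₂ - s′ * x₃ - s * x₄
    power     = x₀ * x₀ + x₁ * x₁ + x₂ * x₂ + x₃ * x₃ + x₄ * x₄
    lag₁      = x₀ * x₄ + x₁ * x₀ + x₂ * x₁ + x₃ * x₂ + x₄ * x₃
    lag₂      = x₀ * x₃ + x₁ * x₄ + x₂ * x₀ + x₃ * x₁ + x₄ * x₂

    ratio : c * c′ + s * s′ ≈ c
    ratio = x∙y⁻¹≈ε⇒x≈y _ _ (trans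
      (solve 4 (λ c s c′ s′ → c :* c′ :+ s :* s′ :− c :=
          c :* (c :* c :+ s :* s :− con (+ 1)) :+ (:- c) :* (c :* c :− s :* s :− c′)
          :+ (:- s) :* (c :* s :+ s :* c :− s′))
        refl c s c′ s′)
      (c ⊛ x≈y⇒x∙y⁻¹≈ε unit
        ⊕ (- c) ⊛ x≈y⇒x∙y⁻¹≈ε power₂
        ⊕ (- s) ⊛ x≈y⇒x∙y⁻¹≈ε power₂-im))

    -- The product of x_j and x_k has the coefficient 2 Re ζ^(j - k), which is 2 c for j - k = ±1
    -- and 2 c′ for j - k = ±2 modulo 5. As x₃ and x₄ carry the conjugates of ζ² and ζ, only the
    -- pairs x₁ x₂ and x₃ x₄ need `ratio`.
    norm : real * real + imaginary * imaginary ≈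
           power + φ (+ 2) * (c * lag₁) + φ (+ 2) * (c′ * lag₂)
    norm = x∙y⁻¹≈ε⇒x≈y _ _ (trans
      (solve 9 (λ c s c′ s′ x₀ x₁ x₂ x₃ x₄ →
          let r = x₀ :+ c :* x₁ :+ c′ :* x₂ :+ c′ :* x₃ :+ c :* x₄
              i = s :* x₁ :+ s′ :* x₂ :− s′ :* x₃ :− s :* x₄
          in
          r :* r :+ i :* i :−
          (x₀ :* x₀ :+ x₁ :* x₁ :+ x₂ :* x₂ :+ x₃ :* x₃ :+ x₄ :* x₄
           :+ con (+ 2) :* (c :* (x₀ :* x₄ :+ x₁ :* x₀ :+ x₂ :* x₁ :+ x₃ :* x₂ :+ x₄ :* x₃))
           :+ con (+ 2) :* (c′ :* (x₀ :* x₃ :+ x₁ :* x₄ :+ x₂ :* x₀ :+ x₃ :* x₁ :+ x₄ :* x₂)))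
          :=
          (x₁ :* x₁ :+ x₄ :* x₄) :* (c :* c :+ s :* s :− con (+ 1))
          :+ (x₂ :* x₂ :+ x₃ :* x₃) :* (c′ :* c′ :+ s′ :* s′ :− con (+ 1))
          :+ (con (+ 2) :* (x₁ :* x₄)) :* (c :* c :− s :* s :− c′)
          :+ (con (+ 2) :* (x₁ :* x₃ :+ x₂ :* x₄)) :* (c :* c′ :− s :* s′ :− c′)
          :+ (con (+ 2) :* (x₂ :* x₃)) :* (c′ :* c′ :− s′ :* s′ :− c)
          :+ (con (+ 2) :* (x₁ :* x₂ :+ x₃ :* x₄)) :* (c :* c′ :+ s :* s′ :− c))
        refl c s c′ s′ x₀ x₁ x₂ x₃ x₄)
      ((x₁ * x₁ + x₄ * x₄) ⊛ x≈y⇒x∙y⁻¹≈ε unit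
        ⊕ (x₂ * x₂ + x₃ * x₃) ⊛ x≈y⇒x∙y⁻¹≈ε unit′
        ⊕ (φ (+ 2) * (x₁ * x₄)) ⊛ x≈y⇒x∙y⁻¹≈ε power₂
        ⊕ (φ (+ 2) * (x₁ * x₃ + x₂ * x₄)) ⊛ x≈y⇒x∙y⁻¹≈ε power₃
        ⊕ (φ (+ 2) * (x₂ * x₃)) ⊛ x≈y⇒x∙y⁻¹≈ε power₄
        ⊕ (φ (+ 2) * (x₁ * x₂ + x₃ * x₄)) ⊛ x≈y⇒x∙y⁻¹≈ε ratio))

    4norm : ∀ σ {q} → φ (+ 4) * c ≈ φ σ * q - φ (+ 1) →
      φ (+ 4) * c′ ≈ φ (ℤ.- σ) * q - φ (+ 1) →
      φ (+ 4) * (real * real + imaginary * imaginary) ≈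
      φ (+ 4) * power - φ (+ 2) * (lag₁ + lag₂) + φ σ * q * (φ (+ 2) * (lag₁ - lag₂))
    4norm σ {q} 4c 4c′ = trans (*-congˡ norm) (x∙y⁻¹≈ε⇒x≈y _ _ (trans
      (solve 8 (λ c c′ σ σ⁻ q p l₁ l₂ →
          con (+ 4) :* (p :+ con (+ 2) :* (c :* l₁) :+ con (+ 2) :* (c′ :* l₂)) :−
          (con (+ 4) :* p :− con (+ 2) :* (l₁ :+ l₂)
           :+ σ :* q :* (con (+ 2) :* (l₁ :− l₂))) :=
          (con (+ 2) :* l₁) :* (con (+ 4) :* c :− (σ :* q :− con (+ 1)))
          :+ (con (+ 2) :* l₂) :* (con (+ 4) :* c′ :− (σ⁻ :* q :− con (+ 1)))
          :+ (con (+ 2) :* l₂ :* q) :* (σ⁻ :− :- σ))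
        refl c c′ (φ σ) (φ (ℤ.- σ)) q power lag₁ lag₂)
      ((φ (+ 2) * lag₁) ⊛ x≈y⇒x∙y⁻¹≈ε 4c
        ⊕ (φ (+ 2) * lag₂) ⊛ x≈y⇒x∙y⁻¹≈ε 4c′
        -- To the solver φ (- σ) is an unrelated variable; this term identifies it with - φ σ.
        ⊕ (φ (+ 2) * lag₂ * q) ⊛ x≈y⇒x∙y⁻¹≈ε (-‿homo σ))))

open ≡ using (refl; sym; trans)

-- Autocorrelations of the compressions, in integers.

module IntegerCorrelations where

  open import Data.Nat.DivMod using (_/_)
  open GroupProperties (AbelianGroup.group ℤₚ.+-0-abelianGroup) using ()
    renaming (∙-cancelˡ to +-cancelˡ)
  open ℤ-Solver.+-*-Solver using (solve; _:=_; _:+_; _:*_; :-_; con)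
  open ℕ-Solver.+-*-Solver using () renaming
    (solve to ℕ-solve; _:=_ to _:≡_; _:+_ to _:⊕_; _:*_ to _:×_; con to ℕ-con)

  module ℤΣ where
    open RangeSum ℤₚ.+-0-commutativeMonoid public
    open SumOverPairs ℤₚ.+-0-commutativeMonoid public
    open SemiringSum (CommutativeRing.semiring ℤₚ.+-*-commutativeRing) public
      using (*-distribˡ-sum; *-distribʳ-sum; ∑-comm; ∑-distrib-+; sum-cong-≗; sum-permute)

  sum-toℕ : ∀ n f → sumℤ {n} (f ∘ toℕ) ≡ ℤΣ.Σ< f n
  sum-toℕ zero    f = refl
  sum-toℕ (suc n) f =
    trans (cong (λ s → f 0 ℤ.+ s) (sum-toℕ n (f ∘ suc))) (sym (ℤΣ.Σ<-head f n))

  -- Moving the window of length m by one place drops g c and adds g (c + m), which are equal.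
  -- Adding the dropped term `G 0` to both sides avoids subtracting sums.
  Σ<-shift : ∀ m (g : ℕ → ℤ) → (∀ t → g (t ℕ.+ m) ≡ g t) →
    ∀ c → ℤΣ.Σ< (λ t → g (c ℕ.+ t)) m ≡ ℤΣ.Σ< g m
  Σ<-shift m g periodic zero    = refl
  Σ<-shift m g periodic (suc c) = trans (+-cancelˡ (G 0) _ _ (begin
      G 0 ℤ.+ ℤΣ.Σ< (λ t → g (suc c ℕ.+ t)) m
        ≡⟨ cong (λ s → G 0 ℤ.+ s)
             (ℤΣ.Σ<-cong (λ t → cong g (sym (ℕₚ.+-suc c t))) m) ⟩
      G 0 ℤ.+ ℤΣ.Σ< (G ∘ suc) m
        ≡⟨ ℤΣ.Σ<-head G m ⟨
      ℤΣ.Σ< G m ℤ.+ G m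
        ≡⟨ cong (λ s → ℤΣ.Σ< G m ℤ.+ s) (trans (periodic c) (cong g (sym (ℕₚ.+-identityʳ c)))) ⟩
      ℤΣ.Σ< G m ℤ.+ G 0
        ≡⟨ ℤₚ.+-comm (ℤΣ.Σ< G m) (G 0) ⟩
      G 0 ℤ.+ ℤΣ.Σ< G m ∎))
    (Σ<-shift m g periodic c)
    where
    open ≡-Reasoning
    G : ℕ → ℤ
    G t = g (c ℕ.+ t)

  mod-cong : ∀ t u N .{{_ : ℕ.NonZero N}} → t % N ≡ u % N → t mod N ≡ u mod N
  mod-cong t u N h = fromℕ<-cong (t % N) (u % N) h (m%n<n t N) (m%n<n u N)

  toℕ-mod : ∀ {N} .{{_ : ℕ.NonZero N}} (i : Fin N) → toℕ i mod N ≡ i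
  toℕ-mod {N} i = toℕ-injective
    (trans (toℕ-fromℕ< (m%n<n (toℕ i) N)) (m<n⇒m%n≡m (toℕ<n i)))

  sum-compress : ∀ m {n} (a : Fin (m ℕ.* n) → ℤ) → sumℤ (compress m a) ≡ sumℤ a
  sum-compress m {n} a = trans (ℤΣ.∑-comm {n} {m} (λ j i → a (combine i j)))
    (sym (ℤΣ.sum-combine m {n} a))

  -- As k varies, the index runs once through the residue class of q - j modulo n. Reversing k makes
  -- it increasing; p and the carry e / n then only shift the window within the periodic sequence g.
  sum-⊖-combine : ∀ m {n} (a : Fin (m ℕ.* n) → ℤ) (p : Fin m) (q j : Fin n) →
    sumℤ {m} (λ k → a (combine p q ⊖ combine k j)) ≡ compress m a (q ⊖ j)
  sum-⊖-combine m@(suc m′) {n@(suc n′)} a p q j = begin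
    sumℤ {m} (λ k → a (combine p q ⊖ combine k j))
      ≡⟨ ℤΣ.sum-cong-≗ {m} (λ k → cong (λ t → a (t mod N)) (index k)) ⟩
    sumℤ {m} (λ k → g (c ℕ.+ toℕ (opposite k)))
      ≡⟨ ℤΣ.sum-permute {m} (λ k → g (c ℕ.+ toℕ k)) reverse ⟨
    sumℤ {m} (λ k → g (c ℕ.+ toℕ k))
      ≡⟨ sum-toℕ m (λ t → g (c ℕ.+ t)) ⟩
    ℤΣ.Σ< (λ t → g (c ℕ.+ t)) m
      ≡⟨ Σ<-shift m g periodic c ⟩
    ℤΣ.Σ< g m
      ≡⟨ sum-toℕ m g ⟨
    sumℤ {m} (g ∘ toℕ)
      ≡⟨ ℤΣ.sum-cong-≗ {m} (λ k → cong a (trans (mod-cong (toℕ k ℕ.* n ℕ.+ e % n) (toℕ (combine k (q ⊖ j))) N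
           (cong (_% N) (residue k))) (toℕ-mod (combine k (q ⊖ j))))) ⟩
    compress m a (q ⊖ j) ∎
    where
    open ≡-Reasoning
    N e c : ℕ
    N = m ℕ.* n
    e = toℕ q ℕ.+ (n ∸ toℕ j)
    c = toℕ p ℕ.+ e / n
    g : ℕ → ℤ
    g t = a ((t ℕ.* n ℕ.+ e % n) mod N)
    periodic : ∀ t → g (t ℕ.+ m) ≡ g t
    periodic t = cong a (mod-cong ((t ℕ.+ m) ℕ.* n ℕ.+ e % n) (t ℕ.* n ℕ.+ e % n) N (trans
      (cong (_% N) (ℕ-solve 4 (λ t m n r → (t :⊕ m) :× n :⊕ r :≡ t :× n :⊕ r :⊕ m :× n)
        refl t m n (e % n)))
      ([m+n]%n≡m%n (t ℕ.* n ℕ.+ e % n) N)))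
    residue : ∀ k → toℕ k ℕ.* n ℕ.+ e % n ≡ toℕ (combine k (q ⊖ j))
    residue k = sym (trans (toℕ-combine k (q ⊖ j))
      (cong₂ ℕ._+_ (ℕₚ.*-comm n (toℕ k)) (toℕ-fromℕ< (m%n<n e n))))
    -- Modulo N, subtracting n k + j amounts to adding n (m - 1 - k) + (n - j).
    index : ∀ k → toℕ (combine p q) ℕ.+ (N ∸ toℕ (combine k j)) ≡
                  (c ℕ.+ toℕ (opposite k)) ℕ.* n ℕ.+ e % n
    index k = begin
      toℕ (combine p q) ℕ.+ (N ∸ toℕ (combine k j))
        ≡⟨ cong₂ ℕ._+_ (toℕ-combine p q) (cong (N ∸_) (toℕ-combine k j)) ⟩
      n ℕ.* toℕ p ℕ.+ toℕ q ℕ.+ (N ∸ (n ℕ.* toℕ k ℕ.+ toℕ j))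
        ≡⟨ cong (λ t → n ℕ.* toℕ p ℕ.+ toℕ q ℕ.+ t) difference ⟩
      n ℕ.* toℕ p ℕ.+ toℕ q ℕ.+ (k′ ℕ.* n ℕ.+ (n ∸ toℕ j))
        ≡⟨ ℕ-solve 5 (λ n p q k d → n :× p :⊕ q :⊕ (k :× n :⊕ d) :≡
                                    (p :⊕ k) :× n :⊕ (q :⊕ d))
             refl n (toℕ p) (toℕ q) k′ (n ∸ toℕ j) ⟩
      (toℕ p ℕ.+ k′) ℕ.* n ℕ.+ e
        ≡⟨ cong (λ t → (toℕ p ℕ.+ k′) ℕ.* n ℕ.+ t) (m≡m%n+[m/n]*n e n) ⟩
      (toℕ p ℕ.+ k′) ℕ.* n ℕ.+ (e % n ℕ.+ e / n ℕ.* n)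
        ≡⟨ ℕ-solve 5 (λ p k n r d → (p :⊕ k) :× n :⊕ (r :⊕ d :× n) :≡
                                    (p :⊕ d :⊕ k) :× n :⊕ r)
             refl (toℕ p) k′ n (e % n) (e / n) ⟩
      (c ℕ.+ k′) ℕ.* n ℕ.+ e % n ∎
      where
      k′ = toℕ (opposite k)
      difference : N ∸ (n ℕ.* toℕ k ℕ.+ toℕ j) ≡ k′ ℕ.* n ℕ.+ (n ∸ toℕ j)
      difference = trans (cong (_∸ (n ℕ.* toℕ k ℕ.+ toℕ j)) (sym (begin
          k′ ℕ.* n ℕ.+ (n ∸ toℕ j) ℕ.+ (n ℕ.* toℕ k ℕ.+ toℕ j)
            ≡⟨ ℕ-solve 5 (λ k′ n d k j → k′ :× n :⊕ d :⊕ (n :× k :⊕ j) :≡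
                                         k′ :× n :⊕ k :× n :⊕ (d :⊕ j))
                 refl k′ n (n ∸ toℕ j) (toℕ k) (toℕ j) ⟩
          k′ ℕ.* n ℕ.+ toℕ k ℕ.* n ℕ.+ (n ∸ toℕ j ℕ.+ toℕ j)
            ≡⟨ cong (λ t → k′ ℕ.* n ℕ.+ toℕ k ℕ.* n ℕ.+ t) (ℕₚ.m∸n+n≡m (ℕₚ.<⇒≤ (toℕ<n j))) ⟩
          k′ ℕ.* n ℕ.+ toℕ k ℕ.* n ℕ.+ n
            ≡⟨ ℕ-solve 3 (λ k′ n k → k′ :× n :⊕ k :× n :⊕ n :≡
                                     (k′ :⊕ (ℕ-con 1 :⊕ k)) :× n) refl k′ n (toℕ k) ⟩
          (k′ ℕ.+ suc (toℕ k)) ℕ.* n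
            ≡⟨ cong (λ t → (t ℕ.+ suc (toℕ k)) ℕ.* n) (opposite-prop k) ⟩
          (m ∸ suc (toℕ k) ℕ.+ suc (toℕ k)) ℕ.* n
            ≡⟨ cong (ℕ._* n) (ℕₚ.m∸n+n≡m (toℕ<n k)) ⟩
          N ∎)))
        (ℕₚ.m+n∸n≡m (k′ ℕ.* n ℕ.+ (n ∸ toℕ j)) (n ℕ.* toℕ k ℕ.+ toℕ j))

  -- By `sum-⊖-combine` the sum over the lags depends on the position n p + q only through q, so the
  -- entries a (n p + q) can be summed over p on their own.
  PAF-compress : ∀ m {n} (a : Fin (m ℕ.* n) → ℤ) j →
    PAF (compress m a) j ≡ sumℤ {m} (λ k → PAF a (combine k j))
  PAF-compress m {n} a j = sym (begin
    sumℤ {m} (λ k → PAF a (combine k j))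
      ≡⟨ ℤΣ.∑-comm {m} {m ℕ.* n} (λ k i → a i ℤ.* a (i ⊖ combine k j)) ⟩
    sumℤ (λ i → sumℤ {m} (λ k → a i ℤ.* a (i ⊖ combine k j)))
      ≡⟨ ℤΣ.sum-combine m {n} _ ⟩
    sumℤ {m} (λ p → sumℤ {n} (λ q → sumℤ {m} (λ k →
      a (combine p q) ℤ.* a (combine p q ⊖ combine k j))))
      ≡⟨ ℤΣ.sum-cong-≗ {m} (λ p → ℤΣ.sum-cong-≗ {n} (λ q → trans
           (sym (ℤΣ.*-distribˡ-sum {m} (a (combine p q)) _))
           (cong (λ s → a (combine p q) ℤ.* s) (sum-⊖-combine m a p q j)))) ⟩
    sumℤ {m} (λ p → sumℤ {n} (λ q → a (combine p q) ℤ.* compress m a (q ⊖ j)))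
      ≡⟨ ℤΣ.∑-comm {m} {n} (λ p q → a (combine p q) ℤ.* compress m a (q ⊖ j)) ⟩
    sumℤ {n} (λ q → sumℤ {m} (λ p → a (combine p q) ℤ.* compress m a (q ⊖ j)))
      ≡⟨ ℤΣ.sum-cong-≗ {n} (λ q →
           sym (ℤΣ.*-distribʳ-sum {m} (compress m a (q ⊖ j)) (λ p → a (combine p q)))) ⟩
    PAF (compress m a) j ∎)
    where open ≡-Reasoning

  sum-odd : ∀ {m} (f : Fin m → ℤ) → (∀ i → f i ≡ -1ℤ ⊎ f i ≡ 1ℤ) →
    ∃[ e ] sumℤ f ≡ + 2 ℤ.* e ℤ.+ + m
  sum-odd {zero}  f h = 0ℤ , refl
  sum-odd {suc m} f h with sum-odd (f ∘ suc) (h ∘ suc) | h zero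
  ... | e , eq | inj₁ f₀≡-1 = e ℤ.- 1ℤ , trans (cong₂ ℤ._+_ f₀≡-1 eq)
    (solve 2 (λ e m → con -1ℤ :+ (con (+ 2) :* e :+ m) :=
                      con (+ 2) :* (e :+ :- con 1ℤ) :+ (con 1ℤ :+ m)) refl e (+ m))
  ... | e , eq | inj₂ f₀≡1 = e , trans (cong₂ ℤ._+_ f₀≡1 eq)
    (solve 2 (λ e m → con 1ℤ :+ (con (+ 2) :* e :+ m) :=
                      con (+ 2) :* e :+ (con 1ℤ :+ m)) refl e (+ m))

  -- Each product is 4 e e′ + 2 (e + e′) + 1. Over all five products every e j occurs twice in the
  -- middle terms, which makes these a multiple of 4, and the five ones add 4 + 1.
  PAF₂-odd : ∀ (A e : Fin 5 → ℤ) → (∀ j → A j ≡ + 2 ℤ.* e j ℤ.+ 1ℤ) →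
    ∃[ k ] PAF A 2F ≡ + 4 ℤ.* k ℤ.+ 1ℤ
  PAF₂-odd A e h = PAF e 2F ℤ.+ sumℤ e ℤ.+ 1ℤ , trans
    (ℤΣ.sum-cong-≗ {5} (λ i → cong₂ ℤ._*_ (h i) (h (i ⊖ 2F))))
    (solve 5 (λ a b c d e →
        let f = λ x → con (+ 2) :* x :+ con 1ℤ
        in f a :* f d :+ (f b :* f e :+ (f c :* f a :+ (f d :* f b :+ (f e :* f c :+ con 0ℤ)))) :=
        con (+ 4) :* (a :* d :+ (b :* e :+ (c :* a :+ (d :* b :+ (e :* c :+ con 0ℤ))))
          :+ (a :+ (b :+ (c :+ (d :+ (e :+ con 0ℤ))))) :+ con 1ℤ) :+ con 1ℤ)
      refl (e 0F) (e 1F) (e 2F) (e 3F) (e 4F))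

  -- The square is the sum of the autocorrelations at all five lags, and lags 4 and 3 repeat lags 1
  -- and 2.
  sum-square : ∀ (A : Fin 5 → ℤ) → sumℤ A ℤ.* sumℤ A ≡
    PAF A 0F ℤ.+ + 2 ℤ.* (PAF A 1F ℤ.+ PAF A 2F)
  sum-square A = solve 5 (λ a b c d e →
      let s = a :+ (b :+ (c :+ (d :+ (e :+ con 0ℤ))))
      in s :* s :=
      a :* a :+ (b :* b :+ (c :* c :+ (d :* d :+ (e :* e :+ con 0ℤ)))) :+ con (+ 2) :* (
      a :* e :+ (b :* a :+ (c :* b :+ (d :* c :+ (e :* d :+ con 0ℤ)))) :+
      (a :* d :+ (b :* e :+ (c :* a :+ (d :* b :+ (e :* c :+ con 0ℤ)))))))
    refl (A 0F) (A 1F) (A 2F) (A 3F) (A 4F)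

  parity : ∀ m → ∃[ h ] (m ≡ h ℕ.* 2 ⊎ m ≡ suc (h ℕ.* 2))
  parity zero    = 0 , inj₁ refl
  parity (suc m) with parity m
  ... | h , inj₁ even = h , inj₂ (cong suc even)
  ... | h , inj₂ odd  = suc h , inj₁ (cong suc odd)

  sum-const : ∀ m c → sumℤ {m} (λ _ → c) ≡ + m ℤ.* c
  sum-const zero    c = sym (ℤₚ.*-zeroˡ c)
  sum-const (suc m) c = trans (cong (λ s → c ℤ.+ s) (sum-const m c))
    (solve 2 (λ m c → c :+ m :* c := (con 1ℤ :+ m) :* c) refl (+ m) c)

  +[m*n+1] : ∀ m n → + (m ℕ.* n ℕ.+ 1) ≡ + m ℤ.* + n ℤ.+ 1ℤ
  +[m*n+1] m n = cong (λ i → i ℤ.+ 1ℤ) (ℤₚ.pos-* m n)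

  -- The m lags 5 k + 1 are all nonzero, so each of them contributes -2.
  lag₁-sum : ∀ m {a b : Fin (m ℕ.* 5) → ℤ} → LegendrePair a b →
    PAF (compress m a) 1F ℤ.+ PAF (compress m b) 1F ≡ + m ℤ.* -[1+ 1 ]
  lag₁-sum m {a} {b} legendre = trans
    (cong₂ ℤ._+_ (PAF-compress m a 1F) (PAF-compress m b 1F))
    (trans (sym (ℤΣ.∑-distrib-+ {m} (λ k → PAF a (combine k 1F)) (λ k → PAF b (combine k 1F))))
    (trans (ℤΣ.sum-cong-≗ {m} (λ k → PAF-sum (combine k 1F) (nonzero k)))
      (sum-const m -[1+ 1 ])))
    where
    open LegendrePair legendre
    nonzero : ∀ (k : Fin m) → toℕ (combine k (suc (zero {3}))) ≢ 0
    nonzero k eq = ℕₚ.m+1+n≢0 (5 ℕ.* toℕ k) (trans (sym (toℕ-combine k 1F)) eq)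

  -- The quantity x of the first condition, up to sign.
  offset : ∀ m → (Fin (m ℕ.* 5) → ℤ) → ℤ
  offset m a = ℤ.- + m ℤ.- PAF (compress m a) 2F

  module _ (m : ℕ) {a : Fin (m ℕ.* 5) → ℤ} (sum≡1 : sumℤ a ≡ 1ℤ) where

    private
      A = compress m a
      P₀ = PAF A 0F
      P₁ = PAF A 1F
      P₂ = PAF A 2F

    PAF-total : P₀ ℤ.+ + 2 ℤ.* (P₁ ℤ.+ P₂) ≡ 1ℤ
    PAF-total = trans (sym (sum-square A))
      (cong₂ ℤ._*_ (trans (sum-compress m a) sum≡1) (trans (sum-compress m a) sum≡1))

    spectrum-mean : + 4 ℤ.* P₀ ℤ.- + 2 ℤ.* (P₁ ℤ.+ P₂) ≡ + 5 ℤ.* P₀ ℤ.- 1ℤ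
    spectrum-mean = trans
      (solve 2 (λ p s → con (+ 4) :* p :+ :- (con (+ 2) :* s) :=
                          con (+ 5) :* p :+ :- (p :+ con (+ 2) :* s)) refl P₀ (P₁ ℤ.+ P₂))
      (cong (λ t → + 5 ℤ.* P₀ ℤ.- t) PAF-total)

    -- S is the part of 4 PSD free of √5, and the hypothesis is four times the sum of the PSD values
    -- at r = 1 and r = 2. It reads 10 P₀ - 2 = 40 m + 8.
    power-from-mean :
      let S = + 4 ℤ.* P₀ ℤ.- + 2 ℤ.* (P₁ ℤ.+ P₂) in
      S ℤ.+ S ≡ + 8 ℤ.* + (m ℕ.* 5 ℕ.+ 1) → P₀ ≡ + (4 ℕ.* m ℕ.+ 1)
    power-from-mean 2S≡ = trans
      (ℤₚ.*-cancelˡ-≡ (+ 10) P₀ (+ 4 ℤ.* + m ℤ.+ 1ℤ) (begin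
        + 10 ℤ.* P₀
          ≡⟨ solve 1 (λ p → con (+ 10) :* p :=
               let s = con (+ 5) :* p :+ :- con 1ℤ in s :+ s :+ con (+ 2)) refl P₀ ⟩
        + 5 ℤ.* P₀ ℤ.- 1ℤ ℤ.+ (+ 5 ℤ.* P₀ ℤ.- 1ℤ) ℤ.+ + 2
          ≡⟨ cong (λ s → s ℤ.+ s ℤ.+ + 2) spectrum-mean ⟨
        + 4 ℤ.* P₀ ℤ.- + 2 ℤ.* (P₁ ℤ.+ P₂) ℤ.+
        (+ 4 ℤ.* P₀ ℤ.- + 2 ℤ.* (P₁ ℤ.+ P₂)) ℤ.+ + 2
          ≡⟨ cong (λ s → s ℤ.+ + 2) 2S≡ ⟩
        + 8 ℤ.* + (m ℕ.* 5 ℕ.+ 1) ℤ.+ + 2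
          ≡⟨ cong (λ l → + 8 ℤ.* l ℤ.+ + 2) (+[m*n+1] m 5) ⟩
        + 8 ℤ.* (+ m ℤ.* + 5 ℤ.+ 1ℤ) ℤ.+ + 2
          ≡⟨ solve 1 (λ m → con (+ 8) :* (m :* con (+ 5) :+ con 1ℤ) :+ con (+ 2) :=
               con (+ 10) :* (con (+ 4) :* m :+ con 1ℤ)) refl (+ m) ⟩
        + 10 ℤ.* (+ 4 ℤ.* + m ℤ.+ 1ℤ) ∎))
      (sym (+[m*n+1] 4 m))
      where open ≡-Reasoning

    mean-from-power : P₀ ≡ + 4 ℤ.* + m ℤ.+ 1ℤ →
      + 4 ℤ.* P₀ ℤ.- + 2 ℤ.* (P₁ ℤ.+ P₂) ≡ + 4 ℤ.* + (m ℕ.* 5 ℕ.+ 1)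
    mean-from-power P₀≡ = trans spectrum-mean
      (trans (cong (λ p → + 5 ℤ.* p ℤ.- 1ℤ) P₀≡)
      (trans (solve 1 (λ m → con (+ 5) :* (con (+ 4) :* m :+ con 1ℤ) :+ :- con 1ℤ :=
                             con (+ 4) :* (m :* con (+ 5) :+ con 1ℤ)) refl (+ m))
        (cong (λ l → + 4 ℤ.* l) (sym (+[m*n+1] m 5)))))

    -- 2 (P₁ - P₂) is the total 1 diminished by P₀ + 4 P₂. The value of P₀ makes it divisible by 4,
    -- so the coefficient of √5 in the PSD itself is an integer.
    spectrum-spread : P₀ ≡ + 4 ℤ.* + m ℤ.+ 1ℤ →
      + 2 ℤ.* (P₁ ℤ.- P₂) ≡ + 4 ℤ.* offset m a
    spectrum-spread P₀≡ = trans
      (solve 3 (λ p x y → con (+ 2) :* (x :+ :- y) :=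
          p :+ con (+ 2) :* (x :+ y) :+ :- (p :+ con (+ 4) :* y)) refl P₀ P₁ P₂)
      (trans (cong₂ (λ s p → s ℤ.- (p ℤ.+ + 4 ℤ.* P₂)) PAF-total P₀≡)
        (solve 2 (λ m y → con 1ℤ :+ :- (con (+ 4) :* m :+ con 1ℤ :+ con (+ 4) :* y) :=
                            con (+ 4) :* (:- m :+ :- y)) refl (+ m) P₂))

  -- As 5 m is odd, so is m, and each entry of the compression is a sum of m signs.
  compress-odd : ∀ m → ¬ (2 ℕ.∣ m ℕ.* 5) → (a : Fin (m ℕ.* 5) → ℤ) →
    (∀ i → a i ≡ -1ℤ ⊎ a i ≡ 1ℤ) →
    ∃[ h ] + m ≡ + 2 ℤ.* h ℤ.+ 1ℤ × ∃[ k ] PAF (compress m a) 2F ≡ + 4 ℤ.* k ℤ.+ 1ℤ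
  compress-odd m odd a binary with parity m
  ... | h , inj₁ m≡2h = ⊥-elim (odd (ℕ.divides (h ℕ.* 5)
    (trans (cong (ℕ._* 5) m≡2h) (trans (ℕₚ.*-assoc h 2 5) (sym (ℕₚ.*-assoc h 5 2))))))
  ... | h , inj₂ m≡1+2h = + h , +m , PAF₂-odd (compress m a) (λ j → proj₁ (e j) ℤ.+ + h)
    λ j → trans (proj₂ (e j)) (trans (cong (λ t → + 2 ℤ.* proj₁ (e j) ℤ.+ t) +m)
      (solve 2 (λ e h → con (+ 2) :* e :+ (con (+ 2) :* h :+ con 1ℤ) :=
                          con (+ 2) :* (e :+ h) :+ con 1ℤ) refl (proj₁ (e j)) (+ h)))
    where
    e : ∀ j → ∃[ e ] compress m a j ≡ + 2 ℤ.* e ℤ.+ + m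
    e j = sum-odd (λ i → a (combine i j)) (λ i → binary (combine i j))
    +m : + m ≡ + 2 ℤ.* + h ℤ.+ 1ℤ
    +m = trans (cong +_ (trans m≡1+2h (ℕₚ.+-comm 1 (h ℕ.* 2))))
      (trans (+[m*n+1] h 2) (cong (λ i → i ℤ.+ 1ℤ) (ℤₚ.*-comm (+ h) (+ 2))))

  -- With P₂ = 4 k + 1 the difference from -(ℓ + 1) is 4 m - 4 k, and that from ℓ + 1 is - 6 m - 4 k
  -- - 2, a multiple of 4 because m = 2 h + 1.
  offset-mod-4 : ∀ m → ¬ (2 ℕ.∣ m ℕ.* 5) → (a : Fin (m ℕ.* 5) → ℤ) →
    (∀ i → a i ≡ -1ℤ ⊎ a i ≡ 1ℤ) →
    offset m a ≡ ℤ.- + (m ℕ.* 5 ℕ.+ 1) [mod 4 ] × offset m a ≡ + (m ℕ.* 5 ℕ.+ 1) [mod 4 ]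
  offset-mod-4 m odd a binary with compress-odd m odd a binary
  ... | h , m≡2h+1 , k , P₂≡4k+1 =
    ∣⇒∣ᵤ (divides (+ m ℤ.- k) (trans
      (cong₂ (λ p l → ℤ.- + m ℤ.- p ℤ.- ℤ.- l) P₂≡4k+1 (+[m*n+1] m 5))
      (solve 2 (λ m k →
          :- m :+ :- (con (+ 4) :* k :+ con 1ℤ) :+ :- (:- (m :* con (+ 5) :+ con 1ℤ)) :=
          (m :+ :- k) :* con (+ 4)) refl (+ m) k))) ,
    ∣⇒∣ᵤ (divides (-[1+ 1 ] ℤ.- + 3 ℤ.* h ℤ.- k) (trans
      (cong₂ (λ p l → ℤ.- + m ℤ.- p ℤ.- l) P₂≡4k+1 (+[m*n+1] m 5))
      (trans (cong (λ m → ℤ.- m ℤ.- (+ 4 ℤ.* k ℤ.+ 1ℤ) ℤ.- (m ℤ.* + 5 ℤ.+ 1ℤ)) m≡2h+1)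
        (solve 2 (λ h k →
            let m = con (+ 2) :* h :+ con 1ℤ
            in :- m :+ :- (con (+ 4) :* k :+ con 1ℤ) :+ :- (m :* con (+ 5) :+ con 1ℤ) :=
               (con -[1+ 1 ] :+ :- (con (+ 3) :* h) :+ :- k) :* con (+ 4)) refl h k))))

  module _ (m : ℕ) {a b : Fin (m ℕ.* 5) → ℤ} (legendre : LegendrePair a b)
    (sum-a≡1 : sumℤ a ≡ 1ℤ) (sum-b≡1 : sumℤ b ≡ 1ℤ) where

    -- The two totals express 2 (P₁ - P₂) + 2 (Q₁ - Q₂) as 4 (P₁ + Q₁) + P₀ + Q₀ - 2. Here 4 (P₁ +
    -- Q₁) = - 8 m by `lag₁-sum`, and P₀ + Q₀ - 2 = 8 m.
    offset-sum : PAF (compress m a) 0F ≡ + 4 ℤ.* + m ℤ.+ 1ℤ →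
      PAF (compress m b) 0F ≡ + 4 ℤ.* + m ℤ.+ 1ℤ → offset m b ≡ ℤ.- offset m a
    offset-sum P₀≡ Q₀≡ = ℤₚ.*-cancelˡ-≡ (+ 4) (offset m b) (ℤ.- offset m a) (begin
      + 4 ℤ.* offset m b
        ≡⟨ spectrum-spread m sum-b≡1 Q₀≡ ⟨
      + 2 ℤ.* (Q₁ ℤ.- Q₂)
        ≡⟨ solve 6 (λ p₀ p₁ p₂ q₀ q₁ q₂ →
             con (+ 2) :* (q₁ :+ :- q₂) :=
             con (+ 4) :* (p₁ :+ q₁) :+ p₀ :+ q₀
             :+ :- (p₀ :+ con (+ 2) :* (p₁ :+ p₂)) :+ :- (q₀ :+ con (+ 2) :* (q₁ :+ q₂))
             :+ :- (con (+ 2) :* (p₁ :+ :- p₂)))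
             refl P₀ P₁ P₂ Q₀ Q₁ Q₂ ⟩
      + 4 ℤ.* (P₁ ℤ.+ Q₁) ℤ.+ P₀ ℤ.+ Q₀
        ℤ.- (P₀ ℤ.+ + 2 ℤ.* (P₁ ℤ.+ P₂)) ℤ.- (Q₀ ℤ.+ + 2 ℤ.* (Q₁ ℤ.+ Q₂))
        ℤ.- + 2 ℤ.* (P₁ ℤ.- P₂)
        ≡⟨ cong₂ (λ s t → s ℤ.- t ℤ.- (Q₀ ℤ.+ + 2 ℤ.* (Q₁ ℤ.+ Q₂)) ℤ.- + 2 ℤ.* (P₁ ℤ.- P₂))
             (cong₂ ℤ._+_ (cong₂ (λ s p → + 4 ℤ.* s ℤ.+ p) (lag₁-sum m legendre) P₀≡) Q₀≡)
             (PAF-total m sum-a≡1) ⟩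
      + 4 ℤ.* (+ m ℤ.* -[1+ 1 ]) ℤ.+ (+ 4 ℤ.* + m ℤ.+ 1ℤ) ℤ.+ (+ 4 ℤ.* + m ℤ.+ 1ℤ)
        ℤ.- 1ℤ ℤ.- (Q₀ ℤ.+ + 2 ℤ.* (Q₁ ℤ.+ Q₂)) ℤ.- + 2 ℤ.* (P₁ ℤ.- P₂)
        ≡⟨ cong₂ (λ s t → + 4 ℤ.* (+ m ℤ.* -[1+ 1 ]) ℤ.+ (+ 4 ℤ.* + m ℤ.+ 1ℤ)
               ℤ.+ (+ 4 ℤ.* + m ℤ.+ 1ℤ) ℤ.- 1ℤ ℤ.- s ℤ.- t)
             (PAF-total m sum-b≡1) (spectrum-spread m sum-a≡1 P₀≡) ⟩
      + 4 ℤ.* (+ m ℤ.* -[1+ 1 ]) ℤ.+ (+ 4 ℤ.* + m ℤ.+ 1ℤ) ℤ.+ (+ 4 ℤ.* + m ℤ.+ 1ℤ)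
        ℤ.- 1ℤ ℤ.- 1ℤ ℤ.- + 4 ℤ.* offset m a
        ≡⟨ solve 2 (λ m y →
             let 4m+1 = con (+ 4) :* m :+ con 1ℤ
             in con (+ 4) :* (m :* con -[1+ 1 ]) :+ 4m+1 :+ 4m+1
                :+ :- con 1ℤ :+ :- con 1ℤ :+ :- (con (+ 4) :* y) :=
                con (+ 4) :* (:- y)) refl (+ m) (offset m a) ⟩
      + 4 ℤ.* (ℤ.- offset m a) ∎)
      where
      open ≡-Reasoning
      P₀ P₁ P₂ Q₀ Q₁ Q₂ : ℤ
      P₀ = PAF (compress m a) 0F
      P₁ = PAF (compress m a) 1F
      P₂ = PAF (compress m a) 2F
      Q₀ = PAF (compress m b) 0F
      Q₁ = PAF (compress m b) 1F
      Q₂ = PAF (compress m b) 2F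

open IntegerCorrelations

-- Products of partial sums of the exponential series.

module ExponentialSums where

  open import Data.Rational.Base
  open import Data.Rational.Properties
  open +-*-Solver using (solve; _:=_; _:+_; _:*_; :-_; con)

  0ᵢ 1ᵢ : ℚ[i]
  0ᵢ = 0ℚ +i 0ℚ
  1ᵢ = 1ℚ +i 0ℚ

  ℚ[i]-commutativeRing : CommutativeRing 0ℓ 0ℓ
  ℚ[i]-commutativeRing = record
    { Carrier = ℚ[i] ; _≈_ = _≡_ ; _+_ = _+ᵢ_ ; _*_ = _*ᵢ_ ; -_ = λ u → (- re u) +i (- im u)
    ; 0# = 0ᵢ ; 1# = 1ᵢ
    ; isCommutativeRing = record
      { isRing = record
        { +-isAbelianGroup = record
          { isGroup = record
            { isMonoid = record
              { isSemigroup = record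
                { isMagma = record
                  { isEquivalence = isEquivalence
                  ; ∙-cong        = cong₂ _+ᵢ_
                  }
                ; assoc = λ u v w → cong₂ _+i_ (+-assoc (re u) (re v) (re w))
                                               (+-assoc (im u) (im v) (im w))
                }
              ; identity =
                  (λ u → cong₂ _+i_ (+-identityˡ (re u)) (+-identityˡ (im u))) ,
                  (λ u → cong₂ _+i_ (+-identityʳ (re u)) (+-identityʳ (im u)))
              }
            ; inverse =
                (λ u → cong₂ _+i_ (+-inverseˡ (re u)) (+-inverseˡ (im u))) ,
                (λ u → cong₂ _+i_ (+-inverseʳ (re u)) (+-inverseʳ (im u)))
            ; ⁻¹-cong = cong (λ u → (- re u) +i (- im u))
            }
          ; comm = λ u v → cong₂ _+i_ (+-comm (re u) (re v)) (+-comm (im u) (im v))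
          }
        ; *-cong     = cong₂ _*ᵢ_
        ; *-assoc    = *ᵢ-assoc
        ; *-identity = *ᵢ-identityˡ , λ u → trans (*ᵢ-comm u 1ᵢ) (*ᵢ-identityˡ u)
        ; distrib    = *ᵢ-distribˡ , λ u v w →
            trans (*ᵢ-comm (v +ᵢ w) u) (trans (*ᵢ-distribˡ u v w)
              (cong₂ _+ᵢ_ (*ᵢ-comm u v) (*ᵢ-comm u w)))
        }
      ; *-comm = *ᵢ-comm
      }
    }
    where
    *ᵢ-comm : ∀ u v → u *ᵢ v ≡ v *ᵢ u
    *ᵢ-comm (a +i b) (c +i d) = cong₂ _+i_
      (solve 4 (λ a b c d → a :* c :+ :- (b :* d) := c :* a :+ :- (d :* b))
        refl a b c d)
      (solve 4 (λ a b c d → a :* d :+ b :* c := c :* b :+ d :* a) refl a b c d)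
    *ᵢ-assoc : ∀ u v w → u *ᵢ v *ᵢ w ≡ u *ᵢ (v *ᵢ w)
    *ᵢ-assoc (a +i b) (c +i d) (e +i f) = cong₂ _+i_
      (solve 6 (λ a b c d e f →
          (a :* c :+ :- (b :* d)) :* e :+ :- ((a :* d :+ b :* c) :* f) :=
          a :* (c :* e :+ :- (d :* f)) :+ :- (b :* (c :* f :+ d :* e)))
        refl a b c d e f)
      (solve 6 (λ a b c d e f →
          (a :* c :+ :- (b :* d)) :* f :+ (a :* d :+ b :* c) :* e :=
          a :* (c :* f :+ d :* e) :+ b :* (c :* e :+ :- (d :* f)))
        refl a b c d e f)
    *ᵢ-identityˡ : ∀ u → 1ᵢ *ᵢ u ≡ u
    *ᵢ-identityˡ (a +i b) = cong₂ _+i_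
      (solve 2 (λ a b → con 1ℚ :* a :+ :- (con 0ℚ :* b) := a) refl a b)
      (solve 2 (λ a b → con 1ℚ :* b :+ con 0ℚ :* a := b) refl a b)
    *ᵢ-distribˡ : ∀ u v w → u *ᵢ (v +ᵢ w) ≡ u *ᵢ v +ᵢ u *ᵢ w
    *ᵢ-distribˡ (a +i b) (c +i d) (e +i f) = cong₂ _+i_
      (solve 6 (λ a b c d e f →
          a :* (c :+ e) :+ :- (b :* (d :+ f)) :=
          a :* c :+ :- (b :* d) :+ (a :* e :+ :- (b :* f))) refl a b c d e f)
      (solve 6 (λ a b c d e f →
          a :* (d :+ f) :+ b :* (c :+ e) := a :* d :+ b :* c :+ (a :* f :+ b :* e))
        refl a b c d e f)

  ℚ-semiring ℚ[i]-semiring : CommutativeSemiring 0ℓ 0ℓ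
  ℚ-semiring    = CommutativeRing.commutativeSemiring +-*-commutativeRing
  ℚ[i]-semiring = CommutativeRing.commutativeSemiring ℚ[i]-commutativeRing

  •-scalar : ∀ q u → q • u ≡ (q +i 0ℚ) *ᵢ u
  •-scalar q (a +i b) = cong₂ _+i_
    (solve 3 (λ q a b → q :* a := q :* a :+ :- (con 0ℚ :* b)) refl q a b)
    (solve 3 (λ q a b → q :* b := q :* b :+ con 0ℚ :* a) refl q a b)

  fromℕᵢ 1/sucᵢ : ℕ → ℚ[i]
  fromℕᵢ n = fromℕ n +i 0ℚ
  1/sucᵢ n = 1/suc n +i 0ℚ

  fromℕᵢ-suc : ∀ n → fromℕᵢ (suc n) ≡ 1ᵢ +ᵢ fromℕᵢ n
  fromℕᵢ-suc n = cong₂ _+i_ (fromℕ-suc n) (sym (+-identityˡ 0ℚ))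

  1/suc*suc : ∀ k → 1/suc k * fromℕ (suc k) ≡ 1ℚ
  1/suc*suc k = trans (*-comm (1/suc k) (fromℕ (suc k))) (suc*1/suc k)

  1/suc*sucᵢ : ∀ k → 1/sucᵢ k *ᵢ fromℕᵢ (suc k) ≡ 1ᵢ
  1/suc*sucᵢ k = trans (sym (•-scalar (1/suc k) (fromℕᵢ (suc k))))
    (cong₂ _+i_ (1/suc*suc k) (*-zeroʳ (1/suc k)))

  module ℚC = Convolution ℚ-semiring fromℕ
  module ℂC = Convolution ℚ[i]-semiring fromℕᵢ

  expTerm-isExp : ∀ z → ℂC.IsExp z (λ k → expTerm k z)
  expTerm-isExp z = record
    { initial    = refl
    ; derivative = λ k → trans
        (cong (fromℕᵢ (suc k) *ᵢ_) (•-scalar (1/suc k) (expTerm k z *ᵢ z)))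
        (trans (sym (*-assocᵢ (fromℕᵢ (suc k)) (1/sucᵢ k) (expTerm k z *ᵢ z)))
        (trans (cong (_*ᵢ (expTerm k z *ᵢ z))
                 (trans (*-commᵢ (fromℕᵢ (suc k)) (1/sucᵢ k)) (1/suc*sucᵢ k)))
          (*-identityˡᵢ (expTerm k z *ᵢ z))))
    }
    where
    open CommutativeSemiring ℚ[i]-semiring using ()
      renaming (*-assoc to *-assocᵢ; *-comm to *-commᵢ; *-identityˡ to *-identityˡᵢ)

  majorant-isExp : ∀ B 0≤B → ℚC.IsExp B (Majorant.t B 0≤B)
  majorant-isExp B 0≤B = record
    { initial    = refl
    ; derivative = λ k → trans (sym (*-assoc (fromℕ (suc k)) (1/suc k) (t k * B)))
        (trans (cong (_* (t k * B)) (suc*1/suc k)) (*-identityˡ (t k * B)))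
    }
    where open Majorant B 0≤B

  expSum-Σ : ∀ n z → expSum n z ≡ ℂC.Σ< (λ k → expTerm k z) n
  expSum-Σ zero    z = refl
  expSum-Σ (suc n) z = cong (_+ᵢ expTerm n z) (expSum-Σ n z)

  majorant-Σ : ∀ B 0≤B n → Majorant.s B 0≤B n ≡ ℚC.Σ< (Majorant.t B 0≤B) n
  majorant-Σ B 0≤B zero    = refl
  majorant-Σ B 0≤B (suc n) = cong (_+ Majorant.t B 0≤B n) (majorant-Σ B 0≤B n)

  expSum-tri : ∀ z w n →
    expSum n (z +ᵢ w) ≡ ℂC.tri (λ k → expTerm k z) (λ k → expTerm k w) n
  expSum-tri z w n = trans (expSum-Σ n (z +ᵢ w))
    (trans (ℂC.Σ<-cong (ℂC.exp-unique 1/sucᵢ 1/suc*sucᵢ (expTerm-isExp (z +ᵢ w))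
             (ℂC.conv-exp refl fromℕᵢ-suc (expTerm-isExp z) (expTerm-isExp w))) n)
      (sym (ℂC.tri≈Σ<conv (λ k → expTerm k z) (λ k → expTerm k w) n)))

  -- The majorant has the coefficients B^k / k!, so the formal addition theorem applies to it too.
  -- It turns the bound of `rectangle-tri` into partial sums of a single series, at B + C.
  majorant-tri : ∀ B 0≤B C 0≤C 0≤B+C n →
    Majorant.s (B + C) 0≤B+C n ≡
    ℚC.tri (Majorant.t B 0≤B) (Majorant.t C 0≤C) n
  majorant-tri B 0≤B C 0≤C 0≤B+C n = trans (majorant-Σ (B + C) 0≤B+C n)
    (trans (ℚC.Σ<-cong (ℚC.exp-unique 1/suc 1/suc*suc (majorant-isExp (B + C) 0≤B+C)
             (ℚC.conv-exp refl fromℕ-suc (majorant-isExp B 0≤B)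
                                         (majorant-isExp C 0≤C))) n)
      (sym (ℚC.tri≈Σ<conv (Majorant.t B 0≤B) (Majorant.t C 0≤C) n)))

  Σ<-tail : ∀ {g G} → (∀ k → norm₁ (g k) ≤ G k) → ∀ d n →
    norm₁ (ℂC.Σ< g (d ℕ.+ n) -ᵢ ℂC.Σ< g n) ≤ ℚC.Σ< G (d ℕ.+ n) - ℚC.Σ< G n
  Σ<-tail {g} {G} hg zero    n = ≤-reflexive (trans
    (cong norm₁ (cong₂ _+i_ (+-inverseʳ (re (ℂC.Σ< g n)))
                            (+-inverseʳ (im (ℂC.Σ< g n)))))
    (sym (+-inverseʳ (ℚC.Σ< G n))))
  Σ<-tail {g} {G} hg (suc d) n = ≤-trans
    (≤-reflexive (cong norm₁ (cong₂ _+i_ (shift (re S) (re T) (re U))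
                                         (shift (im S) (im T) (im U)))))
    (≤-trans (norm₁-+ (S -ᵢ U) T)
    (≤-trans (+-mono-≤ (Σ<-tail hg d n) (hg (d ℕ.+ n)))
      (≤-reflexive (sym (shift (ℚC.Σ< G (d ℕ.+ n)) (G (d ℕ.+ n)) (ℚC.Σ< G n))))))
    where
    S = ℂC.Σ< g (d ℕ.+ n)
    T = g (d ℕ.+ n)
    U = ℂC.Σ< g n
    shift : ∀ a b c → a + b - c ≡ a - c + b
    shift = solve 3 (λ a b c → a :+ b :+ :- c := a :+ :- c :+ b) refl

  -- The difference collects the f j g k with j < n ≤ j + k.
  rectangle-tri : ∀ {f g F G} →
    (∀ k → norm₁ (f k) ≤ F k) → (∀ k → norm₁ (g k) ≤ G k) → ∀ n d →
    norm₁ ((ℂC.Σ< f n *ᵢ ℂC.Σ< g (d ℕ.+ n)) -ᵢ ℂC.tri f g n) ≤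
    ℚC.Σ< F n * ℚC.Σ< G (d ℕ.+ n) - ℚC.tri F G n
  rectangle-tri {f} {g} {F} {G} hf hg zero d = ≤-reflexive
    (trans (cong norm₁ (cong₂ _+i_
        (solve 2 (λ a b → con 0ℚ :* a :+ :- (con 0ℚ :* b) :+ :- con 0ℚ := con 0ℚ)
          refl (re X) (im X))
        (solve 2 (λ a b → con 0ℚ :* b :+ con 0ℚ :* a :+ :- con 0ℚ := con 0ℚ)
          refl (re X) (im X))))
      (solve 1 (λ a → con 0ℚ := con 0ℚ :* a :+ :- con 0ℚ) refl (ℚC.Σ< G (d ℕ.+ 0))))
    where X = ℂC.Σ< g (d ℕ.+ 0)
  rectangle-tri {f} {g} {F} {G} hf hg (suc n) d = ≤-trans
    (≤-reflexive (cong norm₁ (trans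
      (cong (λ s → (s *ᵢ X) -ᵢ (f 0 *ᵢ Y +ᵢ T)) (ℂC.Σ<-head f n))
      (splitᵢ (f 0) S X Y T))))
    (≤-trans (norm₁-+ (f 0 *ᵢ (X -ᵢ Y)) ((S *ᵢ X) -ᵢ T))
    (≤-trans (+-mono-≤
        (≤-trans (norm₁-* (f 0) (X -ᵢ Y))
          (*-mono-0≤ (≤-trans (0≤norm₁ (f 0)) (hf 0)) (0≤norm₁ (X -ᵢ Y)) (hf 0)
            (Σ<-tail hg d (suc n))))
        IH)
      (≤-reflexive (sym (trans
        (cong (λ s → s * X′ - (F 0 * Y′ + T′)) (ℚC.Σ<-head F n))
        (split (F 0) S′ X′ Y′ T′))))))
    where
    X = ℂC.Σ< g (d ℕ.+ suc n)
    Y = ℂC.Σ< g (suc n)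
    S = ℂC.Σ< (f ∘ suc) n
    T = ℂC.tri (f ∘ suc) g n
    X′ = ℚC.Σ< G (d ℕ.+ suc n)
    Y′ = ℚC.Σ< G (suc n)
    S′ = ℚC.Σ< (F ∘ suc) n
    T′ = ℚC.tri (F ∘ suc) G n
    -- Removing a column leaves the height d + (n + 1) of the rectangle unchanged; relative to n it
    -- is the height with excess d + 1, which is why d is general.
    IH : norm₁ ((S *ᵢ X) -ᵢ T) ≤ S′ * X′ - T′
    IH = subst (λ e → norm₁ ((S *ᵢ ℂC.Σ< g e) -ᵢ T) ≤ S′ * ℚC.Σ< G e - T′)
      (sym (ℕₚ.+-suc d n)) (rectangle-tri (hf ∘ suc) hg n (suc d))
    split : ∀ a s x y t → (a + s) * x - (a * y + t) ≡ a * (x - y) + (s * x - t)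
    split = solve 5 (λ a s x y t → (a :+ s) :* x :+ :- (a :* y :+ t) :=
      a :* (x :+ :- y) :+ (s :* x :+ :- t)) refl
    splitᵢ : ∀ a s x y t → ((a +ᵢ s) *ᵢ x) -ᵢ (a *ᵢ y +ᵢ t) ≡
                           a *ᵢ (x -ᵢ y) +ᵢ ((s *ᵢ x) -ᵢ t)
    splitᵢ (a +i a′) (s +i s′) (x +i x′) (y +i y′) (t +i t′) = cong₂ _+i_
      (solve 9 (λ a a′ s s′ x x′ y y′ t →
        (a :+ s) :* x :+ :- ((a′ :+ s′) :* x′) :+ :- (a :* y :+ :- (a′ :* y′) :+ t) :=
        a :* (x :+ :- y) :+ :- (a′ :* (x′ :+ :- y′)) :+ (s :* x :+ :- (s′ :* x′) :+ :- t))
        refl a a′ s s′ x x′ y y′ t)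
      (solve 9 (λ a a′ s s′ x x′ y y′ t →
        (a :+ s) :* x′ :+ (a′ :+ s′) :* x :+ :- (a :* y′ :+ a′ :* y :+ t) :=
        a :* (x′ :+ :- y′) :+ a′ :* (x :+ :- y) :+ (s :* x′ :+ s′ :* x :+ :- t))
        refl a a′ s s′ x x′ y y′ t′)

  0≤Σ< : ∀ {F} → (∀ k → 0ℚ ≤ F k) → ∀ n → 0ℚ ≤ ℚC.Σ< F n
  0≤Σ< hF zero    = ≤-refl
  0≤Σ< hF (suc n) = 0≤-+ (0≤Σ< hF n) (hF n)

  Σ<-mono : ∀ {F} → (∀ k → 0ℚ ≤ F k) → ∀ d n → ℚC.Σ< F n ≤ ℚC.Σ< F (d ℕ.+ n)
  Σ<-mono hF zero    n = ≤-refl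
  Σ<-mono hF (suc d) n = ≤-trans (Σ<-mono hF d n) (p≤p+q _ (hF (d ℕ.+ n)))

  0≤tri : ∀ {F G} → (∀ k → 0ℚ ≤ F k) → (∀ k → 0ℚ ≤ G k) → ∀ n → 0ℚ ≤ ℚC.tri F G n
  0≤tri hF hG zero    = ≤-refl
  0≤tri hF hG (suc n) =
    0≤-+ (0≤-* (hF 0) (0≤Σ< hG (suc n))) (0≤tri (hF ∘ suc) hG n)

  -- Since j < n and k < q imply j + k < n + q, the rectangle lies in the triangle, and the terms
  -- outside it are nonnegative.
  rectangle≤tri : ∀ {F G} → (∀ k → 0ℚ ≤ F k) → (∀ k → 0ℚ ≤ G k) → ∀ n q →
    ℚC.Σ< F n * ℚC.Σ< G q ≤ ℚC.tri F G (n ℕ.+ q)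
  rectangle≤tri {F} {G} hF hG zero    q =
    ≤-trans (≤-reflexive (*-zeroˡ (ℚC.Σ< G q))) (0≤tri hF hG q)
  rectangle≤tri {F} {G} hF hG (suc n) q = ≤-trans
    (≤-reflexive (trans (cong (_* ℚC.Σ< G q) (ℚC.Σ<-head F n))
      (*-distribʳ-+ (ℚC.Σ< G q) (F 0) (ℚC.Σ< (F ∘ suc) n))))
    (+-mono-≤ (*-monoˡ-0≤ (hF 0) (Σ<-mono hG (suc n) q))
              (rectangle≤tri (hF ∘ suc) hG n q))

  -- For the majorants, the square of side n lies in the triangle of side 2 n, so the
  -- error is at most a section of their Cauchy series at B + C.
  expSum-+ : ∀ B 0≤B C 0≤C 0≤B+C z w → norm₁ z ≤ B → norm₁ w ≤ C → ∀ n →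
    let open Majorant (B + C) 0≤B+C in
    norm₁ ((expSum n z *ᵢ expSum n w) -ᵢ expSum n (z +ᵢ w)) ≤ s (n ℕ.+ n) - s n
  expSum-+ B 0≤B C 0≤C 0≤B+C z w hz hw n = ≤-trans
    (≤-reflexive (cong norm₁ (cong₂ _-ᵢ_
      (cong₂ _*ᵢ_ (expSum-Σ n z) (expSum-Σ n w)) (expSum-tri z w n))))
    (≤-trans (rectangle-tri (λ k → Majorant.term-bound B 0≤B k z hz)
                            (λ k → Majorant.term-bound C 0≤C k w hw) n 0)
    (≤-trans (+-monoˡ-≤ (- ℚC.tri T U n)
        (rectangle≤tri (Majorant.0≤t B 0≤B) (Majorant.0≤t C 0≤C) n n))
      (≤-reflexive (sym (cong₂ _-_ (majorant-tri B 0≤B C 0≤C 0≤B+C (n ℕ.+ n))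
                                   (majorant-tri B 0≤B C 0≤C 0≤B+C n))))))
    where
    T = Majorant.t B 0≤B
    U = Majorant.t C 0≤C

open ExponentialSums

-- Equality of Cauchy sequences, cancellation and √ n.

module CauchySequences where

  open import Data.Rational.Base
  open import Data.Rational.Properties
  open +-*-Solver using (solve; _:=_; _:+_; _:*_; :-_; con)

  infix 4 _~_ _≈_

  -- A record, so that the sequences can be inferred from a proof; on sequences,
  -- so that no Cauchy moduli take part in the conversion of equality types.
  record _~_ (x y : ℕ → ℚ) : Set where
    constructor mk~
    field limit : ∀ ε → 0ℚ < ε → ∃[ N ] ∀ n → N ℕ.≤ n → ∣ x n - y n ∣ < ε
  open _~_ public

  _≈_ : ℝ → ℝ → Set
  x ≈ y = seq x ~ seq y

  ∣p-p∣≡0 : ∀ p → ∣ p - p ∣ ≡ 0ℚ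
  ∣p-p∣≡0 p = cong ∣_∣ (+-inverseʳ p)

  pointwise : ∀ {x y} → (∀ n → x n ≡ y n) → x ~ y
  pointwise {x} {y} h .limit ε 0<ε = 0 , λ n _ → subst (_< ε)
    (sym (trans (cong (λ q → ∣ q - y n ∣) (h n)) (∣p-p∣≡0 (y n)))) 0<ε

  ~-dominated : ∀ {p p′ q q′ x y} C → 0ℚ ≤ C → p ~ p′ → q ~ q′ →
    (∀ n → ∣ x n - y n ∣ ≤ C * (∣ p n - p′ n ∣ + ∣ q n - q′ n ∣)) → x ~ y
  ~-dominated C 0≤C p~p′ q~q′ h .limit ε 0<ε = N₁ ℕ.⊔ N₂ , λ n hn →
    -- The third small quantity expected by `combine-<` is 0 here.
    ≤-<-trans (≤-trans (h n) (≤-reflexive (sym (+-identityʳ _))))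
      (<-≤-trans (combine-< 0≤C (h₁ n (ℕₚ.m⊔n≤o⇒m≤o N₁ N₂ hn))
                                (h₂ n (ℕₚ.m⊔n≤o⇒n≤o N₁ N₂ hn)) 0<δ)
        (≤-reflexive (proj₂ (proj₂ δ-spec))))
    where
    δ-spec = shrink (C + C + 1ℚ) ε (0<2C+1 0≤C) 0<ε
    0<δ = proj₁ (proj₂ δ-spec)
    N₁ = proj₁ (limit p~p′ _ 0<δ)
    N₂ = proj₁ (limit q~q′ _ 0<δ)
    h₁ = proj₂ (limit p~p′ _ 0<δ)
    h₂ = proj₂ (limit q~q′ _ 0<δ)

  ~-refl : ∀ {x} → x ~ x
  ~-refl = pointwise λ _ → refl

  ~-sym : ∀ {x y} → x ~ y → y ~ x
  ~-sym {x} {y} h .limit ε 0<ε = proj₁ (limit h ε 0<ε) , λ n hn →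
    subst (_< ε) (∣p-q∣≡∣q-p∣ (x n) (y n)) (proj₂ (limit h ε 0<ε) n hn)

  ~-trans : ∀ {x y z} → x ~ y → y ~ z → x ~ z
  ~-trans {x} {y} {z} h k = ~-dominated 1ℚ 0≤1ℚ h k λ n → ≤-trans
    (≤-reflexive (cong ∣_∣ (solve 3 (λ a b c → a :+ :- c := a :+ :- b :+ (b :+ :- c))
      refl (x n) (y n) (z n))))
    (≤-trans (∣p+q∣≤∣p∣+∣q∣ (x n - y n) (y n - z n))
      (≤-reflexive (sym (*-identityˡ _))))

  +-cong~ : ∀ {x x′ y y′} → x ~ x′ → y ~ y′ → (λ n → x n + y n) ~ (λ n → x′ n + y′ n)
  +-cong~ {x} {x′} {y} {y′} h k = ~-dominated 1ℚ 0≤1ℚ h k λ n → ≤-trans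
    (≤-reflexive (cong ∣_∣ (solve 4
      (λ a b c d → a :+ b :+ :- (c :+ d) := a :+ :- c :+ (b :+ :- d))
      refl (x n) (y n) (x′ n) (y′ n))))
    (≤-trans (∣p+q∣≤∣p∣+∣q∣ (x n - x′ n) (y n - y′ n))
      (≤-reflexive (sym (*-identityˡ _))))

  *-cong~ : ∀ x x′ y y′ → x ≈ x′ → y ≈ y′ → x *ℝ y ≈ x′ *ℝ y′
  *-cong~ x x′ y y′ h k = ~-dominated (B + C) (0≤-+ 0≤B 0≤C) h k λ n →
    *-diff (seq x n) (seq y n) (seq x′ n) (seq y′ n) (0≤-+ 0≤B 0≤C)
      (≤-trans (x≤B n) (p≤p+q B 0≤C)) (≤-trans (y′≤C n) (p≤q+p C 0≤B))
    where
    x-bounded = cauchy⇒bounded (seq x) (cauchy x)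
    y′-bounded = cauchy⇒bounded (seq y′) (cauchy y′)
    B = proj₁ x-bounded
    0≤B = proj₁ (proj₂ x-bounded)
    x≤B = proj₂ (proj₂ x-bounded)
    C = proj₁ y′-bounded
    0≤C = proj₁ (proj₂ y′-bounded)
    y′≤C = proj₂ (proj₂ y′-bounded)

  neg-cong~ : ∀ {x x′} → x ~ x′ → (λ n → - x n) ~ (λ n → - x′ n)
  neg-cong~ {x} {x′} h = ~-dominated {q = x} 1ℚ 0≤1ℚ h ~-refl λ n →
    ≤-trans (≤-reflexive (trans
      (cong ∣_∣ (solve 2 (λ a b → :- a :+ :- :- b := :- (a :+ :- b)) refl (x n) (x′ n)))
      (∣-p∣≡∣p∣ (x n - x′ n))))
    (≤-trans (p≤p+q _ (0≤∣p∣ (x n - x n))) (≤-reflexive (sym (*-identityˡ _))))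

  fromℤ-injective : ∀ {i j} → fromℤ i ≡ fromℤ j → i ≡ j
  fromℤ-injective = cong ↥_

  x-y≡0⇒x≡y : ∀ x y → x - y ≡ 0ℚ → x ≡ y
  x-y≡0⇒x≡y x y h = trans (solve 2 (λ x y → x := x :+ :- y :+ y) refl x y)
    (trans (cong (_+ y) h) (+-identityˡ y))

  -- Both sequences are constant, so a positive distance, taken as ε, would be less than itself.
  -- This is the way back from real equations to integers.
  ℤ→ℝ-injective : ∀ i j → ℤ→ℝ i ≈ ℤ→ℝ j → i ≡ j
  ℤ→ℝ-injective i j h = fromℤ-injective (x-y≡0⇒x≡y (fromℤ i) (fromℤ j)
    (∣p∣≡0⇒p≡0 (fromℤ i - fromℤ j) (≤-antisym (≮⇒≥ λ 0<d →
      <-irrefl refl (proj₂ (limit h _ 0<d) _ ℕₚ.≤-refl)) (0≤∣p∣ _))))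

  fromℤ-* : ∀ i j → fromℤ (i ℤ.* j) ≡ fromℤ i * fromℤ j
  fromℤ-* i j = toℚᵘ-injective (ℚᵘₚ.≃-sym (toℚᵘ-homo-* (fromℤ i) (fromℤ j)))

  fromℤ-neg : ∀ i → fromℤ (ℤ.- i) ≡ - fromℤ i
  fromℤ-neg (+ 0)        = refl
  fromℤ-neg (ℤ.+[1+ n ]) = refl
  fromℤ-neg (ℤ.-[1+ n ]) = refl

  fromℤ-sub : ∀ i j → fromℤ (i ℤ.- j) ≡ fromℤ i - fromℤ j
  fromℤ-sub i j = trans (fromℤ-+ i (ℤ.- j)) (cong (λ q → fromℤ i + q) (fromℤ-neg j))

  -- Bounding x away from 0 is what makes the cancellation constructive.
  *ℝ-cancel-0 : ∀ x y → 0ℝ <ℝ x → x *ℝ y ≈ 0ℝ → y ≈ 0ℝ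
  *ℝ-cancel-0 x y (δ , 0<δ , M , δ≤x) h .limit ε 0<ε = M ℕ.⊔ N , λ n hn →
    let M≤n = ℕₚ.m⊔n≤o⇒m≤o M N hn
        0+δ≤xₙ = δ≤x n M≤n
        δ≤xₙ = ≤-trans (≤-reflexive (sym (+-identityˡ δ))) 0+δ≤xₙ
    in *-cancelˡ-<-nonNeg δ {{nonNegative (<⇒≤ 0<δ)}} (≤-<-trans
      (≤-trans (*-monoʳ-0≤ (0≤∣p∣ (seq y n - 0ℚ)) (≤-trans δ≤xₙ (p≤∣p∣ (seq x n))))
        (≤-reflexive (trans (sym (∣p*q∣≡∣p∣*∣q∣ (seq x n) (seq y n - 0ℚ)))
          (cong ∣_∣ (solve 2 (λ x y → x :* (y :+ :- con 0ℚ) := x :* y :+ :- con 0ℚ)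
            refl (seq x n) (seq y n))))))
      (proj₂ N-spec n (ℕₚ.m⊔n≤o⇒n≤o M N hn)))
    where
    N-spec = limit h (δ * ε) (0<-* 0<δ 0<ε)
    N = proj₁ N-spec

  -- With K = k + 1 and r = isqrt (n K²) one has r² ≤ n K² ≤ r² + 2 r and r ≤ n K. Division by K²
  -- shows that the square of the k-th truncation differs from n by at most 2 n / K.
  √-square : ∀ n → (√ n) *ℝ (√ n) ≈ ℤ→ℝ (+ n)
  √-square n .limit ε 0<ε = N , λ k N≤k →
    ≤-<-trans (≤-trans (bound k) (*-monoˡ-0≤ 0≤2n (1/suc-anti N≤k)))
      (≤-<-trans (*-monoʳ-0≤ (0≤1/suc N) (≤-trans (p≤p+q (c + c) 0≤1ℚ) ≤-refl))
        (<-≤-trans (*-monoʳ-<-pos (c + c + 1ℚ) {{positive (0<2C+1 (0≤fromℕ n))}}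
                     (proj₂ N-spec))
                   (≤-reflexive (proj₂ (proj₂ δ-spec)))))
    where
    c = fromℕ n
    0≤2n = 0≤-+ (0≤fromℕ n) (0≤fromℕ n)
    δ-spec = shrink (c + c + 1ℚ) ε (0<2C+1 (0≤fromℕ n)) 0<ε
    N-spec = small (proj₁ δ-spec) (proj₁ (proj₂ δ-spec))
    N = proj₁ N-spec
    bound : ∀ k → ∣ √approx n k * √approx n k - c ∣ ≤ (c + c) * 1/suc k
    bound k = ∣∣-≤
      (≤-trans (p≤q+r⇒p-q≤r (≤-trans square≤ (≤-reflexive (sym (+-identityʳ c)))))
        (0≤-* 0≤2n (0≤1/suc k)))
      (≤-trans (≤-reflexive (solve 2 (λ a b → :- (a :+ :- b) := b :+ :- a)
          refl (√approx n k * √approx n k) c))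
        (p≤q+r⇒p-q≤r {c} {√approx n k * √approx n k} {(c + c) * 1/suc k} ≤square))
      where
      K = suc k
      i = 1/suc k
      r = isqrt (n ℕ.* (K ℕ.* K))
      r≤nK : r ℕ.≤ n ℕ.* K
      r≤nK = ℕₚ.≮⇒≥ λ nK<r → ℕₚ.<⇒≱ (ℕₚ.*-mono-< nK<r nK<r)
        (ℕₚ.≤-trans (isqrt-lower (n ℕ.* (K ℕ.* K))) (nKK≤ n))
        where
        nKK≤ : ∀ n → n ℕ.* (K ℕ.* K) ℕ.≤ n ℕ.* K ℕ.* (n ℕ.* K)
        nKK≤ zero    = z≤n
        nKK≤ n@(suc _) = ℕₚ.≤-trans (ℕₚ.≤-reflexive (sym (ℕₚ.*-assoc n K K)))
          (ℕₚ.*-monoʳ-≤ (n ℕ.* K) (ℕₚ.m≤n*m K n))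
      scale : ∀ a → fromℕ (a ℕ.* (K ℕ.* K)) * (i * i) ≡ fromℕ a
      scale a = trans (cong (_* (i * i)) (trans (fromℕ-* a (K ℕ.* K))
          (cong (fromℕ a *_) (fromℕ-* K K))))
        (trans (solve 3 (λ a k i → a :* (k :* k) :* (i :* i) := a :* ((k :* i) :* (k :* i)))
          refl (fromℕ a) (fromℕ K) i)
        (trans (cong (λ q → fromℕ a * (q * q)) (suc*1/suc k)) (*-identityʳ (fromℕ a))))
      0≤ii = 0≤-* (0≤1/suc k) (0≤1/suc k)
      square : fromℕ (r ℕ.* r) * (i * i) ≡ √approx n k * √approx n k
      square = trans (cong (_* (i * i)) (fromℕ-* r r))
        (solve 2 (λ r i → r :* r :* (i :* i) := r :* i :* (r :* i)) refl (fromℕ r) i)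
      square≤ : √approx n k * √approx n k ≤ c
      square≤ = subst₂ _≤_ square (scale n)
        (*-monoʳ-0≤ 0≤ii (fromℕ-mono (isqrt-lower (n ℕ.* (K ℕ.* K)))))
      nKK≤ : n ℕ.* (K ℕ.* K) ℕ.≤ r ℕ.* r ℕ.+ (n ℕ.+ n) ℕ.* K
      nKK≤ = ℕₚ.≤-trans (ℕₚ.≤-pred (isqrt-upper (n ℕ.* (K ℕ.* K))))
        (ℕₚ.≤-trans (ℕₚ.≤-reflexive (rearrange r))
          (ℕₚ.+-monoʳ-≤ (r ℕ.* r) (ℕₚ.≤-trans (ℕₚ.+-mono-≤ r≤nK r≤nK)
            (ℕₚ.≤-reflexive (sym (ℕₚ.*-distribʳ-+ K n n))))))
        where
        rearrange : ∀ r → r ℕ.+ r ℕ.* suc r ≡ r ℕ.* r ℕ.+ (r ℕ.+ r)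
        rearrange r = trans (cong (r ℕ.+_) (ℕₚ.*-suc r r))
          (trans (sym (ℕₚ.+-assoc r r _)) (ℕₚ.+-comm (r ℕ.+ r) _))
      ≤square : c ≤ √approx n k * √approx n k + (c + c) * i
      ≤square = subst₂ _≤_ (scale n)
        (trans (cong (_* (i * i)) (fromℤ-+ (+ (r ℕ.* r)) (+ ((n ℕ.+ n) ℕ.* K))))
          (trans (*-distribʳ-+ (i * i) (fromℕ (r ℕ.* r)) (fromℕ ((n ℕ.+ n) ℕ.* K)))
            (cong₂ _+_ square
              (trans (cong (_* (i * i)) (trans (fromℕ-* (n ℕ.+ n) K)
                  (cong (_* fromℕ K) (fromℤ-+ (+ n) (+ n)))))
                (trans (solve 3 (λ c k i → c :* k :* (i :* i) := c :* i :* (k :* i))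
                         refl (c + c) (fromℕ K) i)
                (trans (cong ((c + c) * i *_) (suc*1/suc k)) (*-identityʳ _)))))))
        (*-monoʳ-0≤ 0≤ii (fromℕ-mono nKK≤))

  0≤√approx : ∀ n k → 0ℚ ≤ √approx n k
  0≤√approx n k = 0≤-* (0≤fromℕ (isqrt (n ℕ.* (suc k ℕ.* suc k)))) (0≤1/suc k)

  *4-cancel : ∀ x y → ℤ→ℝ (+ 4) *ℝ x ≈ ℤ→ℝ (+ 4) *ℝ y → x ≈ y
  *4-cancel x y h = ~-trans (pointwise λ n → quarter (seq x n))
    (~-trans (*-cong~ (ℚ→ℝ ¼) (ℚ→ℝ ¼) (ℤ→ℝ (+ 4) *ℝ x) (ℤ→ℝ (+ 4) *ℝ y) ~-refl h)
      (pointwise λ n → sym (quarter (seq y n))))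
    where
    ¼ : ℚ
    ¼ = + 1 / 4
    quarter : ∀ p → p ≡ ¼ * (fromℤ (+ 4) * p)
    quarter p = trans (sym (*-identityˡ p)) (*-assoc ¼ (fromℤ (+ 4)) p)

open CauchySequences

-- The rings of real and complex numbers, and the addition theorem.

module ComplexExponential where

  open import Data.Rational.Base
  open import Data.Rational.Properties
  open +-*-Solver using (solve; _:=_; _:+_; _:*_; :-_; con)

  1ℝ : ℝ
  1ℝ = ℤ→ℝ 1ℤ

  ℝ-commutativeRing : CommutativeRing 0ℓ 0ℓ
  ℝ-commutativeRing = record
    { Carrier = ℝ ; _≈_ = _≈_ ; _+_ = _+ℝ_ ; _*_ = _*ℝ_ ; -_ = λ x → -ℝ x
    ; 0# = 0ℝ ; 1# = 1ℝ
    ; isCommutativeRing = record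
      { isRing = record
        { +-isAbelianGroup = record
          { isGroup = record
            { isMonoid = record
              { isSemigroup = record
                { isMagma = record
                  { isEquivalence = record
                    { refl = ~-refl ; sym = ~-sym ; trans = ~-trans }
                  ; ∙-cong        = +-cong~
                  }
                ; assoc = λ x y z → pointwise λ n →
                    +-assoc (seq x n) (seq y n) (seq z n)
                }
              ; identity = (λ x → pointwise λ n → +-identityˡ (seq x n)) ,
                           (λ x → pointwise λ n → +-identityʳ (seq x n))
              }
            ; inverse = (λ x → pointwise λ n → +-inverseˡ (seq x n)) ,
                        (λ x → pointwise λ n → +-inverseʳ (seq x n))
            ; ⁻¹-cong = neg-cong~
            }
          ; comm = λ x y → pointwise λ n → +-comm (seq x n) (seq y n)
          }
        ; *-cong     = λ {x} {x′} {y} {y′} → *-cong~ x x′ y y′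
        ; *-assoc    = λ x y z → pointwise λ n → *-assoc (seq x n) (seq y n) (seq z n)
        ; *-identity = (λ x → pointwise λ n → *-identityˡ (seq x n)) ,
                       (λ x → pointwise λ n → *-identityʳ (seq x n))
        ; distrib    =
            (λ x y z → pointwise λ n → *-distribˡ-+ (seq x n) (seq y n) (seq z n)) ,
            (λ x y z → pointwise λ n → *-distribʳ-+ (seq x n) (seq y n) (seq z n))
        }
      ; *-comm = λ x y → pointwise λ n → *-comm (seq x n) (seq y n)
      }
    }

  infix 4 _≈ℂ_

  _≈ℂ_ : ℂ → ℂ → Set
  z ≈ℂ w = re z ≈ re w × im z ≈ im w

  at : ℂ → ℕ → ℚ[i]
  at z n = seq (re z) n +i seq (im z) n

  pointwiseℂ : ∀ z w → (∀ n → at z n ≡ at w n) → z ≈ℂ w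
  pointwiseℂ z w h = pointwise (λ n → cong re (h n)) , pointwise (λ n → cong im (h n))

  conj : ℂ → ℂ
  conj (x +i y) = x +i (-ℝ y)

  1ℂ : ℂ
  1ℂ = ℝ→ℂ 1ℝ

  ℂ-commutativeRing : CommutativeRing 0ℓ 0ℓ
  ℂ-commutativeRing = record
    { Carrier = ℂ ; _≈_ = _≈ℂ_ ; _+_ = _+ℂ_ ; _*_ = _*ℂ_
    ; -_ = λ z → (-ℝ re z) +i (-ℝ im z)
    ; 0# = 0ℂ ; 1# = 1ℂ
    ; isCommutativeRing = record
      { isRing = record
        { +-isAbelianGroup = record
          { isGroup = record
            { isMonoid = record
              { isSemigroup = record
                { isMagma = record
                  { isEquivalence = record
                    { refl  = ~-refl , ~-refl
                    ; sym   = λ (h , k) → ~-sym h , ~-sym k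
                    ; trans = λ (h , k) (h′ , k′) → ~-trans h h′ , ~-trans k k′
                    }
                  ; ∙-cong = λ (h , k) (h′ , k′) → +-cong~ h h′ , +-cong~ k k′
                  }
                ; assoc = λ z w u → pointwiseℂ (z +ℂ w +ℂ u) (z +ℂ (w +ℂ u)) λ n →
                    I.+-assoc (at z n) (at w n) (at u n)
                }
              ; identity =
                  (λ z → pointwiseℂ (0ℂ +ℂ z) z λ n → I.+-identityˡ (at z n)) ,
                  (λ z → pointwiseℂ (z +ℂ 0ℂ) z λ n → I.+-identityʳ (at z n))
              }
            ; inverse =
                (λ z → pointwiseℂ (negℂ z +ℂ z) 0ℂ λ n → I.-‿inverseˡ (at z n)) ,
                (λ z → pointwiseℂ (z +ℂ negℂ z) 0ℂ λ n → I.-‿inverseʳ (at z n))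
            ; ⁻¹-cong = λ (h , k) → neg-cong~ h , neg-cong~ k
            }
          ; comm = λ z w → pointwiseℂ (z +ℂ w) (w +ℂ z) λ n → I.+-comm (at z n) (at w n)
          }
        ; *-cong     = λ {z} {z′} {w} {w′} → *ℂ-cong z z′ w w′
        ; *-assoc    = λ z w u → pointwiseℂ (z *ℂ w *ℂ u) (z *ℂ (w *ℂ u)) λ n →
            I.*-assoc (at z n) (at w n) (at u n)
        ; *-identity =
            (λ z → pointwiseℂ (1ℂ *ℂ z) z λ n → I.*-identityˡ (at z n)) ,
            (λ z → pointwiseℂ (z *ℂ 1ℂ) z λ n → I.*-identityʳ (at z n))
        ; distrib    =
            (λ z w u → pointwiseℂ (z *ℂ (w +ℂ u)) (z *ℂ w +ℂ z *ℂ u) λ n →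
              I.distribˡ (at z n) (at w n) (at u n)) ,
            (λ z w u → pointwiseℂ ((w +ℂ u) *ℂ z) (w *ℂ z +ℂ u *ℂ z) λ n →
              I.distribʳ (at z n) (at w n) (at u n))
        }
      ; *-comm = λ z w → pointwiseℂ (z *ℂ w) (w *ℂ z) λ n → I.*-comm (at z n) (at w n)
      }
    }
    where
    module I = CommutativeRing ℚ[i]-commutativeRing
    negℂ : ℂ → ℂ
    negℂ z = (-ℝ re z) +i (-ℝ im z)
    *ℂ-cong : ∀ z z′ w w′ → z ≈ℂ z′ → w ≈ℂ w′ → z *ℂ w ≈ℂ z′ *ℂ w′
    *ℂ-cong (a +i b) (a′ +i b′) (c +i d) (c′ +i d′) (p , q) (r , s) =
      +-cong~ (*-cong~ a a′ c c′ p r) (neg-cong~ (*-cong~ b b′ d d′ q s)) ,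
      +-cong~ (*-cong~ a a′ d d′ p s) (*-cong~ b b′ c c′ q r)

  limitℂ : ∀ z w →
    (∀ ε → 0ℚ < ε → ∃[ N ] ∀ n → N ℕ.≤ n → norm₁ (at z n -ᵢ at w n) < ε) → z ≈ℂ w
  limitℂ z w h =
    (mk~ λ ε 0<ε → proj₁ (h ε 0<ε) , λ n hn →
      ≤-<-trans (p≤p+q _ (0≤∣p∣ (seq (im z) n - seq (im w) n))) (proj₂ (h ε 0<ε) n hn)) ,
    (mk~ λ ε 0<ε → proj₁ (h ε 0<ε) , λ n hn →
      ≤-<-trans (p≤q+p _ (0≤∣p∣ (seq (re z) n - seq (re w) n))) (proj₂ (h ε 0<ε) n hn))

  at-bounded : ∀ z → ∃[ B ] 0ℚ ≤ B × ∀ n → norm₁ (at z n) ≤ B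
  at-bounded (x +i y) =
    proj₁ x-bounded + proj₁ y-bounded ,
    0≤-+ (proj₁ (proj₂ x-bounded)) (proj₁ (proj₂ y-bounded)) ,
    λ n → +-mono-≤ (proj₂ (proj₂ x-bounded) n) (proj₂ (proj₂ y-bounded) n)
    where
    x-bounded = cauchy⇒bounded (seq x) (cauchy x)
    y-bounded = cauchy⇒bounded (seq y) (cauchy y)

  -- Stage n of `exp` is a partial sum at the n-th rational approximation, so B and C must bound
  -- whole approximating sequences. The Cauchy modulus of the majorant at B + C, applied to 2 n and
  -- n, is then a modulus for the equality.
  exp-+ : ∀ z w → exp z *ℂ exp w ≈ℂ exp (z +ℂ w)
  exp-+ z w = limitℂ (exp z *ℂ exp w) (exp (z +ℂ w)) λ ε 0<ε → proj₁ (s-cauchy ε 0<ε) , λ n hn →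
    ≤-<-trans (expSum-+ B 0≤B C 0≤C 0≤B+C (at z n) (at w n) (z≤B n) (w≤C n) n)
      (≤-<-trans (p≤∣p∣ (s (n ℕ.+ n) - s n))
        (proj₂ (s-cauchy ε 0<ε) (n ℕ.+ n) n (ℕₚ.≤-trans hn (ℕₚ.m≤m+n n n)) hn))
    where
    z-bounded = at-bounded z
    w-bounded = at-bounded w
    B = proj₁ z-bounded
    0≤B = proj₁ (proj₂ z-bounded)
    z≤B = proj₂ (proj₂ z-bounded)
    C = proj₁ w-bounded
    0≤C = proj₁ (proj₂ w-bounded)
    w≤C = proj₂ (proj₂ w-bounded)
    0≤B+C = 0≤-+ 0≤B 0≤C
    open Majorant (B + C) 0≤B+C

  exp-pointwise : ∀ z w → (∀ n → at z n ≡ at w n) → exp z ≈ℂ exp w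
  exp-pointwise z w h = pointwiseℂ (exp z) (exp w) λ n → cong (expSum n) (h n)

  expTerm-0 : ∀ k → expTerm (suc k) 0ᵢ ≡ 0ᵢ
  expTerm-0 k = trans
    (cong (1/suc k •_) (CommutativeRing.zeroʳ ℚ[i]-commutativeRing (expTerm k 0ᵢ)))
    (cong₂ _+i_ (*-zeroʳ (1/suc k)) (*-zeroʳ (1/suc k)))

  expSum-0 : ∀ n → expSum (suc n) 0ᵢ ≡ 1ᵢ
  expSum-0 zero    = refl
  expSum-0 (suc n) = trans (cong₂ _+ᵢ_ (expSum-0 n) (expTerm-0 n)) refl

  exp-0 : exp 0ℂ ≈ℂ 1ℂ
  -- The empty sum at stage 0 is 0, so agreement starts at stage 1.
  exp-0 = limitℂ (exp 0ℂ) 1ℂ λ ε 0<ε → 1 , λ where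
    (suc n) _ → subst (_< ε) (sym (cong (λ u → norm₁ (u -ᵢ 1ᵢ)) (expSum-0 n))) 0<ε

  conjᵢ : ℚ[i] → ℚ[i]
  conjᵢ (a +i b) = a +i (- b)

  expTerm-conj : ∀ k z → expTerm k (conjᵢ z) ≡ conjᵢ (expTerm k z)
  expTerm-conj zero    z = refl
  expTerm-conj (suc k) z@(a +i b) = trans
    (cong (λ u → 1/suc k • (u *ᵢ conjᵢ z)) (expTerm-conj k z))
    (cong₂ _+i_
      (solve 5 (λ i a b c d → i :* (c :* a :+ :- (:- d :* :- b)) :=
                              i :* (c :* a :+ :- (d :* b)))
        refl (1/suc k) a b (re (expTerm k z)) (im (expTerm k z)))
      (solve 5 (λ i a b c d → i :* (c :* :- b :+ :- d :* a) :=
                              :- (i :* (c :* b :+ d :* a)))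
        refl (1/suc k) a b (re (expTerm k z)) (im (expTerm k z))))

  expSum-conj : ∀ n z → expSum n (conjᵢ z) ≡ conjᵢ (expSum n z)
  expSum-conj zero    z = refl
  expSum-conj (suc n) z = trans
    (cong₂ _+ᵢ_ (expSum-conj n z) (expTerm-conj n z))
    (cong₂ _+i_ refl
      (sym (neg-distrib-+ (im (expSum n z)) (im (expTerm n z)))))

  -- e^(iqπ), with the number of half turns as argument.
  module Cis (π : ℝ) where

    cis : ℚ → ℂ
    cis q = exp (0ℝ +i (ℚ→ℝ q *ℝ π))

    cis-+ : ∀ p q → cis (p + q) ≈ℂ cis p *ℂ cis q
    cis-+ p q = K.trans {cis (p + q)} {exp (z +ℂ w)} {cis p *ℂ cis q}
      (exp-pointwise (0ℝ +i (ℚ→ℝ (p + q) *ℝ π)) (z +ℂ w) λ n →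
        cong (0ℚ +i_) (*-distribʳ-+ (seq π n) p q))
      (K.sym {exp z *ℂ exp w} {exp (z +ℂ w)} (exp-+ z w))
      where
      module K = CommutativeRing ℂ-commutativeRing
      z = 0ℝ +i (ℚ→ℝ p *ℝ π)
      w = 0ℝ +i (ℚ→ℝ q *ℝ π)

    cis-0 : cis 0ℚ ≈ℂ 1ℂ
    cis-0 = K.trans {cis 0ℚ} {exp 0ℂ} {1ℂ}
      (exp-pointwise (0ℝ +i (ℚ→ℝ 0ℚ *ℝ π)) 0ℂ λ n →
        cong (0ℚ +i_) (*-zeroˡ (seq π n))) exp-0
      where module K = CommutativeRing ℂ-commutativeRing

    cis-neg : ∀ q → cis (- q) ≈ℂ conj (cis q)
    cis-neg q = pointwiseℂ (cis (- q)) (conj (cis q)) λ n → trans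
      (cong (λ t → expSum n (0ℚ +i t)) (sym (neg-distribˡ-* q (seq π n))))
      (expSum-conj n (0ℚ +i (q * seq π n)))

    -- The conjugate is e^(-iqπ), so the addition theorem gives e⁰. The real part is the identity
    -- cos² + sin² = 1.
    cis-unit : ∀ q → cis q *ℂ conj (cis q) ≈ℂ 1ℂ
    cis-unit q = K.trans {cis q *ℂ conj (cis q)} {cis q *ℂ cis (- q)} {1ℂ}
      (K.*-cong {cis q} {cis q} {conj (cis q)} {cis (- q)} (K.refl {cis q})
        (K.sym {cis (- q)} {conj (cis q)} (cis-neg q)))
      (K.trans {cis q *ℂ cis (- q)} {cis (q - q)} {1ℂ}
        (K.sym {cis (q - q)} {cis q *ℂ cis (- q)} (cis-+ q (- q)))
        (subst (λ p → cis p ≈ℂ 1ℂ) (sym (+-inverseʳ q)) cis-0))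
      where module K = CommutativeRing ℂ-commutativeRing

open ComplexExponential

-- ζ = e^(2πi/5) and its cosines.

module FifthRootsOfUnity where

  open import Data.Rational.Base
  open import Data.Rational.Properties
  open +-*-Solver using (solve; _:=_; _:+_; _:*_; :-_; con)

  ℤ→ℝ-homomorphism :
    ℤ.+-*-rawRing -Raw-AlmostCommutative⟶ fromCommutativeRing ℝ-commutativeRing
  ℤ→ℝ-homomorphism = record
    { ⟦_⟧    = ℤ→ℝ
    ; +-homo = λ i j → pointwise λ _ → fromℤ-+ i j
    ; *-homo = λ i j → pointwise λ _ → fromℤ-* i j
    ; -‿homo = λ i → pointwise λ _ → fromℤ-neg i
    ; 0-homo = pointwise λ _ → refl
    ; 1-homo = pointwise λ _ → refl
    }

  module ℝ-Algebra = ℤ-Algebra ℝ-commutativeRing ℤ→ℝ-homomorphism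
  module 𝕂 = CommutativeRing ℂ-commutativeRing

  0<-scale : ∀ {π} q → 0ℚ < q → 0ℝ <ℝ π → 0ℝ <ℝ ℚ→ℝ q *ℝ π
  0<-scale {π} q 0<q (ε , 0<ε , N , h) = q * ε , 0<-* 0<q 0<ε , N , λ n hn →
    subst (_≤ q * seq π n) (trans (cong (q *_) (+-identityˡ ε)) (sym (+-identityˡ (q * ε))))
      (*-monoˡ-0≤ (<⇒≤ 0<q) (h n hn))

  scale-< : ∀ {π} q → q < 1ℚ → 0ℝ <ℝ π → ℚ→ℝ q *ℝ π <ℝ π
  scale-< {π} q q<1 0<π = shift (0<-scale {π} (1ℚ - q) 0<1-q 0<π)
    where
    0<1-q : 0ℚ < 1ℚ - q
    0<1-q = subst (_< 1ℚ - q) (+-inverseʳ q) (+-monoˡ-< (- q) q<1)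
    shift : 0ℝ <ℝ ℚ→ℝ (1ℚ - q) *ℝ π → ℚ→ℝ q *ℝ π <ℝ π
    shift (ε , 0<ε , N , h) = ε , 0<ε , N , λ n hn →
      subst₂ _≤_
        (solve 3 (λ q p e → q :* p :+ (con 0ℚ :+ e) := q :* p :+ e) refl q (seq π n) ε)
        (solve 2 (λ q p → q :* p :+ (con 1ℚ :+ :- q) :* p := p) refl q (seq π n))
        (+-monoʳ-≤ (q * seq π n) (h n hn))

  ⅖ : ℚ
  ⅖ = + 2 / 5

  module FifthRoots (π : ℝ) (isPi : IsPi π) where

    open Cis π
    open IsPi isPi

    cis-1-im : im (cis 1ℚ) ≈ 0ℝ
    cis-1-im = ~-trans
      (pointwise λ n → cong (λ t → im (expSum n (0ℚ +i t))) (*-identityˡ (seq π n)))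
      (mk~ sinπ≃0)

    norm-cis : ∀ q → re (cis q) *ℝ re (cis q) +ℝ im (cis q) *ℝ im (cis q) ≈ 1ℝ
    norm-cis q = ℝ-Algebra.conj-norm {re (cis q)} {im (cis q)} (proj₁ (cis-unit q))

    -- e^(iπ) has imaginary part 0 and modulus 1, so its square is 1, whichever of 1 and -1 it is.
    cis-2 : cis (1ℚ + 1ℚ) ≈ℂ 1ℂ
    cis-2 = 𝕂.trans {cis (1ℚ + 1ℚ)} {cis 1ℚ *ℂ cis 1ℚ} {1ℂ} (cis-+ 1ℚ 1ℚ)
      (ℝ-Algebra.real-square {re (cis 1ℚ)} {im (cis 1ℚ)} cis-1-im (norm-cis 1ℚ) ,
       ℝ-Algebra.imaginary-square {re (cis 1ℚ)} {im (cis 1ℚ)} cis-1-im)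

    0<sin-cis : ∀ q → 0ℚ < q → q < 1ℚ → 0ℝ <ℝ im (cis q)
    0<sin-cis q 0<q q<1 =
      0<sin (ℚ→ℝ q *ℝ π) (0<-scale {π} q 0<q 0<π) (scale-< {π} q q<1 0<π)

    ζ^ : ℕ → ℂ
    ζ^ k = cis (fromℕ k * ⅖)

    ζ^-+ : ∀ j k → ζ^ (j ℕ.+ k) ≈ℂ ζ^ j *ℂ ζ^ k
    ζ^-+ j k = subst (λ q → cis q ≈ℂ ζ^ j *ℂ ζ^ k)
      (sym (trans (cong (_* ⅖) (fromℤ-+ (+ j) (+ k)))
                  (*-distribʳ-+ ⅖ (fromℕ j) (fromℕ k))))
      (cis-+ (fromℕ j * ⅖) (fromℕ k * ⅖))

    ζ^-periodic : ∀ i k → ζ^ (i ℕ.* 5 ℕ.+ k) ≈ℂ ζ^ k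
    ζ^-periodic zero    k = 𝕂.refl {ζ^ k}
    ζ^-periodic (suc i) k =
      𝕂.trans {ζ^ (5 ℕ.+ (i ℕ.* 5 ℕ.+ k))} {ζ^ 5 *ℂ ζ^ (i ℕ.* 5 ℕ.+ k)} {ζ^ k}
        (ζ^-+ 5 (i ℕ.* 5 ℕ.+ k))
        (𝕂.trans {ζ^ 5 *ℂ ζ^ (i ℕ.* 5 ℕ.+ k)} {1ℂ *ℂ ζ^ k} {ζ^ k}
          -- The angle 5 * ⅖ computes to 1 + 1 half turns, so `cis-2` is the equation ζ⁵ = 1.
          (𝕂.*-cong {ζ^ 5} {1ℂ} {ζ^ (i ℕ.* 5 ℕ.+ k)} {ζ^ k} cis-2 (ζ^-periodic i k))
          (𝕂.*-identityˡ (ζ^ k)))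

    -- ζ^j ζ^k = 1, and the inverse of a number of modulus 1 is its conjugate.
    ζ^-conj : ∀ i j k → j ℕ.+ k ≡ i ℕ.* 5 → ζ^ k ≈ℂ conj (ζ^ j)
    ζ^-conj i j k j+k≡5i = begin
      ζ^ k                          ≈⟨ 𝕂.sym {u *ℂ ζ^ k} {ζ^ k} (cancel (ζ^ k)) ⟩
      ζ^ j *ℂ conj (ζ^ j) *ℂ ζ^ k
        ≈⟨ 𝕂.trans {u *ℂ ζ^ k} {conj (ζ^ j) *ℂ ζ^ j *ℂ ζ^ k}
             {conj (ζ^ j) *ℂ (ζ^ j *ℂ ζ^ k)}
             (𝕂.*-congʳ {ζ^ k} {u} {conj (ζ^ j) *ℂ ζ^ j} (𝕂.*-comm (ζ^ j) (conj (ζ^ j))))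
             (𝕂.*-assoc (conj (ζ^ j)) (ζ^ j) (ζ^ k)) ⟩
      conj (ζ^ j) *ℂ (ζ^ j *ℂ ζ^ k)
        ≈⟨ 𝕂.*-congˡ {conj (ζ^ j)} {ζ^ j *ℂ ζ^ k} {1ℂ} product ⟩
      conj (ζ^ j) *ℂ 1ℂ             ≈⟨ 𝕂.*-identityʳ (conj (ζ^ j)) ⟩
      conj (ζ^ j)                   ∎
      where
      open import Relation.Binary.Reasoning.Setoid 𝕂.setoid
      u = ζ^ j *ℂ conj (ζ^ j)
      cancel : ∀ z → u *ℂ z ≈ℂ z
      cancel z = 𝕂.trans {u *ℂ z} {1ℂ *ℂ z} {z}
        (𝕂.*-congʳ {z} {u} {1ℂ} (cis-unit (fromℕ j * ⅖))) (𝕂.*-identityˡ z)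
      product : ζ^ j *ℂ ζ^ k ≈ℂ 1ℂ
      product = 𝕂.trans {ζ^ j *ℂ ζ^ k} {ζ^ (j ℕ.+ k)} {1ℂ}
        (𝕂.sym {ζ^ (j ℕ.+ k)} {ζ^ j *ℂ ζ^ k} (ζ^-+ j k))
        (subst (λ n → ζ^ n ≈ℂ 1ℂ) (trans (ℕₚ.+-identityʳ (i ℕ.* 5)) (sym j+k≡5i))
          (𝕂.trans {ζ^ (i ℕ.* 5 ℕ.+ 0)} {ζ^ 0} {1ℂ} (ζ^-periodic i 0) cis-0))

    private
      c s : ℕ → ℝ
      c k = re (ζ^ k)
      s k = im (ζ^ k)

      0<s₁ : 0ℝ <ℝ s 1
      0<s₁ = 0<sin-cis ⅖ (*<* (ℤ.+<+ (s≤s z≤n))) (*<* (ℤ.+<+ (s≤s (s≤s (s≤s z≤n)))))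

      0<s₂ : 0ℝ <ℝ s 2
      0<s₂ = 0<sin-cis (+ 4 / 5) (*<* (ℤ.+<+ (s≤s z≤n)))
        (*<* (ℤ.+<+ (s≤s (s≤s (s≤s (s≤s (s≤s z≤n)))))))

      module G = ℝ-Algebra.GoldenCosine {c 1} {s 1} {c 2} {s 2} {√ 5}
        (norm-cis ⅖)
        (~-sym (proj₁ (ζ^-+ 1 1)))
        (~-sym (proj₂ (ζ^-+ 1 1)))
        (~-trans (~-sym (proj₂ (ζ^-+ 1 2))) (proj₂ (ζ^-conj 1 2 3 refl)))
        (√-square 5)

      quadratic≈0 : G.quadratic ≈ 0ℝ
      quadratic≈0 = *ℝ-cancel-0 (s 1) G.quadratic 0<s₁ G.s₁*quadratic≈0

      -- The other root of the quadratic, 4 c₁ = - √5 - 1, belongs to ζ² and its conjugate. It is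
      -- excluded by s₁ and s₂ both being positive: for ζ² in place of ζ, s₂ would be sin(8π/5) < 0.
      -- The lower bound of s₁ alone bounds the cancelled factor, whose other terms are nonnegative.
      linear≈0 : G.linear ≈ 0ℝ
      linear≈0 = *ℝ-cancel-0 factor G.linear (positive-factor 0<s₁ 0<s₂)
        (G.factored≈0 quadratic≈0)
        where
        factor = ℤ→ℝ (+ 2) *ℝ s 2 +ℝ (s 1 +ℝ s 1 *ℝ √ 5)
        positive-factor : 0ℝ <ℝ s 1 → 0ℝ <ℝ s 2 → 0ℝ <ℝ factor
        positive-factor (δ , 0<δ , M , hM) (ε , 0<ε , N , hN) =
          δ , 0<δ , M ℕ.⊔ N , λ n hn →
            let δ≤s₁ = hM n (ℕₚ.m⊔n≤o⇒m≤o M N hn)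
                ε≤s₂ = hN n (ℕₚ.m⊔n≤o⇒n≤o M N hn)
                0≤s₁ = ≤-trans (0≤-+ ≤-refl (<⇒≤ 0<δ)) δ≤s₁
                0≤s₂ = ≤-trans (0≤-+ ≤-refl (<⇒≤ 0<ε)) ε≤s₂
            in ≤-trans δ≤s₁ (≤-trans
              (p≤p+q (seq (s 1) n) (0≤-* 0≤s₁ (0≤√approx 5 n)))
              (p≤q+p (seq (s 1) n + seq (s 1) n * √approx 5 n)
                (0≤-* (0≤fromℕ 2) 0≤s₂)))

    4c₁ : ∀ k → c k ≈ c 1 → ℤ→ℝ (+ 4) *ℝ c k ≈ ℤ→ℝ 1ℤ *ℝ √ 5 -ℝ 1ℝ
    4c₁ k h = ~-trans (*-cong~ (ℤ→ℝ (+ 4)) (ℤ→ℝ (+ 4)) (c k) (c 1) ~-refl h)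
      (G.4c₁ linear≈0)

    4c₂ : ∀ k → c k ≈ c 2 → ℤ→ℝ (+ 4) *ℝ c k ≈ ℤ→ℝ -[1+ 0 ] *ℝ √ 5 -ℝ 1ℝ
    4c₂ k h = ~-trans (*-cong~ (ℤ→ℝ (+ 4)) (ℤ→ℝ (+ 4)) (c k) (c 2) ~-refl h)
      (G.4c₂ quadratic≈0 linear≈0)

open FifthRootsOfUnity

-- The spectrum of a vector at multiples of m, from its compression.

module CompressedDFT where

  open import Data.Rational.Base
  open import Data.Rational.Properties
  open +-*-Solver using (solve; _:=_; _:+_; _:*_; :-_; con)
  open ℕ-Solver.+-*-Solver using () renaming
    (solve to ℕ-solve; _:=_ to _:≡_; _:+_ to _:⊕_; _:*_ to _:×_; con to ℕ-con)

  ℤ→ℂ : ℤ → ℂ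
  ℤ→ℂ i = ℝ→ℂ (ℤ→ℝ i)

  ℤ→ℂ-sum : ∀ {n} (f : Fin n → ℤ) → ℤ→ℂ (sumℤ f) ≈ℂ sumℂ (λ i → ℤ→ℂ (f i))
  ℤ→ℂ-sum {zero}  f = 𝕂.refl {0ℂ}
  ℤ→ℂ-sum {suc n} f = 𝕂.trans {ℤ→ℂ (sumℤ f)} {ℤ→ℂ (f zero) +ℂ ℤ→ℂ S}
      {ℤ→ℂ (f zero) +ℂ sumℂ (λ i → ℤ→ℂ (f (suc i)))}
    (pointwiseℂ (ℤ→ℂ (sumℤ f)) (ℤ→ℂ (f zero) +ℂ ℤ→ℂ S) λ _ →
      cong (_+i 0ℚ) (fromℤ-+ (f zero) S))
    (𝕂.+-congˡ {ℤ→ℂ (f zero)} {ℤ→ℂ S} {sumℂ (λ i → ℤ→ℂ (f (suc i)))}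
      (ℤ→ℂ-sum (f ∘ suc)))
    where S = sumℤ (f ∘ suc)

  2jr/N-fifth : ∀ r m (k : Fin (m ℕ.* 5)) →
    2jr/N (r ℕ.* m) k ≡ fromℕ (r ℕ.* toℕ k) * ⅖
  2jr/N-fifth r m@(suc m′) k = fromℚᵘ-cong {ℚᵘ.mkℚᵘ (+ (2 ℕ.* (r ℕ.* m) ℕ.* toℕ k)) (4 ℕ.+ m′ ℕ.* 5)}
    {ℚᵘ.mkℚᵘ (+ (r ℕ.* toℕ k) ℤ.* + 2) 4} (ℚᵘ.*≡*
    (trans (sym (ℤₚ.pos-* (2 ℕ.* (r ℕ.* m) ℕ.* toℕ k) 5))
      (trans (cong +_ (ℕ-solve 3 (λ r m k →
          ℕ-con 2 :× (r :× m) :× k :× ℕ-con 5 :≡ r :× k :× ℕ-con 2 :× (m :× ℕ-con 5))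
          refl r m (toℕ k)))
        (trans (ℤₚ.pos-* (r ℕ.* toℕ k ℕ.* 2) (m ℕ.* 5))
          (cong (ℤ._* (+ (m ℕ.* 5))) (ℤₚ.pos-* (r ℕ.* toℕ k) 2))))))

  fromℤ-sum-* : ∀ (f g : Fin 5 → ℤ) → fromℤ (sumℤ λ i → f i ℤ.* g i) ≡
    fromℤ (f 0F) * fromℤ (g 0F) + fromℤ (f 1F) * fromℤ (g 1F) +
    fromℤ (f 2F) * fromℤ (g 2F) + fromℤ (f 3F) * fromℤ (g 3F) +
    fromℤ (f 4F) * fromℤ (g 4F)
  fromℤ-sum-* f g = trans
    (step 0F (trans (step 1F (trans (step 2F (trans (step 3F (trans (step 4F refl)
      refl)) refl)) refl)) refl))
    (solve 5 (λ a b c d e → a :+ (b :+ (c :+ (d :+ (e :+ con 0ℚ)))) :=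
                            a :+ b :+ c :+ d :+ e) refl
      (F 0F) (F 1F) (F 2F) (F 3F) (F 4F))
    where
    F : Fin 5 → ℚ
    F i = fromℤ (f i) * fromℤ (g i)
    step : ∀ i {j q} → fromℤ j ≡ q → fromℤ (f i ℤ.* g i ℤ.+ j) ≡ F i + q
    step i {j} h = trans (fromℤ-+ (f i ℤ.* g i) j) (cong₂ _+_ (fromℤ-* (f i) (g i)) h)

  -- The summands are variables here so that, in its applications, conversion checking
  -- does not unfold complex multiplication together with its Cauchy moduli.
  sumℂ-combine-* : ∀ m (s : Fin (m ℕ.* 5) → ℂ) (t u : Fin 5 → ℂ) (g : Fin m → Fin 5 → ℂ) →
    (∀ i j → s (combine i j) ≈ℂ u j *ℂ g i j) →
    (∀ j → t j ≈ℂ u j *ℂ sumℂ (λ i → g i j)) → sumℂ s ≈ℂ sumℂ t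
  sumℂ-combine-* m s t u g = sum-combine-* m g u {s} {t}
    where open WeightedSum 𝕂.commutativeSemiring using (sum-combine-*)

  module CompressedSpectrum (π : ℝ) (isPi : IsPi π) where

    open Cis π
    open FifthRoots π isPi
    open Fourier π

    -- The powers ζ^(r j), reduced by ζ⁵ = 1.
    root : ℕ → Fin 5 → ℂ
    root r 0F = 1ℂ
    root r 1F = ζ^ r
    root r 2F = ζ^ (r ℕ.+ r)
    root r 3F = conj (ζ^ (r ℕ.+ r))
    root r 4F = conj (ζ^ r)

    ζ^-root : ∀ r j → ζ^ (r ℕ.* toℕ j) ≈ℂ root r j
    ζ^-root r 0F = subst (λ n → ζ^ n ≈ℂ 1ℂ) (sym (ℕₚ.*-zeroʳ r)) cis-0
    ζ^-root r 1F = subst (λ n → ζ^ n ≈ℂ ζ^ r) (sym (ℕₚ.*-identityʳ r)) (𝕂.refl {ζ^ r})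
    ζ^-root r 2F = subst (λ n → ζ^ n ≈ℂ ζ^ (r ℕ.+ r))
      (trans (cong (r ℕ.+_) (sym (ℕₚ.+-identityʳ r))) (ℕₚ.*-comm 2 r))
      (𝕂.refl {ζ^ (r ℕ.+ r)})
    ζ^-root r 3F = ζ^-conj r (r ℕ.+ r) (r ℕ.* 3)
      (ℕ-solve 1 (λ r → r :⊕ r :⊕ r :× ℕ-con 3 :≡ r :× ℕ-con 5) refl r)
    ζ^-root r 4F = ζ^-conj r r (r ℕ.* 4) (sym (ℕₚ.*-suc r 4))

    -- The exponent r (5 i + j) is r j plus a multiple of 5.
    kernel : ∀ r m (i : Fin m) (j : Fin 5) →
      exp (0ℝ +i (ℚ→ℝ (2jr/N (r ℕ.* m) (combine i j)) *ℝ π)) ≈ℂ root r j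
    kernel r m i j = subst (λ q → cis q ≈ℂ root r j) (sym angle)
      (𝕂.trans {ζ^ (r ℕ.* toℕ i ℕ.* 5 ℕ.+ r ℕ.* toℕ j)} {ζ^ (r ℕ.* toℕ j)} {root r j}
        (ζ^-periodic (r ℕ.* toℕ i) (r ℕ.* toℕ j)) (ζ^-root r j))
      where
      angle : 2jr/N (r ℕ.* m) (combine i j) ≡
              fromℕ (r ℕ.* toℕ i ℕ.* 5 ℕ.+ r ℕ.* toℕ j) * ⅖
      angle = trans (2jr/N-fifth r m (combine i j)) (cong (λ k → fromℕ k * ⅖)
        (trans (cong (r ℕ.*_) (toℕ-combine i j))
          (ℕ-solve 3 (λ r i j → r :× (ℕ-con 5 :× i :⊕ j) :≡ r :× i :× ℕ-con 5 :⊕ r :× j)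
            refl r (toℕ i) (toℕ j))))

    DFT-compress : ∀ m (a : Fin (m ℕ.* 5) → ℤ) r →
      DFT (λ k → ℤ→ℝ (a k)) (r ℕ.* m) ≈ℂ sumℂ (λ j → root r j *ℂ ℤ→ℂ (compress m a j))
    DFT-compress m a r = sumℂ-combine-* m
      (λ k → exp (0ℝ +i (ℚ→ℝ (2jr/N (r ℕ.* m) k) *ℝ π)) *ℂ ℝ→ℂ (ℤ→ℝ (a k)))
      (λ j → root r j *ℂ ℤ→ℂ (compress m a j))
      (root r) (λ i j → ℤ→ℂ (a (combine i j)))
      (λ i j → 𝕂.*-congʳ {ℤ→ℂ (a (combine i j))}
        {exp (0ℝ +i (ℚ→ℝ (2jr/N (r ℕ.* m) (combine i j)) *ℝ π))} {root r j} (kernel r m i j))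
      (λ j → 𝕂.*-congˡ {root r j} {ℤ→ℂ (compress m a j)}
        {sumℂ {m} (λ i → ℤ→ℂ (a (combine i j)))} (ℤ→ℂ-sum {m} (λ i → a (combine i j))))

    private
      module Relations (r : ℕ) where
        c s c′ s′ : ℝ
        c  = re (ζ^ r)
        s  = im (ζ^ r)
        c′ = re (ζ^ (r ℕ.+ r))
        s′ = im (ζ^ (r ℕ.+ r))

        cube : ζ^ r *ℂ ζ^ (r ℕ.+ r) ≈ℂ conj (ζ^ (r ℕ.+ r))
        cube = 𝕂.trans {ζ^ r *ℂ ζ^ (r ℕ.+ r)} {ζ^ (r ℕ.+ (r ℕ.+ r))} {conj (ζ^ (r ℕ.+ r))}
          (𝕂.sym {ζ^ (r ℕ.+ (r ℕ.+ r))} {ζ^ r *ℂ ζ^ (r ℕ.+ r)} (ζ^-+ r (r ℕ.+ r)))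
          (ζ^-conj r (r ℕ.+ r) (r ℕ.+ (r ℕ.+ r))
            (ℕ-solve 1 (λ r → r :⊕ r :⊕ (r :⊕ (r :⊕ r)) :≡ r :× ℕ-con 5) refl r))

        fourth : ζ^ (r ℕ.+ r) *ℂ ζ^ (r ℕ.+ r) ≈ℂ conj (ζ^ r)
        fourth = 𝕂.trans {ζ^ (r ℕ.+ r) *ℂ ζ^ (r ℕ.+ r)} {ζ^ (r ℕ.+ r ℕ.+ (r ℕ.+ r))} {conj (ζ^ r)}
          (𝕂.sym {ζ^ (r ℕ.+ r ℕ.+ (r ℕ.+ r))} {ζ^ (r ℕ.+ r) *ℂ ζ^ (r ℕ.+ r)}
            (ζ^-+ (r ℕ.+ r) (r ℕ.+ r)))
          (ζ^-conj r r (r ℕ.+ r ℕ.+ (r ℕ.+ r))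
            (ℕ-solve 1 (λ r → r :⊕ (r :⊕ r :⊕ (r :⊕ r)) :≡ r :× ℕ-con 5) refl r))

        module Norm = ℝ-Algebra.FifthRootNorm {c} {s} {c′} {s′}
          (norm-cis (fromℕ r * ⅖)) (norm-cis (fromℕ (r ℕ.+ r) * ⅖))
          (~-sym (proj₁ (ζ^-+ r r))) (~-sym (proj₂ (ζ^-+ r r)))
          (proj₁ cube) (proj₁ fourth)

    -- The part free of √5 is left as 4 P₀ - 2 (P₁ + P₂), before P₀ + 2 P₁ + 2 P₂ = 1 is used, so
    -- this holds for every integer vector.
    4PSD : ∀ m (a : Fin (m ℕ.* 5) → ℤ) r σ →
      let A = compress m a in
      ℤ→ℝ (+ 4) *ℝ re (ζ^ r) ≈ ℤ→ℝ σ *ℝ √ 5 -ℝ 1ℝ →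
      ℤ→ℝ (+ 4) *ℝ re (ζ^ (r ℕ.+ r)) ≈ ℤ→ℝ (ℤ.- σ) *ℝ √ 5 -ℝ 1ℝ →
      ℤ→ℝ (+ 4) *ℝ PSD (λ k → ℤ→ℝ (a k)) (r ℕ.* m) ≈
      ℤ→ℝ (+ 4 ℤ.* PAF A 0F ℤ.- + 2 ℤ.* (PAF A 1F ℤ.+ PAF A 2F)) +ℝ
      ℤ→ℝ σ *ℝ √ 5 *ℝ ℤ→ℝ (+ 2 ℤ.* (PAF A 1F ℤ.- PAF A 2F))
    4PSD m a r σ 4c 4c′ = ~-trans
      (*-cong~ (ℤ→ℝ (+ 4)) (ℤ→ℝ (+ 4)) (PSD (λ k → ℤ→ℝ (a k)) (r ℕ.* m))
        (R *ℝ R +ℝ I *ℝ I) ~-refl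
        (+-cong~ (*-cong~ (re F) R (re F) R re-F re-F)
                 (*-cong~ (im F) I (im F) I im-F im-F)))
      (~-trans (N.4norm σ {√ 5} 4c 4c′)
        (pointwise λ n → cong₂ (λ p q → p + fromℤ σ * √approx 5 n * q) (sym P) (sym Q)))
      where
      open Relations r
      A = compress m a
      x : Fin 5 → ℚ
      x j = fromℤ (A j)
      module N = Norm (ℤ→ℝ (A 0F)) (ℤ→ℝ (A 1F)) (ℤ→ℝ (A 2F)) (ℤ→ℝ (A 3F)) (ℤ→ℝ (A 4F))
      F : ℂ
      F = DFT (λ k → ℤ→ℝ (a k)) (r ℕ.* m)
      R I : ℝ
      R = N.real
      I = N.imaginary
      re-F : re F ≈ R
      re-F = ~-trans (proj₁ (DFT-compress m a r)) (pointwise λ n →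
        -- The left side is the sum as complex multiplication computes it, including the zero
        -- imaginary parts of the integers.
        solve 9 (λ c s c′ s′ x₀ x₁ x₂ x₃ x₄ →
            con 1ℚ :* x₀ :+ :- (con 0ℚ :* con 0ℚ) :+ (c :* x₁ :+ :- (s :* con 0ℚ)
            :+ (c′ :* x₂ :+ :- (s′ :* con 0ℚ) :+ (c′ :* x₃ :+ :- (:- s′ :* con 0ℚ)
            :+ (c :* x₄ :+ :- (:- s :* con 0ℚ) :+ con 0ℚ)))) :=
            x₀ :+ c :* x₁ :+ c′ :* x₂ :+ c′ :* x₃ :+ c :* x₄)
          refl (seq c n) (seq s n) (seq c′ n) (seq s′ n) (x 0F) (x 1F) (x 2F) (x 3F) (x 4F))
      im-F : im F ≈ I
      im-F = ~-trans (proj₂ (DFT-compress m a r)) (pointwise λ n →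
        solve 9 (λ c s c′ s′ x₀ x₁ x₂ x₃ x₄ →
            con 1ℚ :* con 0ℚ :+ con 0ℚ :* x₀ :+ (c :* con 0ℚ :+ s :* x₁
            :+ (c′ :* con 0ℚ :+ s′ :* x₂ :+ (c′ :* con 0ℚ :+ :- s′ :* x₃
            :+ (c :* con 0ℚ :+ :- s :* x₄ :+ con 0ℚ)))) :=
            s :* x₁ :+ s′ :* x₂ :+ :- (s′ :* x₃) :+ :- (s :* x₄))
          refl (seq c n) (seq s n) (seq c′ n) (seq s′ n) (x 0F) (x 1F) (x 2F) (x 3F) (x 4F))
      q₀ q₁ q₂ : ℚ
      q₀ = x 0F * x 0F + x 1F * x 1F + x 2F * x 2F + x 3F * x 3F + x 4F * x 4F
      q₁ = x 0F * x 4F + x 1F * x 0F + x 2F * x 1F + x 3F * x 2F + x 4F * x 3F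
      q₂ = x 0F * x 3F + x 1F * x 4F + x 2F * x 0F + x 3F * x 1F + x 4F * x 2F
      lag : ∀ j → fromℤ (PAF A j) ≡
        x 0F * x (0F ⊖ j) + x 1F * x (1F ⊖ j) + x 2F * x (2F ⊖ j) +
        x 3F * x (3F ⊖ j) + x 4F * x (4F ⊖ j)
      lag j = fromℤ-sum-* A (λ i → A (i ⊖ j))
      P : fromℤ (+ 4 ℤ.* PAF A 0F ℤ.- + 2 ℤ.* (PAF A 1F ℤ.+ PAF A 2F)) ≡
          fromℤ (+ 4) * q₀ - fromℤ (+ 2) * (q₁ + q₂)
      P = trans (fromℤ-sub (+ 4 ℤ.* PAF A 0F) (+ 2 ℤ.* (PAF A 1F ℤ.+ PAF A 2F)))
        (cong₂ _-_
          (trans (fromℤ-* (+ 4) (PAF A 0F)) (cong (fromℤ (+ 4) *_) (lag 0F)))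
          (trans (fromℤ-* (+ 2) (PAF A 1F ℤ.+ PAF A 2F)) (cong (fromℤ (+ 2) *_)
            (trans (fromℤ-+ (PAF A 1F) (PAF A 2F)) (cong₂ _+_ (lag 1F) (lag 2F))))))
      Q : fromℤ (+ 2 ℤ.* (PAF A 1F ℤ.- PAF A 2F)) ≡ fromℤ (+ 2) * (q₁ - q₂)
      Q = trans (fromℤ-* (+ 2) (PAF A 1F ℤ.- PAF A 2F)) (cong (fromℤ (+ 2) *_)
            (trans (fromℤ-sub (PAF A 1F) (PAF A 2F)) (cong₂ _-_ (lag 1F) (lag 2F))))

open CompressedDFT

-- From the spectrum to the power of the compression and back.

module Conditions where

  open import Data.Rational.Base
  open import Data.Rational.Properties
  open +-*-Solver using (solve; _:=_; _:+_; _:*_; :-_; con)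

  module Equivalence (π : ℝ) (isPi : IsPi π) where

    open Fourier π
    open FifthRoots π isPi
    open CompressedSpectrum π isPi

    -- For r = 1, ..., 4 this is the quadratic character of r modulo 5, the sign that √5 receives
    -- under ζ ↦ ζ^r.
    sign : ℕ → ℤ
    sign r = -1ℤ ℤ.^ ⌊ r /2⌋

    -- Periodicity and conjugation reduce the real parts of ζ^r and ζ^(2 r) to those of ζ and ζ², in
    -- this order for r = 1, 4 and in the opposite order for r = 2, 3.
    cosines : ∀ r → 1 ℕ.≤ r → r ℕ.≤ 4 →
      ℤ→ℝ (+ 4) *ℝ re (ζ^ r) ≈ ℤ→ℝ (sign r) *ℝ √ 5 -ℝ 1ℝ ×
      ℤ→ℝ (+ 4) *ℝ re (ζ^ (r ℕ.+ r)) ≈ ℤ→ℝ (ℤ.- sign r) *ℝ √ 5 -ℝ 1ℝ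
    cosines 1 _ _ = 4c₁ 1 ~-refl , 4c₂ 2 ~-refl
    cosines 2 _ _ = 4c₂ 2 ~-refl , 4c₁ 4 (proj₁ (ζ^-conj 1 1 4 refl))
    cosines 3 _ _ = 4c₂ 3 (proj₁ (ζ^-conj 1 2 3 refl)) , 4c₁ 6 (proj₁ (ζ^-periodic 1 1))
    cosines 4 _ _ = 4c₁ 4 (proj₁ (ζ^-conj 1 1 4 refl)) ,
      4c₂ 8 (~-trans (proj₁ (ζ^-periodic 1 3)) (proj₁ (ζ^-conj 1 2 3 refl)))
    cosines (suc (suc (suc (suc (suc _))))) _ (s≤s (s≤s (s≤s (s≤s ()))))

    ℓ+1 : ℕ → ℤ
    ℓ+1 m = + (m ℕ.* 5 ℕ.+ 1)

    -- The coefficient y is an arbitrary real, so that x serves for one vector of the pair and -x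
    -- for the other.
    power-from-PSD : ∀ m (a : Fin (m ℕ.* 5) → ℤ) → sumℤ a ≡ 1ℤ → (y : ℝ) →
      (∀ r → 1 ℕ.≤ r → r ℕ.≤ 4 → PSD (λ k → ℤ→ℝ (a k)) (r ℕ.* m) ≈
        ℤ→ℝ (ℓ+1 m) +ℝ ℤ→ℝ (sign r) *ℝ √ 5 *ℝ y) →
      PAF (compress m a) 0F ≡ + (4 ℕ.* m ℕ.+ 1)
    power-from-PSD m a sum≡1 y h =
      power-from-mean m sum≡1 (ℤ→ℝ-injective (Z ℤ.+ Z) (+ 8 ℤ.* L) 2Z≈8L)
      where
      P₀ P₁ P₂ Z L : ℤ
      P₀ = PAF (compress m a) 0F
      P₁ = PAF (compress m a) 1F
      P₂ = PAF (compress m a) 2F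
      Z = + 4 ℤ.* P₀ ℤ.- + 2 ℤ.* (P₁ ℤ.+ P₂)
      L = ℓ+1 m
      W : ℤ
      W = + 2 ℤ.* (P₁ ℤ.- P₂)
      X : ℕ → ℝ
      X r = ℤ→ℝ Z +ℝ ℤ→ℝ (sign r) *ℝ √ 5 *ℝ ℤ→ℝ W
      Y : ℕ → ℝ
      Y r = ℤ→ℝ L +ℝ ℤ→ℝ (sign r) *ℝ √ 5 *ℝ y
      X≈4Y : ∀ r → 1 ℕ.≤ r → r ℕ.≤ 4 → X r ≈ ℤ→ℝ (+ 4) *ℝ Y r
      X≈4Y r 1≤r r≤4 = ~-trans
        (~-sym (4PSD m a r (sign r) (proj₁ (cosines r 1≤r r≤4)) (proj₂ (cosines r 1≤r r≤4))))
        (*-cong~ (ℤ→ℝ (+ 4)) (ℤ→ℝ (+ 4)) (PSD (λ k → ℤ→ℝ (a k)) (r ℕ.* m)) (Y r) ~-refl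
          (h r 1≤r r≤4))
      -- The terms with √ 5 cancel, as sign 1 = 1 and sign 2 = -1.
      2Z≈8L : ℤ→ℝ (Z ℤ.+ Z) ≈ ℤ→ℝ (+ 8 ℤ.* L)
      2Z≈8L = ~-trans
        (pointwise λ n → trans (fromℤ-+ Z Z)
          (solve 3 (λ z w q → z :+ z := z :+ con 1ℚ :* q :* w :+ (z :+ con (- 1ℚ) :* q :* w))
            refl (fromℤ Z) (fromℤ W) (√approx 5 n)))
        (~-trans (+-cong~ (X≈4Y 1 (s≤s z≤n) (s≤s z≤n)) (X≈4Y 2 (s≤s z≤n) (s≤s (s≤s z≤n))))
          (pointwise λ n → trans
            (solve 3 (λ l y q → con (fromℤ (+ 4)) :* (l :+ con 1ℚ :* q :* y)
                :+ con (fromℤ (+ 4)) :* (l :+ con (- 1ℚ) :* q :* y) := con (fromℤ (+ 8)) :* l)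
              refl (fromℤ L) (seq y n) (√approx 5 n))
            (sym (fromℤ-* (+ 8) L))))

    -- `mean-from-power` and `spectrum-spread` show both parts of 4 PSD to be multiples of 4, and
    -- the factor cancels.
    PSD-from-power : ∀ m (a : Fin (m ℕ.* 5) → ℤ) → sumℤ a ≡ 1ℤ →
      PAF (compress m a) 0F ≡ + 4 ℤ.* + m ℤ.+ 1ℤ → ∀ r → 1 ℕ.≤ r → r ℕ.≤ 4 →
      PSD (λ k → ℤ→ℝ (a k)) (r ℕ.* m) ≈
        ℤ→ℝ (ℓ+1 m) +ℝ ℤ→ℝ (sign r) *ℝ √ 5 *ℝ ℤ→ℝ (offset m a)
    PSD-from-power m a sum≡1 P₀≡ r 1≤r r≤4 =
      *4-cancel (PSD (λ k → ℤ→ℝ (a k)) (r ℕ.* m))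
        (ℤ→ℝ (ℓ+1 m) +ℝ ℤ→ℝ (sign r) *ℝ √ 5 *ℝ ℤ→ℝ (offset m a))
        (~-trans
          (4PSD m a r (sign r) (proj₁ (cosines r 1≤r r≤4)) (proj₂ (cosines r 1≤r r≤4)))
          (pointwise λ n → trans
            (cong₂ (λ z w → fromℤ z + fromℤ (sign r) * √approx 5 n * fromℤ w)
              (mean-from-power m sum≡1 P₀≡) (spectrum-spread m sum≡1 P₀≡))
            (trans
              (cong₂ (λ z w → z + fromℤ (sign r) * √approx 5 n * w)
                (fromℤ-* (+ 4) (ℓ+1 m)) (fromℤ-* (+ 4) (offset m a)))
              (solve 4 (λ l s q y → con (fromℤ (+ 4)) :* l :+ s :* q :* (con (fromℤ (+ 4)) :* y) :=
                                    con (fromℤ (+ 4)) :* (l :+ s :* q :* y))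
                refl (fromℤ (ℓ+1 m)) (fromℤ (sign r)) (√approx 5 n) (fromℤ (offset m a))))))

    module _ (m : ℕ) {a b : Fin (m ℕ.* 5) → ℤ}
      (sum-a≡1 : sumℤ a ≡ 1ℤ) (sum-b≡1 : sumℤ b ≡ 1ℤ) where

      PSD⇒power : PSDCondition π m a b →
        PAF (compress m a) 0F ≡ + (4 ℕ.* m ℕ.+ 1) × PAF (compress m b) 0F ≡ + (4 ℕ.* m ℕ.+ 1)
      PSD⇒power (x , _ , _ , h) =
        power-from-PSD m a sum-a≡1 (ℤ→ℝ (+ x)) (λ r 1≤r r≤4 → mk~ (proj₁ (h r 1≤r r≤4))) ,
        power-from-PSD m b sum-b≡1 (-ℝ ℤ→ℝ (+ x)) (λ r 1≤r r≤4 → ~-trans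
          (mk~ (proj₂ (h r 1≤r r≤4)))
          (pointwise λ n → solve 4 (λ l s q y → l :+ :- (s :* q :* y) := l :+ s :* q :* :- y)
            refl (fromℤ (ℓ+1 m)) (fromℤ (sign r)) (√approx 5 n) (fromℤ (+ x))))

      power⇒PSD : ¬ (2 ℕ.∣ m ℕ.* 5) → (∀ i → a i ≡ -1ℤ ⊎ a i ≡ 1ℤ) →
        PAF (compress m a) 0F ≡ + 4 ℤ.* + m ℤ.+ 1ℤ →
        PAF (compress m b) 0F ≡ + 4 ℤ.* + m ℤ.+ 1ℤ →
        ∀ x → offset m a ≡ + x → offset m b ≡ ℤ.- + x → PSDCondition π m a b
      power⇒PSD odd binary P₀≡ Q₀≡ x a≡x b≡-x =
        x ,
        subst (λ y → y ≡ ℤ.- ℓ+1 m [mod 4 ]) a≡x (proj₁ congruence) ,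
        subst (λ y → y ≡ ℓ+1 m [mod 4 ]) a≡x (proj₂ congruence) ,
        λ r 1≤r r≤4 →
          limit (~-trans (PSD-from-power m a sum-a≡1 P₀≡ r 1≤r r≤4)
            (pointwise λ n → cong (term r n) a≡x)) ,
          limit (~-trans (PSD-from-power m b sum-b≡1 Q₀≡ r 1≤r r≤4)
            (pointwise λ n → trans (cong (term r n) b≡-x)
              (trans (cong (λ y → fromℤ (ℓ+1 m) + fromℤ (sign r) * √approx 5 n * y)
                  (fromℤ-neg (+ x)))
                (solve 4 (λ l s q y → l :+ s :* q :* :- y := l :+ :- (s :* q :* y))
                  refl (fromℤ (ℓ+1 m)) (fromℤ (sign r)) (√approx 5 n) (fromℤ (+ x))))))
        where
        congruence = offset-mod-4 m odd a binary
        term : ℕ → ℕ → ℤ → ℚ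
        term r n y = fromℤ (ℓ+1 m) + fromℤ (sign r) * √approx 5 n * fromℤ y

open Conditions

-- The two implications and the choice between (a, b) and (b, a).

open import Data.Nat.Base using (_*_)

proposition2 :
    (π : ℝ) → IsPi π →
    (m : ℕ) → ¬ (2 ∣ m * 5) →
    (a b : Fin (m * 5) → ℤ) → LegendrePair a b →
    sumℤ a ≡ 1ℤ → sumℤ b ≡ 1ℤ →
    (PSDCondition π m a b ⊎ PSDCondition π m b a) ⇔ CompressionCondition m a b
proposition2 π isPi m odd a b legendre sum-a≡1 sum-b≡1 = mk⇔ to from
  where
  open Equivalence π isPi
  open LegendrePair legendre
  P₀ Q₀ : ℤ
  P₀ = PAF (compress m a) 0F
  Q₀ = PAF (compress m b) 0F
  compression : P₀ ≡ + (4 * m ℕ.+ 1) → Q₀ ≡ + (4 * m ℕ.+ 1) → CompressionCondition m a b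
  -- `p₂` and `PAF` at lag 0 agree by computation, since `i ⊖ zero` reduces to i at each of the five
  -- indices.
  compression P₀≡ Q₀≡ = refl , trans P₀≡ (sym Q₀≡) , refl , Q₀≡
  to : PSDCondition π m a b ⊎ PSDCondition π m b a → CompressionCondition m a b
  to (inj₁ h) = compression (proj₁ powers) (proj₂ powers)
    where powers = PSD⇒power m sum-a≡1 sum-b≡1 h
  to (inj₂ h) = compression (proj₂ powers) (proj₁ powers)
    where powers = PSD⇒power m sum-b≡1 sum-a≡1 h
  from : CompressionCondition m a b → PSDCondition π m a b ⊎ PSDCondition π m b a
  from (_ , P₀≡Q₀ , _ , Q₀≡) = by-sign (offset m a) refl
    where
    Q₀≡′ : Q₀ ≡ + 4 ℤ.* + m ℤ.+ 1ℤ
    Q₀≡′ = trans Q₀≡ (+[m*n+1] 4 m)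
    P₀≡′ : P₀ ≡ + 4 ℤ.* + m ℤ.+ 1ℤ
    P₀≡′ = trans P₀≡Q₀ Q₀≡′
    offset-b : ∀ {y} → offset m a ≡ y → offset m b ≡ ℤ.- y
    offset-b a≡y = trans (offset-sum m legendre sum-a≡1 sum-b≡1 P₀≡′ Q₀≡′) (cong ℤ.-_ a≡y)
    -- The offsets of a and b are opposite integers, and the vector with the nonnegative one has to
    -- come first.
    by-sign : ∀ y → offset m a ≡ y → PSDCondition π m a b ⊎ PSDCondition π m b a
    by-sign (+ x)    a≡y = inj₁ (power⇒PSD m sum-a≡1 sum-b≡1 odd a-binary
      P₀≡′ Q₀≡′ x a≡y (offset-b a≡y))
    -- Here the offset of b is x + 1. Its congruences come from the entries of b itself, by
    -- `offset-mod-4`.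
    by-sign -[1+ x ] a≡y = inj₂ (power⇒PSD m sum-b≡1 sum-a≡1 odd b-binary
      Q₀≡′ P₀≡′ (suc x) (offset-b a≡y) a≡y)
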